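{- For $n\geq1$, with $N_n(t,q,r)=\sum_{\sigma\in\mathfrak{S}_n(321)}t^{\mathsf{exc}\,\sigma}q^{\mathsf{inv}\,\sigma}r^{\mathsf{fix}\,\sigma}$, $$N_n(t/q, q, 1)=\sum_{k=0}^{\lfloor \frac{n-1}{2}\rfloor}\gamma_{n-1, k}(q)t^k(1+t)^{n-1-2k},$$ where $$\gamma_{n-1, k}(q)=\sum_{\pi\in\widetilde{\mathfrak{S}}_{n-1,k}(321)}q^{\mathsf{inv}\,\pi}=\sum_{\pi\in\widetilde{\mathfrak{S}}_{n-1,k}(231)}q^{(31\text{ - }2)\pi+\mathsf{des}\,\pi}=\sum_{\pi\in\widetilde{\mathfrak{S}}_{n-1,k}(312)}q^{(2\text{ - }31)\pi+\mathsf{des}\,\pi}=\sum_{\pi\in\widetilde{\mathfrak{S}}_{n-1,k}(132)}q^{(2\text{ - }13)\pi+\mathsf{asc}\,\pi}=\sum_{\pi\in\widetilde{\mathfrak{S}}_{n-1,k}(213)}q^{(13\text{ - }2)\pi+\mathsf{asc}\,\pi}.$$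
   Context: $\mathfrak{S}_m(\tau)$ is the set of permutations of $[m]$ avoiding the classical pattern $\tau$. For $\sigma\in\mathfrak{S}_m$: $\mathsf{exc},\mathsf{fix},\mathsf{inv}$ are the numbers of excedances ($\sigma(i)>i$), fixed points and inversions; $\mathsf{des}\,\sigma=\#\{i\in[m-1]:\sigma(i)>\sigma(i+1)\}$, $\mathsf{asc}\,\sigma=\#\{i\in[m-1]:\sigma(i)<\sigma(i+1)\}$. $(31\text{ - }2)\sigma=\#\{(i,j):i+1<j\le m,\ \sigma(i+1)<\sigma(j)<\sigma(i)\}$, $(2\text{ - }31)\sigma=\#\{(i,j):j<i<m,\ \sigma(i+1)<\sigma(j)<\sigma(i)\}$, $(2\text{ - }13)\sigma=\#\{(i,j):j<i<m,\ \sigma(i)<\sigma(j)<\sigma(i+1)\}$, $(13\text{ - }2)\sigma=\#\{(i,j):i+1<j\le m,\ \sigma(i)<\sigma(j)<\sigma(i+1)\}$. $\mathsf{cda}\,\sigma$ is the number of values $x$ with $\sigma^{ -1}(x)<x<\sigma(x)$. $\mathsf{ldd}\,\sigma$ is the number of $i\in[m]$ with $\sigma(i-1)>\sigma(i)>\sigma(i+1)$ under the convention $\sigma(0)=0,\sigma(m+1)=\infty$; $\mathsf{rda}\,\sigma$ is the number of $i\in[m]$ with $\sigma(i-1)<\sigma(i)<\sigma(i+1)$ under the convention $\sigma(0)=\infty,\sigma(m+1)=0$. For $0\le k\le m$: $\widetilde{\mathfrak{S}}_{m,k}(321)=\{\sigma\in\mathfrak{S}_m(321):\mathsf{exc}\,\sigma=k,\mathsf{cda}\,\sigma=0\}$,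 $\widetilde{\mathfrak{S}}_{m,k}(213)=\{\sigma\in\mathfrak{S}_m(213):\mathsf{asc}\,\sigma=k,\mathsf{rda}\,\sigma=0\}$, $\widetilde{\mathfrak{S}}_{m,k}(312)=\{\sigma\in\mathfrak{S}_m(312):\mathsf{des}\,\sigma=k,\mathsf{ldd}\,\sigma=0\}$, $\widetilde{\mathfrak{S}}_{m,k}(132)=\{\sigma\in\mathfrak{S}_m(132):\mathsf{asc}\,\sigma=k,\mathsf{rda}\,\sigma=0\}$, $\widetilde{\mathfrak{S}}_{m,k}(231)=\{\sigma\in\mathfrak{S}_m(231):\mathsf{des}\,\sigma=k,\mathsf{ldd}\,\sigma=0\}$. -}

module Defs where

open import Algebra.Bundles using (CommutativeRing)
open import Data.Fin as Fin using (Fin; zero; suc; toℕ; inject₁; punchIn)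
import Data.Fin.Properties as Fin
open import Data.Fin.Permutation
  using (Permutation′; _⟨$⟩ʳ_; _⟨$⟩ˡ_; _≈_; id; insert; remove; insert-remove)
open import Data.List using (List; []; [_]; map; foldr; filter; length; allFin; cartesianProduct; cartesianProductWith)
open import Data.List.Relation.Unary.All using ([])
open import Data.List.Relation.Unary.AllPairs using ([]; _∷_)
open import Data.List.Relation.Unary.Any using (Any; here)
import Data.List.Relation.Unary.Any.Properties as Any
open import Data.List.Membership.Propositional.Properties using (∈-allFin)
import Data.List.Relation.Unary.Unique.Setoid as UniqueSetoid
import Data.List.Relation.Unary.Unique.Setoid.Properties as UniqueSetoid
import Data.List.Relation.Unary.Unique.Propositional.Properties as Unique
open import Data.Nat as ℕ using (ℕ; zero; suc)
open import Data.Product using (∃; _×_; _,_)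
open import Data.Vec as Vec using (Vec; []; _∷_; _∷ʳ_; lookup; tabulate)
open import Function.Base using (_∘_)
open import Function.Bundles using (_⇔_; Equivalence; mk⇔)
open import Level using (0ℓ)
open import Relation.Binary.Bundles using (Setoid)
open import Relation.Binary.PropositionalEquality using (_≡_; refl; sym; trans; cong; setoid)
open import Relation.Nullary using (Dec; ¬_; ¬?; map′; _×-dec_; _→-dec_)
open import Relation.Unary using (Decidable)

private
  variable
    a p : Level.Level
    A : Set a

-- A permutation σ of [m] is a bijection of Fin m: positions and values both run
-- over 0, …, m-1, so every comparison between them agrees with the 1-based one.
-- σ(i) is σ ⟨$⟩ʳ i, and σ⁻¹(x) is σ ⟨$⟩ˡ x.

-- Every permutation of Fin (suc m) is obtained exactly once by choosing the
-- image j of 0 together with a permutation of the remaining positions and values.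
𝔖 : ∀ m → List (Permutation′ m)
𝔖 zero    = [ id ]
𝔖 (suc m) = cartesianProductWith (insert zero) (allFin (suc m)) (𝔖 m)

≈-setoid : ℕ → Setoid 0ℓ 0ℓ
≈-setoid m = record
  { Carrier       = Permutation′ m
  ; _≈_           = _≈_
  ; isEquivalence = record
    { refl  = λ _ → refl
    ; sym   = λ π≈ρ i → sym (π≈ρ i)
    ; trans = λ π≈ρ ρ≈σ i → trans (π≈ρ i) (ρ≈σ i)
    }
  }

𝔖-complete : ∀ m (σ : Permutation′ m) → Any (σ ≈_) (𝔖 m)
𝔖-complete zero    σ = here λ ()
𝔖-complete (suc m) σ =
  Any.cartesianProductWith⁺ (insert zero) step
    (∈-allFin (σ ⟨$⟩ʳ zero)) (𝔖-complete m (remove zero σ))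
  where
  step : ∀ {j ρ} → σ ⟨$⟩ʳ zero ≡ j → remove zero σ ≈ ρ → σ ≈ insert zero j ρ
  step         refl _ zero    = refl
  step {ρ = ρ} refl e (suc i) =
    trans (sym (insert-remove zero σ (suc i)))
          (cong (punchIn (σ ⟨$⟩ʳ zero)) (e i))

𝔖-unique : ∀ m → UniqueSetoid.Unique (≈-setoid m) (𝔖 m)
𝔖-unique zero    = [] ∷ []
𝔖-unique (suc m) =
  UniqueSetoid.cartesianProductWith⁺ (setoid (Fin (suc m))) (≈-setoid m) (≈-setoid (suc m))
    (insert zero) (λ {_} {_} {ρ} {π} → inj ρ π) (Unique.allFin⁺ (suc m)) (𝔖-unique m)
  where
  inj : ∀ {j k} ρ π → insert zero j ρ ≈ insert zero k π → j ≡ k × ρ ≈ π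
  inj {j} ρ π e with refl ← e zero = refl , λ i → Fin.punchIn-injective j _ _ (e (suc i))

∃-Vec? : ∀ {n} k {P : Vec (Fin n) k → Set p} → Decidable P → Dec (∃ P)
∃-Vec? zero    P? = map′ ([] ,_) (λ { ([] , p) → p }) (P? [])
∃-Vec? (suc k) P? = map′ (λ (i , v , p) → i ∷ v , p) (λ { (i ∷ v , p) → i , v , p })
  (Fin.any? λ i → ∃-Vec? k (P? ∘ (i ∷_)))

_⇔-dec_ : ∀ {b} {B : Set b} → Dec A → Dec B → Dec (A ⇔ B)
a? ⇔-dec b? = map′ (λ (f , g) → mk⇔ f g) (λ e → Equivalence.to e , Equivalence.from e)
  ((a? →-dec b?) ×-dec (b? →-dec a?))

module _ {k m : ℕ} (τ : Vec ℕ k) (σ : Permutation′ m) where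

  -- v lists the positions of an occurrence of the pattern τ in σ.
  Occurrence : Vec (Fin m) k → Set
  Occurrence v =
      (∀ a b → a Fin.< b → lookup v a Fin.< lookup v b)
    × (∀ a b → ((σ ⟨$⟩ʳ lookup v a) Fin.< (σ ⟨$⟩ʳ lookup v b)) ⇔ (lookup τ a ℕ.< lookup τ b))

  Avoids : Set
  Avoids = ¬ ∃ Occurrence

  occurrence? : Decidable Occurrence
  occurrence? v =
    (Fin.all? λ a → Fin.all? λ b → (a Fin.<? b) →-dec (lookup v a Fin.<? lookup v b))
    ×-dec
    (Fin.all? λ a → Fin.all? λ b →
      ((σ ⟨$⟩ʳ lookup v a) Fin.<? (σ ⟨$⟩ʳ lookup v b)) ⇔-dec (lookup τ a ℕ.<? lookup τ b))

  avoids? : Dec Avoids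
  avoids? = ¬? (∃-Vec? k occurrence?)

𝔖[_]_ : ∀ {k} → Vec ℕ k → ∀ m → List (Permutation′ m)
𝔖[ τ ] m = filter (avoids? τ) (𝔖 m)

pat321 pat213 pat312 pat132 pat231 : Vec ℕ 3
pat321 = 3 ∷ 2 ∷ 1 ∷ []
pat213 = 2 ∷ 1 ∷ 3 ∷ []
pat312 = 3 ∷ 1 ∷ 2 ∷ []
pat132 = 1 ∷ 3 ∷ 2 ∷ []
pat231 = 2 ∷ 3 ∷ 1 ∷ []

# : {P : A → Set p} → Decidable P → List A → ℕ
# P? xs = length (filter P? xs)

-- The pairs (i , i+1) of consecutive positions.
steps : ∀ m → List (Fin m × Fin m)
steps zero    = []
steps (suc m) = map (λ i → inject₁ i , suc i) (allFin m)

module _ {m : ℕ} (σ : Permutation′ m) where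

  private
    σ⟨_⟩ : Fin m → Fin m
    σ⟨ i ⟩ = σ ⟨$⟩ʳ i

    σ⁻¹⟨_⟩ : Fin m → Fin m
    σ⁻¹⟨ x ⟩ = σ ⟨$⟩ˡ x

  exc fix inv des asc : ℕ
  exc = # (λ i → i Fin.<? σ⟨ i ⟩) (allFin m)
  fix = # (λ i → σ⟨ i ⟩ Fin.≟ i) (allFin m)
  inv = # (λ (i , j) → (i Fin.<? j) ×-dec (σ⟨ j ⟩ Fin.<? σ⟨ i ⟩))
          (cartesianProduct (allFin m) (allFin m))
  des = # (λ (i , i⁺) → σ⟨ i⁺ ⟩ Fin.<? σ⟨ i ⟩) (steps m)
  asc = # (λ (i , i⁺) → σ⟨ i ⟩ Fin.<? σ⟨ i⁺ ⟩) (steps m)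

  31-2 2-31 2-13 13-2 : ℕ
  31-2 = # (λ ((i , i⁺) , j) → (i⁺ Fin.<? j) ×-dec (σ⟨ i⁺ ⟩ Fin.<? σ⟨ j ⟩) ×-dec (σ⟨ j ⟩ Fin.<? σ⟨ i ⟩))
           (cartesianProduct (steps m) (allFin m))
  2-31 = # (λ ((i , i⁺) , j) → (j Fin.<? i) ×-dec (σ⟨ i⁺ ⟩ Fin.<? σ⟨ j ⟩) ×-dec (σ⟨ j ⟩ Fin.<? σ⟨ i ⟩))
           (cartesianProduct (steps m) (allFin m))
  2-13 = # (λ ((i , i⁺) , j) → (j Fin.<? i) ×-dec (σ⟨ i ⟩ Fin.<? σ⟨ j ⟩) ×-dec (σ⟨ j ⟩ Fin.<? σ⟨ i⁺ ⟩))
           (cartesianProduct (steps m) (allFin m))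
  13-2 = # (λ ((i , i⁺) , j) → (i⁺ Fin.<? j) ×-dec (σ⟨ i ⟩ Fin.<? σ⟨ j ⟩) ×-dec (σ⟨ j ⟩ Fin.<? σ⟨ i⁺ ⟩))
           (cartesianProduct (steps m) (allFin m))

  cda : ℕ
  cda = # (λ x → (σ⁻¹⟨ x ⟩ Fin.<? x) ×-dec (x Fin.<? σ⟨ x ⟩)) (allFin m)

  -- The word σ(0) σ(1) … σ(m) σ(m+1) with values in [m] and with the given
  -- boundary values l = σ(0) and r = σ(m+1); its entries are indexed by 0, …, m+1.
  bordered : ℕ → ℕ → Vec ℕ (suc (suc m))
  bordered l r = l ∷ (tabulate (suc ∘ toℕ ∘ σ⟨_⟩) ∷ʳ r)

  -- m+1 exceeds every value of σ and so stands for ∞. The index i : Fin m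
  -- below refers to position i+1 of the 1-based word.
  ldd rda : ℕ
  ldd = # (λ i → (w (inject₁ (suc i)) ℕ.<? w (inject₁ (inject₁ i)))
                 ×-dec (w (suc (suc i)) ℕ.<? w (inject₁ (suc i))))
          (allFin m)
    where
    w : Fin (suc (suc m)) → ℕ
    w = lookup (bordered 0 (suc m))
  rda = # (λ i → (w (inject₁ (inject₁ i)) ℕ.<? w (inject₁ (suc i)))
                 ×-dec (w (inject₁ (suc i)) ℕ.<? w (suc (suc i))))
          (allFin m)
    where
    w : Fin (suc (suc m)) → ℕ
    w = lookup (bordered (suc m) 0)

𝔖̃321 𝔖̃213 𝔖̃312 𝔖̃132 𝔖̃231 : (m k : ℕ) → List (Permutation′ m)
𝔖̃321 m k = filter (λ σ → (exc σ ℕ.≟ k) ×-dec (cda σ ℕ.≟ 0)) (𝔖[ pat321 ] m)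
𝔖̃213 m k = filter (λ σ → (asc σ ℕ.≟ k) ×-dec (rda σ ℕ.≟ 0)) (𝔖[ pat213 ] m)
𝔖̃312 m k = filter (λ σ → (des σ ℕ.≟ k) ×-dec (ldd σ ℕ.≟ 0)) (𝔖[ pat312 ] m)
𝔖̃132 m k = filter (λ σ → (asc σ ℕ.≟ k) ×-dec (rda σ ℕ.≟ 0)) (𝔖[ pat132 ] m)
𝔖̃231 m k = filter (λ σ → (des σ ℕ.≟ k) ×-dec (ldd σ ℕ.≟ 0)) (𝔖[ pat231 ] m)

-- Polynomials are represented by their values at arbitrary elements of a
-- commutative ring R; an identity holding for all R and all elements is the
-- polynomial identity (take R to be the polynomial ring itself).
module GeneratingFunctions {c ℓ} (R : CommutativeRing c ℓ) where

  open CommutativeRing R using (Carrier; _+_; _*_; 0#; semiring)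
  open import Algebra.Properties.Semiring.Exp semiring public using (_^_)

  ∑ : List A → (A → Carrier) → Carrier
  ∑ xs f = foldr _+_ 0# (map f xs)

  syntax ∑ xs (λ x → e) = ∑[ x ∈ xs ] e

  N : ℕ → Carrier → Carrier → Carrier → Carrier
  N n t q r = ∑[ σ ∈ 𝔖[ pat321 ] n ] (t ^ exc σ * q ^ inv σ * r ^ fix σ)

  γ : ℕ → ℕ → Carrier → Carrier
  γ m k q = ∑[ π ∈ 𝔖̃321 m k ] (q ^ inv π)

{-# OPTIONS --safe #-}

-- A permutation σ is encoded by its Lehmer code: σ(1) followed by the code of the
-- word obtained by deleting σ(1) and standardizing. For σ avoiding 321, inv is the sum
-- of the code, exc the number of its nonzero entries, and cda the number of nonzero
-- entries j whose j-th successor is nonzero as well. For every σ, (31-2) + des is the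
-- total drop of the code at its descents.
--
-- Reading the code of a 321-avoiding σ from left to right, one keeps the list of those
-- forthcoming values that have been used already. Postponing the choice of the value
-- of each excedance until that value is reached turns this list into a number, and the
-- generating function into a weighted sum E over Motzkin paths. For 231 the remaining
-- values form consecutive blocks, and in the absence of double descents these obey the
-- first-return decomposition of the same Motzkin paths. The other three patterns are
-- images of 231 under reversal and complementation.
--
-- With cda unrestricted, E is the even contraction of a Dyck path sum whose odd
-- contraction has level steps of weight (1+t) qʰ; expanding the latter by the number
-- of up steps gives the γ-expansion.

module Submission where

open import Defs
open import Algebra.Bundles using (CommutativeRing)
open import Data.Bool using (Bool; true; false; if_then_else_; T; _∧_; _∨_)
open import Data.Bool.Properties using (∧-zeroʳ; ∧-identityʳ)
open import Data.Fin as Fin using (Fin; zero; suc; toℕ; fromℕ; inject₁; fromℕ<; punchIn; opposite)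
import Data.Fin.Properties as Fin
open import Data.Fin.Patterns using (0F; 1F; 2F)
open import Data.Fin.Permutation as Perm
  using (Permutation′; _⟨$⟩ʳ_; _⟨$⟩ˡ_; _∘ₚ_; insert; remove; inverseˡ; inverseʳ; punchIn-permute; remove-insert)
  renaming (_≈_ to _≈ₚ_)
open import Data.Fin.Relation.Unary.Top using (view; ‵fromℕ; ‵inject₁)
open import Data.List as List
  using (List; []; _∷_; _++_; map; filter; foldr; length; replicate; allFin; upTo; applyUpTo;
         cartesianProduct; cartesianProductWith)
import Data.List.Properties as List
import Data.List.Membership.Setoid as SetoidMembership
import Data.List.Membership.Setoid.Properties as SetoidMembershipₚ
open import Data.List.Membership.Propositional using (_∈_)
open import Data.List.Membership.Propositional.Properties
  using (∈-allFin; ∈-map⁺; ∈-map⁻; ∈-cartesianProduct⁺; ∈-cartesianProduct⁻)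
import Data.List.Relation.Binary.Permutation.Setoid as SetoidPermutation
import Data.List.Relation.Binary.Permutation.Setoid.Properties as SetoidPermutationₚ
open import Data.List.Relation.Unary.All as All using (_∷_)
open import Data.List.Relation.Unary.AllPairs using ([]; _∷_)
open import Data.List.Relation.Unary.Any using (here; there)
import Data.List.Relation.Unary.Unique.Setoid as UniqueSetoid
import Data.List.Relation.Unary.Unique.Setoid.Properties as UniqueSetoidₚ
open import Data.List.Relation.Unary.Unique.Propositional using (Unique)
import Data.List.Relation.Unary.Unique.Propositional.Properties as Unique
open import Data.Nat as ℕ using (ℕ; zero; suc; _≤_; _<_; z≤n; s≤s; s≤s⁻¹; _∸_; ⌊_/2⌋)
import Data.Nat.Induction as ℕ
open import Data.Nat.ListAction using (sum)
import Data.Nat.Properties as ℕ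
import Data.Nat.Solver as ℕ
open import Data.Product using (_×_; _,_; proj₁; proj₂; ∃)
open import Data.Sum using (_⊎_; inj₁; inj₂; [_,_]′)
open import Data.Unit using (⊤; tt)
open import Data.Vec using (Vec; []; _∷_; _∷ʳ_; lookup; tabulate)
import Data.Vec.Properties as Vec
open import Function.Base using (_∘_; case_of_)
open import Function.Bundles using (_⇔_; Equivalence; mk⇔)
open import Function.Construct.Composition using (_⇔-∘_)
open import Function.Definitions using (Injective)
open import Level using (Level)
open import Relation.Binary using (Setoid; tri<; tri≈; tri>)
open import Relation.Binary.PropositionalEquality as ≡ using (_≡_; _≢_)
open import Relation.Nullary using (Dec; does; yes; no; ¬_; contradiction; _×-dec_; _⊎-dec_)
open import Relation.Nullary.Decidable using (dec-true; dec-false; does-⇔; T?)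
open import Relation.Unary using (Decidable)

-- Polynomials are represented by their values, so coefficients of `t` cannot be compared. The
-- recursions therefore carry an arbitrary function `f` of the number of excedances or descents:
-- `f = δ k` singles out the permutations with `k` of them, while the powers of `t * q⁻¹` yield the
-- whole generating function. In the same way `z` marks cyclic double ascents: `z = 1#` ignores them
-- and `z = 0#` forbids them, `0# ^ d` being the indicator of `d = 0`. One path sum thus serves both
-- sides of the expansion. Deleting the first entry of a permutation destroys two kinds of
-- information: how the remaining values lie relative to the deleted ones, on which avoidance
-- depends, and which values sit to the left of their own position, on which cyclic double ascents
-- depend. A threshold or a list of block boundaries retains the former, marks on values the latter.
-- The statements about codes are proved for permutations in an arbitrary state of this kind and
-- specialized to the initial one.

tail : List Bool → List Bool
tail []       = []
tail (_ ∷ bs) = bs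

head : List Bool → Bool
head []      = false
head (b ∷ _) = b

-- Sets the mark at position j, for j beyond the marked range.
pad : List Bool → ℕ → List Bool
pad []       zero    = true ∷ []
pad []       (suc j) = false ∷ pad [] j
pad (b ∷ bs) zero    = true ∷ []
pad (b ∷ bs) (suc j) = b ∷ pad bs j

length-pad : ∀ bs j → length (pad bs j) ≡ suc j
length-pad []       zero    = ≡.refl
length-pad []       (suc j) = ≡.cong suc (length-pad [] j)
length-pad (b ∷ bs) zero    = ≡.refl
length-pad (b ∷ bs) (suc j) = ≡.cong suc (length-pad bs j)

split-size : ∀ j s n → j ≤ s → j ℕ.+ (s ∸ j ℕ.+ n) ≡ s ℕ.+ n
split-size j s n le = ≡.trans (≡.sym (ℕ.+-assoc j (s ∸ j) n)) (≡.cong (ℕ._+ n) (ℕ.m+[n∸m]≡n le))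

-- Motzkin path sums

module PathSums {c ℓ} (R : CommutativeRing c ℓ) where

  open CommutativeRing R hiding (zero)
  open GeneratingFunctions R using (_^_)
  open import Algebra.Properties.Semiring.Exp semiring using (^-homo-*; ^-congʳ)
  open import Algebra.Solver.Ring.NaturalCoefficients.Default commutativeSemiring
    using (solve; _:+_; _:*_; _:=_; con)
  open import Relation.Binary.Reasoning.Setoid setoid

  +-interchange : ∀ a b c d → (a + b) + (c + d) ≈ (a + c) + (b + d)
  +-interchange = solve 4 (λ a b c d → (a :+ b) :+ (c :+ d) := (a :+ c) :+ (b :+ d)) refl

  Σ< : ℕ → (ℕ → Carrier) → Carrier
  Σ< zero    F = 0#
  Σ< (suc n) F = F 0 + Σ< n (F ∘ suc)

  Σ<-cong : ∀ n {F G : ℕ → Carrier} → (∀ i → i < n → F i ≈ G i) → Σ< n F ≈ Σ< n G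
  Σ<-cong zero    F≈G = refl
  Σ<-cong (suc n) F≈G = +-cong (F≈G 0 (s≤s z≤n)) (Σ<-cong n λ i i<n → F≈G (suc i) (s≤s i<n))

  Σ<-0 : ∀ n {F : ℕ → Carrier} → (∀ i → i < n → F i ≈ 0#) → Σ< n F ≈ 0#
  Σ<-0 zero    F≈0 = refl
  Σ<-0 (suc n) F≈0 = trans (+-cong (F≈0 0 (s≤s z≤n)) (Σ<-0 n λ i i<n → F≈0 (suc i) (s≤s i<n)))
                           (+-identityˡ 0#)

  Σ<-+ : ∀ n (F G : ℕ → Carrier) → Σ< n (λ i → F i + G i) ≈ Σ< n F + Σ< n G
  Σ<-+ zero    F G = sym (+-identityˡ 0#)
  Σ<-+ (suc n) F G = trans (+-congˡ (Σ<-+ n (F ∘ suc) (G ∘ suc))) (+-interchange _ _ _ _)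

  *-Σ< : ∀ n a (F : ℕ → Carrier) → Σ< n (λ i → a * F i) ≈ a * Σ< n F
  *-Σ< zero    a F = sym (zeroʳ a)
  *-Σ< (suc n) a F = trans (+-congˡ (*-Σ< n a (F ∘ suc))) (sym (distribˡ a _ _))

  -- Σ of g i j over i + j + 1 = m.
  conv : (ℕ → ℕ → Carrier) → ℕ → Carrier
  conv g zero    = 0#
  conv g (suc m) = g 0 m + conv (λ i j → g (suc i) j) m

  conv-cong : ∀ m {g h : ℕ → ℕ → Carrier} →
    (∀ i j → suc (i ℕ.+ j) ≡ m → g i j ≈ h i j) → conv g m ≈ conv h m
  conv-cong zero    g≈h = refl
  conv-cong (suc m) g≈h =
    +-cong (g≈h 0 m ≡.refl) (conv-cong m λ i j e → g≈h (suc i) j (≡.cong suc e))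

  conv-+ : ∀ m (g h : ℕ → ℕ → Carrier) → conv (λ i j → g i j + h i j) m ≈ conv g m + conv h m
  conv-+ zero    g h = sym (+-identityˡ 0#)
  conv-+ (suc m) g h = trans (+-congˡ (conv-+ m (g ∘ suc) (h ∘ suc))) (+-interchange _ _ _ _)

  *-conv : ∀ m a (g : ℕ → ℕ → Carrier) → conv (λ i j → a * g i j) m ≈ a * conv g m
  *-conv zero    a g = sym (zeroʳ a)
  *-conv (suc m) a g = trans (+-congˡ (*-conv m a (g ∘ suc))) (sym (distribˡ a _ _))

  -- Both sides range over `a + b + j + 2 = m`. This regroups two successive first returns of a
  -- path.
  conv-assoc : ∀ m (h : ℕ → ℕ → ℕ → Carrier) →
    conv (λ i j → conv (λ a b → h a b j) i) m ≈ conv (λ a l → conv (λ b j → h a b j) l) m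
  conv-assoc zero    h = refl
  conv-assoc (suc m) h = begin
    0# + conv (λ i j → h 0 i j + conv (λ a b → h (suc a) b j) i) m
      ≈⟨ +-identityˡ _ ⟩
    conv (λ i j → h 0 i j + conv (λ a b → h (suc a) b j) i) m
      ≈⟨ conv-+ m (h 0) _ ⟩
    conv (h 0) m + conv (λ i j → conv (λ a b → h (suc a) b j) i) m
      ≈⟨ +-congˡ (conv-assoc m (h ∘ suc)) ⟩
    conv (h 0) m + conv (λ a l → conv (λ b j → h (suc a) b j) l) m ∎

  conv-Σ< : ∀ s (g : ℕ → ℕ → Carrier) → conv g s ≈ Σ< s (λ i → g i (s ∸ suc i))
  conv-Σ< zero    g = refl
  conv-Σ< (suc s) g = +-congˡ (conv-Σ< s (g ∘ suc))

  module Motzkin (q z : Carrier) where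

    -- Sum over the Motzkin paths of length m from height h to 0. A path with e up
    -- steps and special level steps in total has the factor f e, special level steps
    -- only occur at positive height and carry the factor z, and each step starting
    -- at height k carries the factor q ^ k.
    E : (ℕ → Carrier) → ℕ → ℕ → Carrier
    E f zero    zero    = f 0
    E f zero    (suc k) = 0#
    E f (suc m) zero    = E f m 0 + E (f ∘ suc) m 1
    E f (suc m) (suc k) = q ^ suc k *
      (E f m (suc k) + z * E (f ∘ suc) m (suc k) + E (f ∘ suc) m (suc (suc k)) + E f m k)

    E-cong : ∀ m h {f g : ℕ → Carrier} → (∀ e → f e ≈ g e) → E f m h ≈ E g m h
    E-cong zero    zero    f≈g = f≈g 0
    E-cong zero    (suc k) f≈g = refl
    E-cong (suc m) zero    f≈g = +-cong (E-cong m 0 f≈g) (E-cong m 1 (f≈g ∘ suc))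
    E-cong (suc m) (suc k) f≈g = *-congˡ (+-cong (+-cong (+-cong
      (E-cong m (suc k) f≈g) (*-congˡ (E-cong m (suc k) (f≈g ∘ suc))))
      (E-cong m (suc (suc k)) (f≈g ∘ suc))) (E-cong m k f≈g))

    E-+ : ∀ m h (f g : ℕ → Carrier) → E (λ e → f e + g e) m h ≈ E f m h + E g m h
    E-+ zero    zero    f g = refl
    E-+ zero    (suc k) f g = sym (+-identityˡ 0#)
    E-+ (suc m) zero    f g =
      trans (+-cong (E-+ m 0 f g) (E-+ m 1 (f ∘ suc) (g ∘ suc))) (+-interchange _ _ _ _)
    E-+ (suc m) (suc k) f g = trans
      (*-congˡ (+-cong (+-cong (+-cong
        (E-+ m (suc k) f g) (*-congˡ (E-+ m (suc k) (f ∘ suc) (g ∘ suc))))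
        (E-+ m (suc (suc k)) (f ∘ suc) (g ∘ suc))) (E-+ m k f g)))
      (solve 10 (λ p z a a' b b' c c' d d' →
        p :* (a :+ a' :+ z :* (b :+ b') :+ (c :+ c') :+ (d :+ d'))
        := p :* (a :+ z :* b :+ c :+ d) :+ p :* (a' :+ z :* b' :+ c' :+ d')) refl
        (q ^ suc k) z _ _ _ _ _ _ _ _)

    E-* : ∀ m h a (f : ℕ → Carrier) → E (λ e → a * f e) m h ≈ a * E f m h
    E-* zero    zero    a f = refl
    E-* zero    (suc k) a f = sym (zeroʳ a)
    E-* (suc m) zero    a f =
      trans (+-cong (E-* m 0 a f) (E-* m 1 a (f ∘ suc))) (sym (distribˡ a _ _))
    E-* (suc m) (suc k) a f = trans
      (*-congˡ (+-cong (+-cong (+-cong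
        (E-* m (suc k) a f) (*-congˡ (E-* m (suc k) a (f ∘ suc))))
        (E-* m (suc (suc k)) a (f ∘ suc))) (E-* m k a f)))
      (solve 7 (λ p z x a b c d →
        p :* (x :* a :+ z :* (x :* b) :+ x :* c :+ x :* d)
        := x :* (p :* (a :+ z :* b :+ c :+ d))) refl
        (q ^ suc k) z a _ _ _ _)

    E-0 : ∀ m h → E (λ _ → 0#) m h ≈ 0#
    E-0 m h = begin
      E (λ _ → 0#) m h       ≈⟨ E-cong m h (λ _ → sym (zeroˡ 0#)) ⟩
      E (λ _ → 0# * 0#) m h  ≈⟨ E-* m h 0# (λ _ → 0#) ⟩
      0# * E (λ _ → 0#) m h  ≈⟨ zeroˡ _ ⟩
      0#                     ∎

    E-conv : ∀ m h n (g : ℕ → ℕ → ℕ → Carrier) →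
      E (λ e → conv (g e) n) m h ≈ conv (λ i j → E (λ e → g e i j) m h) n
    E-conv m h zero    g = E-0 m h
    E-conv m h (suc n) g = trans (E-+ m h _ _) (+-congˡ (E-conv m h n (λ e → g e ∘ suc)))

    E-Σ< : ∀ m h n (g : ℕ → ℕ → Carrier) →
      E (λ e → Σ< n (g e)) m h ≈ Σ< n (λ i → E (λ e → g e i) m h)
    E-Σ< m h zero    g = E-0 m h
    E-Σ< m h (suc n) g = trans (E-+ m h _ _) (+-congˡ (E-Σ< m h n (λ e → g e ∘ suc)))

    ζ : Bool → Carrier
    ζ true  = z
    ζ false = 1#

    -- As E, when bs records which of the next values are already used and k excedances
    -- are waiting for values beyond these. The latter pay for the range of bs in advance.
    V : (ℕ → Carrier) → ℕ → ℕ → List Bool → Carrier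
    V f m       k []       = E f m k
    V f zero    k (b ∷ bs) = 0#
    V f (suc m) k (b ∷ bs) = V f m k bs + ζ b * (q ^ length bs * V (f ∘ suc) m (suc k) bs)

    _◂_ : List Bool → ℕ → List Bool
    bs ◂ d = bs ++ replicate d false ++ true ∷ []

    length-◂ : ∀ bs d → length (bs ◂ d) ≡ length bs ℕ.+ suc d
    length-◂ (b ∷ bs) d       = ≡.cong suc (length-◂ bs d)
    length-◂ []       zero    = ≡.refl
    length-◂ []       (suc d) = ≡.cong suc (length-◂ [] d)

    -- The first waiting excedance takes the value d positions beyond the range of bs; all
    -- k + 1 of them pay for the d + 1 positions.
    V-resolve : ∀ f m k bs →
      V f m (suc k) bs ≈ Σ< (m ∸ length bs) (λ d → q ^ (suc d ℕ.* suc k) * V f m k (bs ◂ d))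
    V-resolve f zero    k []       = refl
    V-resolve f zero    k (b ∷ bs) = refl
    V-resolve f (suc m) k (b ∷ bs) = sym (begin
      Σ< n (λ d → Q d * (V f m k (bs ◂ d) + ζ b * (q ^ length (bs ◂ d) * V f′ m (suc k) (bs ◂ d))))
        ≈⟨ Σ<-cong n (λ d _ → split d) ⟩
      Σ< n (λ d → Q d * V f m k (bs ◂ d) + ζ b * (p * (Q′ d * V f′ m (suc k) (bs ◂ d))))
        ≈⟨ Σ<-+ n _ _ ⟩
      Σ< n (λ d → Q d * V f m k (bs ◂ d)) + Σ< n (λ d → ζ b * (p * (Q′ d * V f′ m (suc k) (bs ◂ d))))
        ≈⟨ +-cong (sym (V-resolve f m k bs)) (begin
             _ ≈⟨ *-Σ< n (ζ b) _ ⟩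
             _ ≈⟨ *-congˡ (*-Σ< n p _) ⟩
             _ ≈⟨ *-congˡ (*-congˡ (V-resolve f′ m (suc k) bs)) ⟨
             _ ∎) ⟩
      V f m (suc k) bs + ζ b * (p * V f′ m (suc (suc k)) bs) ∎)
      where
      n = m ∸ length bs
      p = q ^ length bs
      f′ = f ∘ suc
      Q Q′ : ℕ → Carrier
      Q d = q ^ (suc d ℕ.* suc k)
      Q′ d = q ^ (suc d ℕ.* suc (suc k))
      -- The new excedance pays up front for `bs`, and for the `d + 1` further positions just like
      -- the `k + 1` earlier ones.
      exponents : ∀ d → Q d * q ^ length (bs ◂ d) ≈ p * Q′ d
      exponents d = begin
        Q d * q ^ length (bs ◂ d)  ≈⟨ ^-homo-* q (suc d ℕ.* suc k) _ ⟨
        q ^ (suc d ℕ.* suc k ℕ.+ length (bs ◂ d))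
          ≈⟨ ^-congʳ q (≡.trans (≡.cong (suc d ℕ.* suc k ℕ.+_) (length-◂ bs d))
               (lem d k (length bs))) ⟩
        q ^ (length bs ℕ.+ suc d ℕ.* suc (suc k)) ≈⟨ ^-homo-* q (length bs) _ ⟩
        p * Q′ d ∎
        where
        open ℕ.+-*-Solver using () renaming (solve to solveℕ; _:+_ to _⊕_; _:*_ to _⊗_; _:=_ to _⊜_; con to ‵_)
        lem : ∀ d k l → suc d ℕ.* suc k ℕ.+ (l ℕ.+ suc d) ≡ l ℕ.+ suc d ℕ.* suc (suc k)
        lem = solveℕ 3 (λ d k l → (‵ 1 ⊕ d) ⊗ (‵ 1 ⊕ k) ⊕ (l ⊕ (‵ 1 ⊕ d))
                ⊜ l ⊕ (‵ 1 ⊕ d) ⊗ (‵ 2 ⊕ k)) ≡.refl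
      split : ∀ d → Q d * (V f m k (bs ◂ d) + ζ b * (q ^ length (bs ◂ d) * V f′ m (suc k) (bs ◂ d)))
                  ≈ Q d * V f m k (bs ◂ d) + ζ b * (p * (Q′ d * V f′ m (suc k) (bs ◂ d)))
      split d = begin
        _ ≈⟨ solve 5 (λ Q v ζ r w → Q :* (v :+ ζ :* (r :* w)) := Q :* v :+ ζ :* ((Q :* r) :* w)) refl
               (Q d) _ (ζ b) (q ^ length (bs ◂ d)) _ ⟩
        _ ≈⟨ +-congˡ (*-congˡ (trans (*-congʳ (exponents d)) (*-assoc _ _ _))) ⟩
        _ ∎
    V-resolve f (suc m) k [] = sym (begin
      q ^ (suc 0 ℕ.* suc k) * (E f m k + z * (1# * E f′ m (suc k)))
        + Σ< m (λ d → Q (suc d) * (V f m k ([] ◂ d) + 1# * (q ^ length ([] ◂ d) * V f′ m (suc k) ([] ◂ d))))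
        ≈⟨ +-cong (*-cong (^-congʳ q (ℕ.*-identityˡ (suc k))) refl) (Σ<-cong m λ d _ → split d) ⟩
      p * (E f m k + z * (1# * E f′ m (suc k)))
        + Σ< m (λ d → p * (Q d * V f m k ([] ◂ d)) + p * (Q′ d * V f′ m (suc k) ([] ◂ d)))
        ≈⟨ +-congˡ (Σ<-+ m _ _) ⟩
      _ ≈⟨ +-congˡ (+-cong (*-Σ< m p _) (*-Σ< m p _)) ⟩
      _ ≈⟨ +-congˡ (+-cong (*-congˡ (V-resolve f m k [])) (*-congˡ (V-resolve f′ m (suc k) []))) ⟨
      -- The summand `d = 0` hands the next value to a waiting excedance: a down step or, if the
      -- next position is an excedance as well, a special level step. The summands `d > 0` keep all
      -- excedances waiting: a level step or an up step.
      p * (E f m k + z * (1# * E f′ m (suc k))) + (p * E f m (suc k) + p * E f′ m (suc (suc k)))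
        ≈⟨ solve 6 (λ p z a b c d → p :* (a :+ z :* (con 1 :* b)) :+ (p :* c :+ p :* d)
             := p :* (c :+ z :* b :+ d :+ a)) refl p z _ _ _ _ ⟩
      E f (suc m) (suc k) ∎)
      where
      p = q ^ suc k
      f′ = f ∘ suc
      Q Q′ : ℕ → Carrier
      Q d = q ^ (suc d ℕ.* suc k)
      Q′ d = q ^ (suc d ℕ.* suc (suc k))
      exponents : ∀ d → Q (suc d) * q ^ length ([] ◂ d) ≈ p * Q′ d
      exponents d = begin
        Q (suc d) * q ^ length ([] ◂ d)  ≈⟨ ^-homo-* q (suc (suc d) ℕ.* suc k) _ ⟨
        q ^ (suc (suc d) ℕ.* suc k ℕ.+ length ([] ◂ d))
          ≈⟨ ^-congʳ q (≡.trans (≡.cong (suc (suc d) ℕ.* suc k ℕ.+_) (length-◂ [] d)) (lem d k)) ⟩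
        q ^ (suc k ℕ.+ suc d ℕ.* suc (suc k)) ≈⟨ ^-homo-* q (suc k) _ ⟩
        p * Q′ d ∎
        where
        open ℕ.+-*-Solver using () renaming (solve to solveℕ; _:+_ to _⊕_; _:*_ to _⊗_; _:=_ to _⊜_; con to ‵_)
        lem : ∀ d k → suc (suc d) ℕ.* suc k ℕ.+ suc d ≡ suc k ℕ.+ suc d ℕ.* suc (suc k)
        lem = solveℕ 2 (λ d k → (‵ 2 ⊕ d) ⊗ (‵ 1 ⊕ k) ⊕ (‵ 1 ⊕ d)
                ⊜ (‵ 1 ⊕ k) ⊕ (‵ 1 ⊕ d) ⊗ (‵ 2 ⊕ k)) ≡.refl
      split : ∀ d →
        Q (suc d) * (V f m k ([] ◂ d) + 1# * (q ^ length ([] ◂ d) * V f′ m (suc k) ([] ◂ d)))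
          ≈ p * (Q d * V f m k ([] ◂ d)) + p * (Q′ d * V f′ m (suc k) ([] ◂ d))
      split d = begin
        _ ≈⟨ solve 4 (λ Q v r w → Q :* (v :+ con 1 :* (r :* w)) := Q :* v :+ (Q :* r) :* w) refl
               (Q (suc d)) _ (q ^ length ([] ◂ d)) _ ⟩
        _ ≈⟨ +-cong (trans (*-congʳ (^-homo-* q (suc k) (suc d ℕ.* suc k))) (*-assoc _ _ _))
                    (trans (*-congʳ (exponents d)) (*-assoc _ _ _)) ⟩
        _ ∎

  open ℕ.+-*-Solver using () renaming (solve to solveℕ; _:+_ to _⊕_; _:*_ to _⊗_; _:=_ to _⊜_; con to ‵_)

  -- Motzkin paths without special level steps

  module Restricted (q : Carrier) where

    open Motzkin q 0# public

    E-suc : ∀ f m k → E f (suc m) (suc k) ≈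
      q ^ suc k * E f m (suc k) + q ^ suc k * E (f ∘ suc) m (suc (suc k)) + q ^ suc k * E f m k
    E-suc f m k = trans (*-congˡ (+-congʳ (+-congʳ (trans (+-congˡ (zeroˡ _)) (+-identityʳ _)))))
      (solve 4 (λ p a b c → p :* (a :+ b :+ c) := p :* a :+ p :* b :+ p :* c) refl _ _ _ _)

    -- An excursion of length `i` is raised by `suc k`, so each of its `i` steps and the down step
    -- after it gain `q ^ suc k`. Raising preserves the step weights only for `z = 0#`: otherwise
    -- the raised excursion could use special level steps at its base, while the original one has
    -- none at height 0.
    FirstReturn : ℕ → Set _
    FirstReturn m = ∀ f k → E f m (suc k) ≈
      conv (λ i j → q ^ (suc k ℕ.* suc i) * E (λ e → E (λ e′ → f (e ℕ.+ e′)) j k) i 0) m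

    -- Decomposition of a path at its first step below its starting height.
    first-return : ∀ m → FirstReturn m
    first-return m = ℕ.<-rec FirstReturn step m
      where
      step : ∀ m → (∀ {i} → i < m → FirstReturn i) → FirstReturn m
      step zero    rec f k = refl
      step (suc m) rec f k = begin
        E f (suc m) (suc k)
          ≈⟨ E-suc f m k ⟩
        p * E f m (suc k) + p * E f′ m (suc (suc k)) + p * E f m k
          ≈⟨ solve 3 (λ a b c → a :+ b :+ c := c :+ (a :+ b)) refl _ _ _ ⟩
        p * E f m k + (p * E f m (suc k) + p * E f′ m (suc (suc k)))
          ≈⟨ +-cong (*-congʳ (^-congʳ q (≡.sym (ℕ.*-identityʳ (suc k)))))
                    (+-cong level up) ⟩
        q ^ (suc k ℕ.* 1) * E f m k
          + (conv (λ i j → Q i * E (F j) i 0) m + conv (λ i j → Q i * E (F j ∘ suc) i 1) m)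
          ≈⟨ +-congˡ (conv-+ m _ _) ⟨
        q ^ (suc k ℕ.* 1) * E f m k
          + conv (λ i j → Q i * E (F j) i 0 + Q i * E (F j ∘ suc) i 1) m
          ≈⟨ +-congˡ (conv-cong m λ i j _ → sym (distribˡ _ _ _)) ⟩
        q ^ (suc k ℕ.* 1) * E f m k + conv (λ i j → Q i * E (F j) (suc i) 0) m ∎
        where
        p = q ^ suc k
        f′ = f ∘ suc
        Q : ℕ → Carrier
        Q i = q ^ (suc k ℕ.* suc (suc i))
        F : ℕ → ℕ → Carrier
        F j e = E (λ e′ → f (e ℕ.+ e′)) j k
        F₃ : ℕ → ℕ → ℕ → Carrier
        F₃ a b j = E (λ e → E (λ e′ → F j (suc (e ℕ.+ e′))) b 0) a 0

        level : p * E f m (suc k) ≈ conv (λ i j → Q i * E (F j) i 0) m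
        level = begin
          p * E f m (suc k) ≈⟨ *-congˡ (rec ℕ.≤-refl f k) ⟩
          p * conv (λ i j → q ^ (suc k ℕ.* suc i) * E (F j) i 0) m ≈⟨ *-conv m p _ ⟨
          conv (λ i j → p * (q ^ (suc k ℕ.* suc i) * E (F j) i 0)) m
            ≈⟨ conv-cong m (λ i j _ → trans (sym (*-assoc _ _ _)) (*-congʳ (trans
                 (sym (^-homo-* q (suc k) (suc k ℕ.* suc i)))
                 (^-congʳ q (≡.sym (ℕ.*-suc (suc k) (suc i))))))) ⟩
          _ ∎

        -- Up step, excursion of length `a`, down step, excursion of length `b`, down step: all
        -- `a + b + 3` steps gain `q ^ suc k`, and the `a + 1` steps that start one level higher
        -- gain one more `q`.
        exponents : ∀ a b → p * (q ^ (suc (suc k) ℕ.* suc a) * q ^ (suc k ℕ.* suc b))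
                              ≈ Q (suc (a ℕ.+ b)) * q ^ (1 ℕ.* suc a)
        exponents a b = begin
          _ ≈⟨ *-congˡ (^-homo-* q (suc (suc k) ℕ.* suc a) _) ⟨
          _ ≈⟨ ^-homo-* q (suc k) _ ⟨
          q ^ (suc k ℕ.+ (suc (suc k) ℕ.* suc a ℕ.+ suc k ℕ.* suc b))
            ≈⟨ ^-congʳ q (solveℕ 3 (λ k a b →
                 (‵ 1 ⊕ k) ⊕ ((‵ 2 ⊕ k) ⊗ (‵ 1 ⊕ a) ⊕ (‵ 1 ⊕ k) ⊗ (‵ 1 ⊕ b))
                 ⊜ (‵ 1 ⊕ k) ⊗ (‵ 2 ⊕ (‵ 1 ⊕ (a ⊕ b))) ⊕ ‵ 1 ⊗ (‵ 1 ⊕ a)) ≡.refl k a b) ⟩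
          q ^ (suc k ℕ.* suc (suc (suc (a ℕ.+ b))) ℕ.+ 1 ℕ.* suc a)
            ≈⟨ ^-homo-* q (suc k ℕ.* suc (suc (suc (a ℕ.+ b)))) _ ⟩
          _ ∎

        -- After an up step the path is cut at its first returns to heights `suc k` and `k`. The
        -- part before the second cut is then reassembled into a path from height 1 by reading the
        -- decomposition backwards. Both uses concern other lengths below `suc m`, hence the strong
        -- induction.
        up : p * E f′ m (suc (suc k)) ≈ conv (λ i j → Q i * E (F j ∘ suc) i 1) m
        up = begin
          p * E f′ m (suc (suc k)) ≈⟨ *-congˡ (rec ℕ.≤-refl f′ (suc k)) ⟩
          p * conv (λ a l → r a * E (λ e → E (λ e′ → f′ (e ℕ.+ e′)) l (suc k)) a 0) m
            ≈⟨ *-congˡ (conv-cong m λ a l a+l → *-congˡ (trans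
                 (E-cong a 0 λ e → rec (s≤s (ℕ.≤-trans (ℕ.m≤n+m l (suc a)) (ℕ.≤-reflexive a+l))) _ k)
                 (trans (E-conv a 0 l _) (conv-cong l λ b j _ → trans (E-* a 0 _ _)
                   (*-congˡ (E-cong a 0 λ e → E-cong b 0 λ e′ → E-cong j k λ e″ →
                     reflexive (≡.cong f (≡.cong suc (≡.sym (ℕ.+-assoc e e′ e″)))))))))) ⟩
          p * conv (λ a l → r a * conv (λ b j → s b * F₃ a b j) l) m
            ≈⟨ *-conv m p _ ⟨
          conv (λ a l → p * (r a * conv (λ b j → s b * F₃ a b j) l)) m
            ≈⟨ conv-cong m (λ a l _ → trans (*-congˡ (sym (*-conv l (r a) _)))
                 (trans (sym (*-conv l p _)) (conv-cong l λ b j _ →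
                   trans (solve 4 (λ p r s x → p :* (r :* (s :* x)) := p :* (r :* s) :* x) refl _ _ _ _)
                         (*-congʳ (exponents a b))))) ⟩
          conv (λ a l → conv (λ b j → (Q (suc (a ℕ.+ b)) * q ^ (1 ℕ.* suc a)) * F₃ a b j) l) m
            ≈⟨ conv-assoc m _ ⟨
          conv (λ i j → conv (λ a b → (Q (suc (a ℕ.+ b)) * q ^ (1 ℕ.* suc a)) * F₃ a b j) i) m
            ≈⟨ conv-cong m (λ i j i+j → trans
                 (conv-cong i λ a b a+b → trans (*-assoc _ _ _)
                   (*-congʳ (^-congʳ q (≡.cong (λ x → suc k ℕ.* suc (suc x)) a+b))))
                 (trans (*-conv i (Q i) _) (*-congˡ (sym
                   (rec (s≤s (ℕ.≤-trans (ℕ.m≤m+n i j) (ℕ.≤-trans (ℕ.n≤1+n _) (ℕ.≤-reflexive i+j))))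
                        (F j ∘ suc) 0))))) ⟩
          conv (λ i j → Q i * E (F j ∘ suc) i 1) m ∎
          where
          r s : ℕ → Carrier
          r a = q ^ (suc (suc k) ℕ.* suc a)
          s b = q ^ (suc k ℕ.* suc b)

    -- Sequences of excursions with prescribed lengths.
    B : (ℕ → Carrier) → List ℕ → Carrier
    B f []       = f 0
    B f (n ∷ bl) = E (λ e → B (λ e′ → f (e ℕ.+ e′)) bl) n 0

    B-cong : ∀ bl {f g : ℕ → Carrier} → (∀ e → f e ≈ g e) → B f bl ≈ B g bl
    B-cong []       f≈g = f≈g 0
    B-cong (n ∷ bl) f≈g = E-cong n 0 λ e → B-cong bl λ e′ → f≈g (e ℕ.+ e′)

    -- The first excursion begins with a level step, or with an up step whose matching down step
    -- cuts the rest into lengths `i` and `s ∸ suc i`. A block of a 231-avoiding permutation splits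
    -- in the same way once its entry `suc i` and the smallest value are used.
    B-suc : ∀ f s bl → B f (suc s ∷ bl) ≈
      B f (s ∷ bl) + Σ< s (λ i → q ^ suc i * B (f ∘ suc) (i ∷ s ∸ suc i ∷ bl))
    B-suc f s bl = +-congˡ (begin
      E (λ e → B (λ e′ → f (suc e ℕ.+ e′)) bl) s 1 ≈⟨ first-return s _ 0 ⟩
      _ ≈⟨ conv-cong s (λ i j _ → *-cong (^-congʳ q (ℕ.*-identityˡ (suc i)))
             (E-cong i 0 λ e → E-cong j 0 λ e′ → B-cong bl λ e″ →
               reflexive (≡.cong f (≡.cong suc (ℕ.+-assoc e e′ e″))))) ⟩
      conv (λ i j → q ^ suc i * B (f ∘ suc) (i ∷ j ∷ bl)) s
        ≈⟨ conv-Σ< s _ ⟩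
      _ ∎)

    -- A path from height `h` to 0 with `e` up steps has `e + h` down steps, so `f` is never
    -- evaluated beyond this bound. This controls the truncated subtraction in `w` and makes the
    -- expansion in `E-δ` finite.
    E-cong-≤ : ∀ m h {f g : ℕ → Carrier} →
      (∀ e → e ℕ.+ e ℕ.+ h ≤ m → f e ≈ g e) → E f m h ≈ E g m h
    E-cong-≤ zero    zero    f≈g = f≈g 0 z≤n
    E-cong-≤ zero    (suc k) f≈g = refl
    E-cong-≤ (suc m) zero    f≈g =
      +-cong (E-cong-≤ m 0 λ e le → f≈g e (ℕ.m≤n⇒m≤1+n le))
             (E-cong-≤ m 1 λ e le → f≈g (suc e) (s≤s (ℕ.≤-trans (ℕ.≤-reflexive
               (solveℕ 1 (λ e → e ⊕ (‵ 1 ⊕ e) ⊕ ‵ 0 ⊜ e ⊕ e ⊕ ‵ 1) ≡.refl e)) le)))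
    E-cong-≤ (suc m) (suc k) f≈g = trans (E-suc _ m k) (trans (+-cong (+-cong
      (*-congˡ (E-cong-≤ m (suc k) λ e le → f≈g e (ℕ.m≤n⇒m≤1+n le)))
      (*-congˡ (E-cong-≤ m (suc (suc k)) λ e le → f≈g (suc e) (s≤s (ℕ.≤-trans (ℕ.≤-reflexive
        (solveℕ 2 (λ e k → e ⊕ (‵ 1 ⊕ e) ⊕ (‵ 1 ⊕ k) ⊜ e ⊕ e ⊕ (‵ 2 ⊕ k)) ≡.refl e k)) le)))))
      (*-congˡ (E-cong-≤ m k λ e le → f≈g e (ℕ.≤-trans (ℕ.≤-reflexive
        (ℕ.+-suc (e ℕ.+ e) k)) (s≤s le)))))
      (sym (E-suc _ m k)))

    δ : ℕ → ℕ → Carrier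
    δ k e = if k ℕ.≡ᵇ e then 1# else 0#

    E-δ : ∀ f m K → ⌊ m /2⌋ < K → E f m 0 ≈ Σ< K (λ k → f k * E (δ k) m 0)
    E-δ f m K m/2<K = begin
      E f m 0                                  ≈⟨ E-cong-≤ m 0 (λ e le → sym (expand K f e (bound e le))) ⟩
      E (λ e → Σ< K (λ k → f k * δ k e)) m 0   ≈⟨ E-Σ< m 0 K _ ⟩
      Σ< K (λ k → E (λ e → f k * δ k e) m 0)   ≈⟨ Σ<-cong K (λ k _ → E-* m 0 (f k) (δ k)) ⟩
      Σ< K (λ k → f k * E (δ k) m 0)           ∎
      where
      bound : ∀ e → e ℕ.+ e ℕ.+ 0 ≤ m → e < K
      bound e le = ℕ.≤-<-trans (≡.subst (_≤ ⌊ m /2⌋) (≡.sym (ℕ.n≡⌊n+n/2⌋ e))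
        (ℕ.⌊n/2⌋-mono (≡.subst (_≤ m) (ℕ.+-identityʳ _) le))) m/2<K
      expand : ∀ K (f : ℕ → Carrier) e → e < K → Σ< K (λ k → f k * δ k e) ≈ f e
      expand (suc K) f zero    _         = trans (+-cong (*-identityʳ _) (Σ<-0 K λ i _ → zeroʳ _)) (+-identityʳ _)
      expand (suc K) f (suc e) (s≤s e<K) = trans (+-cong (zeroʳ _) (expand K (f ∘ suc) e e<K)) (+-identityˡ _)

  -- Even and odd contractions of the same Dyck path sum.
  module Contraction (t q q⁻¹ : Carrier) (q*q⁻¹≈1 : q * q⁻¹ ≈ 1#) where

    x : Carrier
    x = t * q⁻¹

    x*q≈t : x * q ≈ t
    x*q≈t = trans (solve 3 (λ t q r → t :* r :* q := t :* (q :* r)) refl t q q⁻¹)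
                  (trans (*-congˡ q*q⁻¹≈1) (*-identityʳ t))

    module M₁ = Motzkin q 1#
    module M₀ = Restricted q

    -- A path of length `m` from height `h` with `e` up steps has `m - h - 2e` level steps. For
    -- `n = m ∸ h` the weight is therefore `t` per up step and `1# + t` per level step.
    w : ℕ → ℕ → Carrier
    w n e = t ^ e * (1# + t) ^ (n ∸ 2 ℕ.* e)

    e₁ G : ℕ → ℕ → Carrier
    e₁ = M₁.E (x ^_)
    G m h = M₀.E (w (m ∸ h)) m h

    e₁-zero : ∀ m → e₁ (suc m) 0 ≈ e₁ m 0 + x * e₁ m 1
    e₁-zero m = +-congˡ (M₁.E-* m 1 x (x ^_))

    e₁-suc : ∀ m k → e₁ (suc m) (suc k) ≈
      q ^ suc k * (e₁ m (suc k) + x * e₁ m (suc k) + x * e₁ m (suc (suc k)) + e₁ m k)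
    e₁-suc m k = *-congˡ (+-congʳ (+-cong (+-congˡ (trans (*-identityˡ _)
      (M₁.E-* m (suc k) x (x ^_)))) (M₁.E-* m (suc (suc k)) x (x ^_))))

    w-level : ∀ m h e → e ℕ.+ e ℕ.+ h ≤ m → w (suc m ∸ h) e ≈ (1# + t) * w (m ∸ h) e
    w-level m h e le = begin
      t ^ e * (1# + t) ^ (suc m ∸ h ∸ 2 ℕ.* e)
        ≈⟨ *-congˡ (^-congʳ (1# + t) (≡.trans (≡.cong (_∸ 2 ℕ.* e) (ℕ.+-∸-assoc 1 h≤m))
             (ℕ.+-∸-assoc 1 2e≤))) ⟩
      t ^ e * ((1# + t) * (1# + t) ^ (m ∸ h ∸ 2 ℕ.* e))
        ≈⟨ solve 3 (λ a b c → a :* (b :* c) := b :* (a :* c)) refl _ _ _ ⟩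
      (1# + t) * w (m ∸ h) e ∎
      where
      h≤m : h ≤ m
      h≤m = ℕ.≤-trans (ℕ.m≤n+m h (e ℕ.+ e)) le
      2e≤ : 2 ℕ.* e ≤ m ∸ h
      2e≤ = ≡.subst (_≤ m ∸ h) (≡.trans (ℕ.m+n∸n≡m (e ℕ.+ e) h) (≡.cong (e ℕ.+_) (≡.sym (ℕ.+-identityʳ e))))
              (ℕ.∸-monoˡ-≤ h le)

    E-level : ∀ m h → M₀.E (w (suc m ∸ h)) m h ≈ (1# + t) * G m h
    E-level m h = trans (M₀.E-cong-≤ m h (w-level m h)) (M₀.E-* m h (1# + t) _)

    w-up : ∀ n e → w (suc n) (suc e) ≈ t * w (n ∸ 1) e
    w-up n e = trans (*-assoc t _ _) (*-congˡ (*-congˡ (^-congʳ (1# + t) (lem n))))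
      where
      lem : ∀ n → suc n ∸ 2 ℕ.* suc e ≡ n ∸ 1 ∸ 2 ℕ.* e
      lem n = ≡.trans (≡.cong (suc n ∸_) (ℕ.*-suc 2 e)) (≡.sym (ℕ.∸-+-assoc n 1 (2 ℕ.* e)))

    E-up-≤ : ∀ m h → h ≤ m → M₀.E (w (suc m ∸ h) ∘ suc) m (suc h) ≈ t * G m (suc h)
    E-up-≤ m h h≤m = trans (M₀.E-cong m (suc h) λ e → trans
      (reflexive (≡.cong (λ n → w n (suc e)) (ℕ.+-∸-assoc 1 h≤m)))
      (trans (w-up (m ∸ h) e) (reflexive (≡.cong (λ n → t * w n e)
        (≡.trans (ℕ.∸-+-assoc m h 1) (≡.cong (m ∸_) (ℕ.+-comm h 1)))))))
      (M₀.E-* m (suc h) t _)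

    E-high : ∀ m h f → m < h → M₀.E f m h ≈ 0#
    E-high m h f m<h = trans (M₀.E-cong-≤ m h λ e le →
      contradiction (ℕ.≤-trans (ℕ.m≤n+m h (e ℕ.+ e)) le) (ℕ.<⇒≱ m<h)) (M₀.E-0 m h)

    -- For `h > m` no path can reach 0 in time, and both sides vanish.
    E-up : ∀ m h → M₀.E (w (suc m ∸ h) ∘ suc) m (suc h) ≈ t * G m (suc h)
    E-up m h with h ℕ.≤? m
    ... | yes h≤m = E-up-≤ m h h≤m
    ... | no  h≰m = trans (E-high m (suc h) _ m<) (sym (trans (*-congˡ (E-high m (suc h) _ m<)) (zeroʳ t)))
      where m< = s≤s (ℕ.<⇒≤ (ℕ.≰⇒> h≰m))

    G-zero : ∀ m → G (suc m) 0 ≈ (1# + t) * G m 0 + t * G m 1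
    G-zero m = +-cong (E-level m 0) (E-up m 0)

    G-suc : ∀ m k → G (suc m) (suc k) ≈
      q ^ suc k * ((1# + t) * G m (suc k) + t * G m (suc (suc k)) + G m k)
    G-suc m k = trans (M₀.E-suc _ m k) (trans
      (+-congʳ (+-cong (*-congˡ (E-level m (suc k))) (*-congˡ (E-up m (suc k)))))
      (solve 4 (λ p a b c → p :* a :+ p :* b :+ p :* c := p :* (a :+ b :+ c)) refl _ _ _ _))

    -- In terms of Dyck paths, `e₁ m h` collects the paths from height `2h` in `2m` steps and
    -- `G m h` those from height `2h + 1` in `2m + 1` steps. A step from height `2h` weighs `q ^ h`;
    -- a step from an odd height weighs `x` upwards and `1#` downwards. Returning to height `2h + 1`
    -- in two steps then weighs `q ^ h` from below and `x * q ^ suc h` from above, in total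
    -- `(1# + t) * q ^ h` because `x * q ≈ t`: this is the reason for substituting `t / q`. A path
    -- from height 0 must start upwards, which accounts for the passage from `n` to `n - 1`.
    contract : ∀ m h → G m h ≈ e₁ m h + x * e₁ m (suc h)
    contract-zero : ∀ m → e₁ (suc m) 0 ≈ G m 0
    contract-suc : ∀ m k → e₁ (suc m) (suc k) ≈ q ^ suc k * (G m (suc k) + G m k)

    contract-zero m = trans (e₁-zero m) (sym (contract m 0))

    contract-suc m k = trans (e₁-suc m k) (*-congˡ (trans
      (solve 5 (λ x a b c d → a :+ x :* a :+ x :* b :+ c := (a :+ x :* b) :+ (c :+ x :* a)) refl
        x _ _ _ (e₁ m k))
      (sym (+-cong (contract m (suc k)) (contract m k)))))

    contract zero    zero    = trans (*-identityˡ _) (sym (trans (+-congˡ (zeroʳ x)) (+-identityʳ _)))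
    contract zero    (suc k) = sym (trans (+-identityˡ _) (zeroʳ x))
    contract (suc m) zero    = begin
      G (suc m) 0                         ≈⟨ G-zero m ⟩
      (1# + t) * G m 0 + t * G m 1        ≈⟨ solve 3 (λ t a b → (con 1 :+ t) :* a :+ t :* b
                                               := a :+ t :* (b :+ a)) refl t _ _ ⟩
      G m 0 + t * (G m 1 + G m 0)         ≈⟨ +-congˡ (*-congʳ x*q≈t) ⟨
      G m 0 + x * q * (G m 1 + G m 0)
        ≈⟨ +-congˡ (trans (*-assoc x q _) (*-congˡ (*-congʳ (sym (*-identityʳ q))))) ⟩
      G m 0 + x * (q ^ 1 * (G m 1 + G m 0)) ≈⟨ +-cong (contract-zero m) (*-congˡ (contract-suc m 0)) ⟨
      e₁ (suc m) 0 + x * e₁ (suc m) 1     ∎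
    contract (suc m) (suc k) = begin
      G (suc m) (suc k) ≈⟨ G-suc m k ⟩
      p * ((1# + t) * G m (suc k) + t * G m (suc (suc k)) + G m k)
        ≈⟨ solve 5 (λ p t a b c → p :* ((con 1 :+ t) :* a :+ t :* b :+ c)
             := p :* (a :+ c) :+ t :* (p :* (b :+ a))) refl p t _ _ _ ⟩
      p * (G m (suc k) + G m k) + t * (p * (G m (suc (suc k)) + G m (suc k)))
        ≈⟨ +-congˡ (*-congʳ x*q≈t) ⟨
      p * (G m (suc k) + G m k) + x * q * (p * (G m (suc (suc k)) + G m (suc k)))
        ≈⟨ +-congˡ (solve 4 (λ x q p a → x :* q :* (p :* a) := x :* (q :* p :* a)) refl x q p _) ⟩
      p * (G m (suc k) + G m k) + x * (q ^ suc (suc k) * (G m (suc (suc k)) + G m (suc k)))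
        ≈⟨ +-cong (contract-suc m k) (*-congˡ (contract-suc m (suc k))) ⟨
      e₁ (suc m) (suc k) + x * e₁ (suc m) (suc (suc k)) ∎
      where p = q ^ suc k

    γ-expansion : ∀ m → e₁ (suc m) 0 ≈
      Σ< (suc ⌊ m /2⌋) (λ k → M₀.E (M₀.δ k) m 0 * t ^ k * (1# + t) ^ (m ∸ 2 ℕ.* k))
    γ-expansion m = begin
      e₁ (suc m) 0    ≈⟨ contract-zero m ⟩
      M₀.E (w m) m 0  ≈⟨ M₀.E-δ (w m) m _ ℕ.≤-refl ⟩
      _ ≈⟨ Σ<-cong (suc ⌊ m /2⌋) (λ k _ → trans (*-comm (w m k) γₖ[ k ]) (sym (*-assoc γₖ[ k ] (t ^ k) _))) ⟩
      _ ∎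
      where
      γₖ[_] : ℕ → Carrier
      γₖ[ k ] = M₀.E (M₀.δ k) m 0

-- Sums over Lehmer codes

module CodeSums {c ℓ} (R : CommutativeRing c ℓ) where

  open CommutativeRing R hiding (zero)
  open GeneratingFunctions R using (_^_)
  open import Algebra.Properties.Semiring.Exp semiring using (^-homo-*; ^-congʳ)
  open import Relation.Binary.Reasoning.Setoid setoid
  open PathSums R

  -- Sum over the Lehmer codes of the permutations of [m].
  Σcode : ℕ → (List ℕ → Carrier) → Carrier
  Σcode zero    F = F []
  Σcode (suc m) F = Σ< (suc m) λ j → Σcode m (F ∘ (j ∷_))

  Σcode-cong : ∀ m {F G : List ℕ → Carrier} → (∀ c → F c ≈ G c) → Σcode m F ≈ Σcode m G
  Σcode-cong zero    F≈G = F≈G []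
  Σcode-cong (suc m) F≈G = Σ<-cong (suc m) λ j _ → Σcode-cong m (F≈G ∘ (j ∷_))

  *-Σcode : ∀ m a (F : List ℕ → Carrier) → Σcode m (λ c → a * F c) ≈ a * Σcode m F
  *-Σcode zero    a F = refl
  *-Σcode (suc m) a F =
    trans (Σ<-cong (suc m) λ j _ → *-Σcode m a (F ∘ (j ∷_))) (*-Σ< (suc m) a λ j → Σcode m (F ∘ (j ∷_)))

  Σcode-0 : ∀ m → Σcode m (λ _ → 0#) ≈ 0#
  Σcode-0 zero    = refl
  Σcode-0 (suc m) = Σ<-0 (suc m) λ _ _ → Σcode-0 m

  Σ<-drop : ∀ a m (F : ℕ → Carrier) →
    Σ< m (λ i → if does (a ℕ.≤? i) then F i else 0#) ≈ Σ< (m ∸ a) (λ i → F (a ℕ.+ i))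
  Σ<-drop zero    m       F = Σ<-cong m λ _ _ → refl
  Σ<-drop (suc a) zero    F = refl
  Σ<-drop (suc a) (suc m) F =
    trans (+-identityˡ _) (trans (Σ<-cong m λ i _ → drop₁ a i) (Σ<-drop a m (F ∘ suc)))
    where
    drop₁ : ∀ a i → (if does (suc a ℕ.≤? suc i) then F (suc i) else 0#)
                  ≈ (if does (a ℕ.≤? i) then F (suc i) else 0#)
    drop₁ zero    i = refl
    drop₁ (suc a) i = refl

  -- Codes of 321-avoiding permutations

  module Code321 (q z : Carrier) where

    open Motzkin q z

    val : (ℕ → Carrier) → List Bool → List ℕ → Carrier
    val f bs []          = f 0
    val f bs (zero  ∷ c) = val f (tail bs) c
    val f bs (suc j ∷ c) = if does (length (tail bs) ℕ.≤? j)
      then ζ (head bs) * (q ^ suc j * val (f ∘ suc) (pad (tail bs) j) c) else 0#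

    pad-◂ : ∀ bs d → pad bs (length bs ℕ.+ d) ≡ bs ◂ d
    pad-◂ []       zero    = ≡.refl
    pad-◂ []       (suc d) = ≡.cong (false ∷_) (pad-◂ [] d)
    pad-◂ (b ∷ bs) d       = ≡.cong (b ∷_) (pad-◂ bs d)

    V-step : ∀ f m bs → V f (suc m) 0 bs ≈
      V f m 0 (tail bs) + ζ (head bs) * (q ^ length (tail bs) * V (f ∘ suc) m 1 (tail bs))
    V-step f m []       = +-congˡ (sym (trans (*-identityˡ _) (*-identityˡ _)))
    V-step f m (b ∷ bs) = refl

    length-tail : ∀ bs {m} → length bs ≤ suc m → length (tail bs) ≤ m
    length-tail []       _       = z≤n
    length-tail (b ∷ bs) (s≤s l) = l

    -- An admissible entry `suc j` has `j = length tl + d`. Its factor `q ^ length tl` is paid at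
    -- once, and the sum over `d` of the remaining `q ^ suc d` is the resolution of a single waiting
    -- excedance.
    Σcode-val : ∀ m f bs → length bs ≤ m → Σcode m (val f bs) ≈ V f m 0 bs
    Σcode-val zero    f []  _  = refl
    Σcode-val (suc m) f bs  le = begin
      Σcode m (val f tl) + Σ< m (λ j → Σcode m (val f bs ∘ (suc j ∷_)))
        ≈⟨ +-cong (Σcode-val m f tl (length-tail bs le)) (begin
             Σ< m (λ j → Σcode m (val f bs ∘ (suc j ∷_)))
               ≈⟨ Σ<-cong m step ⟩
             Σ< m (λ j → if does (length tl ℕ.≤? j) then H j else 0#)
               ≈⟨ Σ<-drop (length tl) m H ⟩
             Σ< n (λ d → H (length tl ℕ.+ d))
               ≈⟨ Σ<-cong n (λ d _ → *-congˡ (trans (*-congʳ (powers d)) (trans (*-assoc _ _ _)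
                    (*-congˡ (*-congˡ (reflexive (≡.cong (V (f ∘ suc) m 0) (pad-◂ tl d)))))))) ⟩
             Σ< n (λ d → ζ b * (q ^ length tl * (q ^ (suc d ℕ.* 1) * V (f ∘ suc) m 0 (tl ◂ d))))
               ≈⟨ *-Σ< n (ζ b) _ ⟩
             _ ≈⟨ *-congˡ (trans (*-Σ< n (q ^ length tl) _) (*-congˡ (sym (V-resolve (f ∘ suc) m 0 tl)))) ⟩
             ζ b * (q ^ length tl * V (f ∘ suc) m 1 tl) ∎) ⟩
      V f m 0 tl + ζ b * (q ^ length tl * V (f ∘ suc) m 1 tl)
        ≈⟨ V-step f m bs ⟨
      V f (suc m) 0 bs ∎
      where
      tl = tail bs
      b = head bs
      n = m ∸ length tl
      H : ℕ → Carrier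
      H j = ζ b * (q ^ suc j * V (f ∘ suc) m 0 (pad tl j))
      powers : ∀ d → q ^ suc (length tl ℕ.+ d) ≈ q ^ length tl * q ^ (suc d ℕ.* 1)
      powers d = trans (^-congʳ q (≡.trans (≡.sym (ℕ.+-suc (length tl) d))
        (≡.cong (length tl ℕ.+_) (≡.sym (ℕ.*-identityʳ (suc d)))))) (^-homo-* q (length tl) _)
      step : ∀ j → j < m → Σcode m (val f bs ∘ (suc j ∷_)) ≈ (if does (length tl ℕ.≤? j) then H j else 0#)
      step j j<m with does (length tl ℕ.≤? j)
      ... | true  = trans (*-Σcode m (ζ b) _) (*-congˡ (trans (*-Σcode m (q ^ suc j) _) (*-congˡ
                      (Σcode-val m (f ∘ suc) (pad tl j) (≡.subst (_≤ m) (≡.sym (length-pad tl j)) j<m)))))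
      ... | false = Σcode-0 m

  -- Codes of 231-avoiding permutations without double descents

  module Code231 (q : Carrier) where

    open Restricted q

    -- The remaining values form consecutive blocks of sizes bl, to be used up block
    -- by block; the previous entry exceeds p of them and is a descent bottom iff d.
    val : (ℕ → Carrier) → Bool → ℕ → List ℕ → List ℕ → Carrier
    val f d p bl           []      = f 0
    val f d p []           (j ∷ c) = 0#
    val f d p (zero  ∷ bl) (j ∷ c) = val f d p bl (j ∷ c)
    val f d p (suc s ∷ bl) (j ∷ c) = if does (j ℕ.≤? s)
      then (if does (j ℕ.<? p)
        then (if d then 0# else q ^ (p ∸ j) * val (f ∘ suc) true j (j ∷ s ∸ j ∷ bl) c)
        else val f false j (j ∷ s ∸ j ∷ bl) c)
      else 0#

    -- The next entry must come from the first nonempty block. In `Fresh` this block lies below the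
    -- previous entry, so a descent is forced; in `Falling` it would be the second descent in a row.
    -- Consequently a forced descent can only go to the smallest value of the block, since any other
    -- choice leaves values below it and leads to `Falling`. In `Ascending` nothing remains below
    -- the previous entry.
    Ascending Fresh Falling : ℕ → Set _
    Ascending m = ∀ f d bl → sum bl ≡ m → Σcode m (val f d 0 bl) ≈ B f bl
    Fresh m = ∀ f s bl → suc s ℕ.+ sum bl ≡ m →
      Σcode m (val f false (suc s) (suc s ∷ bl)) ≈ q ^ suc s * B (f ∘ suc) (s ∷ bl)
    Falling m = ∀ f s bl → suc s ℕ.+ sum bl ≡ m →
      Σcode m (val f true (suc s) (suc s ∷ bl)) ≈ 0#

    Σ<-block : ∀ m s (F G : ℕ → Carrier) → s ≤ m →
      (∀ j → j ≤ s → F j ≈ G j) → (∀ j → s < j → F j ≈ 0#) → Σ< (suc m) F ≈ Σ< (suc s) G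
    Σ<-block m zero    F G _ F≈G F≈0 = +-cong (F≈G 0 z≤n) (Σ<-0 m λ i _ → F≈0 (suc i) (s≤s z≤n))
    Σ<-block (suc m) (suc s) F G (s≤s s≤m) F≈G F≈0 = +-cong (F≈G 0 z≤n)
      (Σ<-block m s (F ∘ suc) (G ∘ suc) s≤m (λ j le → F≈G (suc j) (s≤s le))
        (λ j lt → F≈0 (suc j) (s≤s lt)))

    ascending : ∀ m → Ascending m
    fresh     : ∀ m → Fresh m
    falling   : ∀ m → Falling m

    ascending m f d (zero ∷ bl) e = trans (drop₀ m) (ascending m f d bl e)
      where
      drop₀ : ∀ m → Σcode m (val f d 0 (zero ∷ bl)) ≈ Σcode m (val f d 0 bl)
      drop₀ zero    = refl
      drop₀ (suc m) = refl
    ascending zero    f d []           e = refl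
    ascending (suc m) f d (suc s ∷ bl) e = begin
      Σcode (suc m) (val f d 0 (suc s ∷ bl))
        ≈⟨ Σ<-block m s _ _ (≡.subst (s ≤_) (ℕ.suc-injective e) (ℕ.m≤m+n s (sum bl)))
             (λ j le → Σcode-cong m λ c → reflexive (≡.cong (if_then val f false j (j ∷ s ∸ j ∷ bl) c else 0#)
                (dec-true (j ℕ.≤? s) le)))
             (λ j lt → trans (Σcode-cong m λ c → reflexive (≡.cong (if_then val f false j (j ∷ s ∸ j ∷ bl) c else 0#)
                (dec-false (j ℕ.≤? s) (ℕ.<⇒≱ lt)))) (Σcode-0 m)) ⟩
      -- The smallest value of the block corresponds to a level step. An entry `suc i` has values
      -- below it, hence a forced descent, and corresponds to an up step.
      Σcode m (val f false 0 (0 ∷ s ∷ bl))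
        + Σ< s (λ i → Σcode m (val f false (suc i) (suc i ∷ s ∸ suc i ∷ bl)))
        ≈⟨ +-cong (ascending m f false (0 ∷ s ∷ bl) (ℕ.suc-injective e))
             (Σ<-cong s λ i i<s → fresh m f i (s ∸ suc i ∷ bl)
               (≡.trans (split-size (suc i) s (sum bl) i<s) (ℕ.suc-injective e))) ⟩
      B f (s ∷ bl) + Σ< s (λ i → q ^ suc i * B (f ∘ suc) (i ∷ s ∸ suc i ∷ bl))
        ≈⟨ B-suc f s bl ⟨
      B f (suc s ∷ bl) ∎

    fresh (suc m) f s bl e = begin
      Σcode (suc m) (val f false (suc s) (suc s ∷ bl))
        ≈⟨ Σ<-block m s _ (λ j → q ^ (suc s ∸ j) * Σcode m (val (f ∘ suc) true j (j ∷ s ∸ j ∷ bl)))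
             (≡.subst (s ≤_) (ℕ.suc-injective e) (ℕ.m≤m+n s (sum bl)))
             (λ j le → trans (Σcode-cong m λ c → reflexive (inside j le c)) (*-Σcode m _ _))
             (λ j lt → trans (Σcode-cong m λ c → reflexive (outside j lt c)) (Σcode-0 m)) ⟩
      q ^ suc s * Σcode m (val (f ∘ suc) true 0 (0 ∷ s ∷ bl))
        + Σ< s (λ i → q ^ (s ∸ i) * Σcode m (val (f ∘ suc) true (suc i) (suc i ∷ s ∸ suc i ∷ bl)))
        ≈⟨ +-cong (*-congˡ (ascending m (f ∘ suc) true (0 ∷ s ∷ bl) (ℕ.suc-injective e)))
             (Σ<-0 s λ i i<s → trans (*-congˡ (falling m (f ∘ suc) i (s ∸ suc i ∷ bl)
               (≡.trans (split-size (suc i) s (sum bl) i<s) (ℕ.suc-injective e)))) (zeroʳ _)) ⟩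
      q ^ suc s * B (f ∘ suc) (s ∷ bl) + 0# ≈⟨ +-identityʳ _ ⟩
      q ^ suc s * B (f ∘ suc) (s ∷ bl) ∎
      where
      inside : ∀ j → j ≤ s → ∀ c → val f false (suc s) (suc s ∷ bl) (j ∷ c) ≡
        q ^ (suc s ∸ j) * val (f ∘ suc) true j (j ∷ s ∸ j ∷ bl) c
      inside j le c rewrite dec-true (j ℕ.≤? s) le | dec-true (j ℕ.<? suc s) (s≤s le) = ≡.refl
      outside : ∀ j → s < j → ∀ c → val f false (suc s) (suc s ∷ bl) (j ∷ c) ≡ 0#
      outside j lt c rewrite dec-false (j ℕ.≤? s) (ℕ.<⇒≱ lt) = ≡.refl

    falling (suc m) f s bl e =
      Σ<-0 (suc m) λ j _ → trans (Σcode-cong m λ c → reflexive (zero-val j c)) (Σcode-0 m)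
      where
      zero-val : ∀ j c → val f true (suc s) (suc s ∷ bl) (j ∷ c) ≡ 0#
      zero-val j c with j ℕ.≤? s
      ... | no  j≰s rewrite dec-false (j ℕ.≤? s) j≰s = ≡.refl
      ... | yes j≤s rewrite dec-true (j ℕ.≤? s) j≤s | dec-true (j ℕ.<? suc s) (s≤s j≤s) = ≡.refl

    Σcode-val : ∀ m f → Σcode m (val f false 0 (m ∷ [])) ≈ E f m 0
    Σcode-val m f = trans (ascending m f false (m ∷ []) (ℕ.+-identityʳ m))
      (E-cong m 0 λ e → reflexive (≡.cong f (ℕ.+-identityʳ e)))

-- Permutation statistics in terms of Lehmer codes

module _ where

  open ≡ using (refl; sym; trans; cong; cong₂; subst; subst₂; setoid; module ≡-Reasoning)
  open import Data.Nat using (_+_)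

  -- Finite counting and rearrangement

  module _ {a ℓ} (S : Setoid a ℓ) where
    open Setoid S using () renaming (_≈_ to _≋_; sym to ≋-sym; trans to ≋-trans; refl to ≋-refl)
    open SetoidMembership S using () renaming (_∈_ to _∈ₛ_)
    open SetoidPermutation S using (_↭_; ↭-sym; ↭-trans; prep; refl; ↭-reflexive-≋)

    -- The first element of `xs` does not recur, so removing it from `ys` keeps the inclusion of the
    -- rest. This makes an injective map of a finite list into itself a rearrangement, without
    -- constructing an inverse.
    unique∧⊆⇒↭ : ∀ {xs ys} → UniqueSetoid.Unique S xs → (∀ {x} → x ∈ₛ xs → x ∈ₛ ys) →
      length xs ≡ length ys → xs ↭ ys
    unique∧⊆⇒↭ {[]}     {[]}     _          _     _  = SetoidPermutation.↭-refl S
    unique∧⊆⇒↭ {x ∷ xs} {ys} (x∉xs ∷ xs!) xs⊆ys e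
      with as , bs , w , x≈w , ys≋ ← SetoidMembershipₚ.∈-∃++ S (xs⊆ys (here ≋-refl)) =
      ↭-trans (prep x≈w (unique∧⊆⇒↭ xs! xs⊆rest (ℕ.suc-injective
        (trans e (SetoidPermutationₚ.xs↭ys⇒|xs|≡|ys| S ys↭))))) (↭-sym ys↭)
      where
      ys↭ : ys ↭ w ∷ as ++ bs
      ys↭ = ↭-trans (↭-reflexive-≋ ys≋) (SetoidPermutationₚ.shift S ≋-refl as bs)
      xs⊆rest : ∀ {y} → y ∈ₛ xs → y ∈ₛ as ++ bs
      xs⊆rest {y} y∈xs with SetoidPermutationₚ.∈-resp-↭ S ys↭ (xs⊆ys (there y∈xs))
      ... | there y∈ = y∈
      ... | here y≈w = contradiction (≋-trans x≈w (≋-sym y≈w))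
        (λ x≈y → All.lookupₛ S (λ y≈z x≉y x≈z → x≉y (≋-trans x≈z (≋-sym y≈z))) x∉xs y∈xs x≈y)

  private
    variable
      a b p r : Level
      A : Set a
      X : Set b

  𝟙 : Bool → ℕ
  𝟙 b = if b then 1 else 0

  module _ {P : A → Set p} (P? : Decidable P) where

    #-∷ : ∀ x xs → # P? (x ∷ xs) ≡ 𝟙 (does (P? x)) + # P? xs
    #-∷ x xs with does (P? x)
    ... | true  = refl
    ... | false = refl

    #-++ : ∀ xs ys → # P? (xs ++ ys) ≡ # P? xs + # P? ys
    #-++ xs ys = trans (cong length (List.filter-++ P? xs ys)) (List.length-++ (filter P? xs))

    #-map : ∀ (f : X → A) xs → # P? (map f xs) ≡ # (λ x → P? (f x)) xs
    #-map f []       = refl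
    #-map f (x ∷ xs) = trans (#-∷ (f x) _)
      (trans (cong (𝟙 (does (P? (f x))) +_) (#-map f xs)) (sym (lem x xs)))
      where
      lem : ∀ x xs → # (λ x → P? (f x)) (x ∷ xs) ≡ 𝟙 (does (P? (f x))) + # (λ x → P? (f x)) xs
      lem x xs with does (P? (f x))
      ... | true  = refl
      ... | false = refl

    #-cong : ∀ {Q : A → Set r} (Q? : Decidable Q) → (∀ x → P x ⇔ Q x) → ∀ xs → # P? xs ≡ # Q? xs
    #-cong Q? P⇔Q xs = cong length (List.filter-≐ P? Q?
      ((λ {x} → Equivalence.to (P⇔Q x)) , (λ {x} → Equivalence.from (P⇔Q x))) xs)

    #-none : (∀ x → ¬ P x) → ∀ xs → # P? xs ≡ 0
    #-none ¬P xs = cong length (List.filter-none P? {xs} (All.tabulate λ {x} _ → ¬P x))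

    #-reindex : ∀ {xs} (φ : A → A) → Unique xs → Injective _≡_ _≡_ φ → (∀ {x} → x ∈ xs → φ x ∈ xs) →
      # (λ x → P? (φ x)) xs ≡ # P? xs
    #-reindex {xs} φ xs! φ-inj φ-closed = trans (sym (#-map φ xs))
      (SetoidPermutationₚ.xs↭ys⇒|xs|≡|ys| (setoid A) (SetoidPermutationₚ.filter⁺ (setoid A) P? (λ { refl p → p })
        (unique∧⊆⇒↭ (setoid A) (Unique.map⁺ φ-inj xs!) closed (List.length-map φ xs))))
      where
      closed : ∀ {y} → y ∈ map φ xs → y ∈ xs
      closed y∈ with x , x∈ , refl ← ∈-map⁻ φ y∈ = φ-closed x∈

  #-allFin : ∀ {m} {P : Fin (suc m) → Set p} (P? : Decidable P) →
    # P? (allFin (suc m)) ≡ 𝟙 (does (P? zero)) + # (λ i → P? (suc i)) (allFin m)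
  #-allFin {m = m} P? = trans (#-∷ P? zero _) (cong (𝟙 (does (P? zero)) +_)
    (trans (cong (# P?) (sym (List.map-tabulate (λ i → i) suc))) (#-map P? suc (allFin m))))

  module _ {P : A × X → Set p} (P? : Decidable P) where

    #-×-∷ˡ : ∀ x xs ys → # P? (cartesianProduct (x ∷ xs) ys) ≡
      # (λ y → P? (x , y)) ys + # P? (cartesianProduct xs ys)
    #-×-∷ˡ x xs ys = trans (#-++ P? (map (x ,_) ys) _) (cong (_+ _) (#-map P? (x ,_) ys))

  #-×-∷ʳ : ∀ {P : A × X → Set p} (P? : Decidable P) xs y ys → # P? (cartesianProduct xs (y ∷ ys)) ≡
    # (λ x → P? (x , y)) xs + # P? (cartesianProduct xs ys)
  #-×-∷ʳ P? []       y ys = refl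
  #-×-∷ʳ P? (x ∷ xs) y ys = begin
    # P? (cartesianProduct (x ∷ xs) (y ∷ ys))
      ≡⟨ #-×-∷ˡ P? x xs (y ∷ ys) ⟩
    # (λ y → P? (x , y)) (y ∷ ys) + # P? (cartesianProduct xs (y ∷ ys))
      ≡⟨ cong₂ _+_ (#-∷ (λ y → P? (x , y)) y ys) (#-×-∷ʳ P? xs y ys) ⟩
    (𝟙 (does (P? (x , y))) + # (λ y → P? (x , y)) ys) + (# (λ x → P? (x , y)) xs + # P? (cartesianProduct xs ys))
      ≡⟨ solve 4 (λ a b c d → (a :+ b) :+ (c :+ d) := (a :+ c) :+ (b :+ d)) refl
           (𝟙 (does (P? (x , y)))) _ (# (λ x → P? (x , y)) xs) _ ⟩
    (𝟙 (does (P? (x , y))) + # (λ x → P? (x , y)) xs) + (# (λ y → P? (x , y)) ys + # P? (cartesianProduct xs ys))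
      ≡⟨ cong₂ _+_ (#-∷ (λ x → P? (x , y)) x xs) (#-×-∷ˡ P? x xs ys) ⟨
    # (λ x → P? (x , y)) (x ∷ xs) + # P? (cartesianProduct (x ∷ xs) ys) ∎
    where
    open ≡-Reasoning
    open import Data.Nat.Solver
    open +-*-Solver

  #-×-map : ∀ {A′ : Set a} {X′ : Set b} {P : A′ × X′ → Set p} (P? : Decidable P)
    (f : A → A′) (g : X → X′) xs ys →
    # P? (cartesianProduct (map f xs) (map g ys)) ≡ # (λ (x , y) → P? (f x , g y)) (cartesianProduct xs ys)
  #-×-map P? f g []       ys = refl
  #-×-map P? f g (x ∷ xs) ys = trans (#-×-∷ˡ P? (f x) (map f xs) (map g ys))
    (trans (cong₂ _+_ (#-map (λ y → P? (f x , y)) g ys) (#-×-map P? f g xs ys))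
           (sym (#-×-∷ˡ (λ (x , y) → P? (f x , g y)) x xs ys)))

  #-range : ∀ m lo hi → hi ≤ m → # (λ v → (lo ℕ.≤? toℕ v) ×-dec (toℕ v ℕ.<? hi)) (allFin m) ≡ hi ∸ lo
  #-range zero    lo zero     _  = sym (ℕ.0∸n≡0 lo)
  #-range (suc m) lo zero     _  = trans (#-none (λ v → (lo ℕ.≤? toℕ v) ×-dec (toℕ v ℕ.<? 0)) (λ _ ()) (allFin (suc m)))
    (sym (ℕ.0∸n≡0 lo))
  #-range (suc m) lo (suc hi) (s≤s le) = trans
    (#-allFin (λ v → (lo ℕ.≤? toℕ v) ×-dec (toℕ v ℕ.<? suc hi)))
    (trans (cong (𝟙 (does (lo ℕ.≤? 0) ∧ true) +_) (trans
      (#-cong (λ v → (lo ℕ.≤? suc (toℕ v)) ×-dec (suc (toℕ v) ℕ.<? suc hi))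
        (λ v → (ℕ.pred lo ℕ.≤? toℕ v) ×-dec (toℕ v ℕ.<? hi)) (λ v → mk⇔
        (λ (l , h) → ℕ.pred-mono-≤ l , s≤s⁻¹ h) (λ (l , h) → lower lo l , s≤s h)) (allFin m))
      (#-range m (ℕ.pred lo) hi le))) (lem lo))
    where
    lower : ∀ lo {v} → ℕ.pred lo ≤ v → lo ≤ suc v
    lower zero     _ = z≤n
    lower (suc lo) l = s≤s l
    lem : ∀ lo → 𝟙 (does (lo ℕ.≤? 0) ∧ true) + (hi ∸ ℕ.pred lo) ≡ suc hi ∸ lo
    lem zero     = refl
    lem (suc lo) = refl

  ⟨$⟩ʳ-injective : ∀ {m} (σ : Permutation′ m) → Injective _≡_ _≡_ (σ ⟨$⟩ʳ_)
  ⟨$⟩ʳ-injective σ e = trans (sym (inverseˡ σ)) (trans (cong (σ ⟨$⟩ˡ_) e) (inverseˡ σ))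

  #-values : ∀ {m} {P : Fin m → Set p} (P? : Decidable P) (σ : Permutation′ m) →
    # (λ i → P? (σ ⟨$⟩ʳ i)) (allFin m) ≡ # P? (allFin m)
  #-values {m = m} P? σ = #-reindex P? (σ ⟨$⟩ʳ_) (Unique.allFin⁺ m) (⟨$⟩ʳ-injective σ) (λ _ → ∈-allFin _)

  punchIn-below : ∀ {n} (j : Fin (suc n)) (i : Fin n) → toℕ i < toℕ j → toℕ (punchIn j i) ≡ toℕ i
  punchIn-below (suc j) zero    _         = refl
  punchIn-below (suc j) (suc i) (s≤s i<j) = cong suc (punchIn-below j i i<j)

  punchIn-above : ∀ {n} (j : Fin (suc n)) (i : Fin n) → toℕ j ≤ toℕ i → toℕ (punchIn j i) ≡ suc (toℕ i)
  punchIn-above zero    i       _         = refl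
  punchIn-above (suc j) (suc i) (s≤s j≤i) = cong suc (punchIn-above j i j≤i)

  -- Lehmer codes and deletion of the first entry

  code : ∀ m → Permutation′ m → List ℕ
  code zero    σ = []
  code (suc m) σ = toℕ (σ ⟨$⟩ʳ zero) ∷ code m (remove zero σ)

  module Head {m} (σ : Permutation′ (suc m)) where

    j : ℕ
    j = toℕ (σ ⟨$⟩ʳ zero)

    ρ : Permutation′ m
    ρ = remove zero σ

    σ⁺ : Fin m → ℕ
    σ⁺ i = toℕ (σ ⟨$⟩ʳ suc i)

    ρᵛ : Fin m → ℕ
    ρᵛ i = toℕ (ρ ⟨$⟩ʳ i)

    σ⁺-punchIn : ∀ i → σ ⟨$⟩ʳ suc i ≡ punchIn (σ ⟨$⟩ʳ zero) (ρ ⟨$⟩ʳ i)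
    σ⁺-punchIn = punchIn-permute σ zero

    below : ∀ i → ρᵛ i < j → σ⁺ i ≡ ρᵛ i
    below i lt = trans (cong toℕ (σ⁺-punchIn i)) (punchIn-below _ _ lt)

    above : ∀ i → j ≤ ρᵛ i → σ⁺ i ≡ suc (ρᵛ i)
    above i le = trans (cong toℕ (σ⁺-punchIn i)) (punchIn-above _ _ le)

    <-head⁺ : ∀ i → ρᵛ i < j → σ⁺ i < j
    <-head⁺ i lt = subst (_< j) (sym (below i lt)) lt

    <-head⁻ : ∀ i → σ⁺ i < j → ρᵛ i < j
    <-head⁻ i lt with ρᵛ i ℕ.<? j
    ... | yes p = p
    ... | no ¬p = contradiction (subst (_< j) (above i (ℕ.≮⇒≥ ¬p)) lt)
                    (ℕ.≤⇒≯ (ℕ.m≤n⇒m≤1+n (ℕ.≮⇒≥ ¬p)))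

    σ⁺≤ : ∀ i → σ⁺ i ≤ suc (ρᵛ i)
    σ⁺≤ i with ρᵛ i ℕ.<? j
    ... | yes p = ℕ.≤-trans (ℕ.≤-reflexive (below i p)) (ℕ.n≤1+n _)
    ... | no ¬p = ℕ.≤-reflexive (above i (ℕ.≮⇒≥ ¬p))

    ρᵛ≤ : ∀ i → ρᵛ i ≤ σ⁺ i
    ρᵛ≤ i with ρᵛ i ℕ.<? j
    ... | yes p = ℕ.≤-reflexive (sym (below i p))
    ... | no ¬p = ℕ.≤-trans (ℕ.n≤1+n _) (ℕ.≤-reflexive (sym (above i (ℕ.≮⇒≥ ¬p))))

    mono : ∀ a b → ρᵛ a < ρᵛ b → σ⁺ a < σ⁺ b
    mono a b lt = subst₂ (λ x y → toℕ x < toℕ y) (sym (σ⁺-punchIn a)) (sym (σ⁺-punchIn b))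
      (ℕ.≰⇒> λ le → ℕ.<⇒≱ lt (Fin.punchIn-cancel-≤ (σ ⟨$⟩ʳ zero) (ρ ⟨$⟩ʳ b) (ρ ⟨$⟩ʳ a) le))

    cancel : ∀ a b → σ⁺ a < σ⁺ b → ρᵛ a < ρᵛ b
    cancel a b lt = ℕ.≰⇒> λ le → ℕ.<⇒≱
      (subst₂ (λ x y → toℕ x < toℕ y) (σ⁺-punchIn a) (σ⁺-punchIn b) lt)
      (Fin.punchIn-mono-≤ (σ ⟨$⟩ʳ zero) (ρ ⟨$⟩ʳ b) (ρ ⟨$⟩ʳ a) le)

  remove-cong : ∀ {m} {σ π : Permutation′ (suc m)} → σ ≈ₚ π → remove zero σ ≈ₚ remove zero π
  remove-cong {σ = σ} {π} e i = Fin.punchIn-injective (σ ⟨$⟩ʳ zero) _ _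
    (trans (sym (punchIn-permute σ zero i)) (trans (e (suc i)) (trans (punchIn-permute π zero i)
      (cong (λ k → punchIn k (remove zero π ⟨$⟩ʳ i)) (sym (e zero))))))

  code-cong : ∀ m {σ π : Permutation′ m} → σ ≈ₚ π → code m σ ≡ code m π
  code-cong zero    e = refl
  code-cong (suc m) {σ} {π} e =
    cong₂ _∷_ (cong toℕ (e zero)) (code-cong m (remove-cong {σ = σ} {π} e))

  code-insert : ∀ {m} j (ρ : Permutation′ m) → code (suc m) (insert zero j ρ) ≡ toℕ j ∷ code m ρ
  code-insert j ρ = cong (toℕ j ∷_) (code-cong _ (remove-insert zero j ρ))

  -- Avoidance of 321

  Av321 : ∀ {m} → Permutation′ m → Set
  Av321 {m} σ = ∀ (a b c : Fin m) → a Fin.< b → b Fin.< c →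
    σ ⟨$⟩ʳ c Fin.< σ ⟨$⟩ʳ b → ¬ σ ⟨$⟩ʳ b Fin.< σ ⟨$⟩ʳ a

  -- An inversion whose larger entry lies below a deleted entry would complete a 321. Only the
  -- largest deleted entry matters, so one threshold `h`, counted in remaining values, remembers the
  -- whole past.
  Inc : ∀ {m} → ℕ → Permutation′ m → Set
  Inc {m} h σ = ∀ (a b : Fin m) → a Fin.< b → σ ⟨$⟩ʳ b Fin.< σ ⟨$⟩ʳ a → ¬ toℕ (σ ⟨$⟩ʳ a) < h

  Inc-0 : ∀ {m} (σ : Permutation′ m) → Inc 0 σ
  Inc-0 σ _ _ _ _ ()

  -- A smaller value to the right of `i` would form an inversion with top below `h`. So all smaller
  -- values stand to the left, and their positions inject into those before `i`.
  Inc⇒value≤position : ∀ {m h} (σ : Permutation′ m) → Inc h σ →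
    ∀ i → toℕ (σ ⟨$⟩ʳ i) < h → toℕ (σ ⟨$⟩ʳ i) ≤ toℕ i
  Inc⇒value≤position {m} σ inc i lt = Fin.injective⇒≤ {f = pos} pos-injective
    where
    σi = σ ⟨$⟩ʳ i
    value : Fin (toℕ σi) → Fin m
    value v = Fin.inject {i = σi} v
    value< : ∀ v → toℕ (value v) < toℕ σi
    value< v = subst (_< toℕ σi) (sym (Fin.toℕ-inject v)) (Fin.toℕ<n v)
    pos< : ∀ v → toℕ (σ ⟨$⟩ˡ value v) < toℕ i
    pos< v with Fin.<-cmp (σ ⟨$⟩ˡ value v) i
    ... | tri< l _ _ = l
    ... | tri≈ _ e _ = contradiction (subst (λ k → toℕ k < toℕ σi)
                         (trans (sym (inverseʳ σ)) (cong (σ ⟨$⟩ʳ_) e)) (value< v)) (ℕ.<-irrefl refl)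
    ... | tri> _ _ g = contradiction lt
                         (inc i (σ ⟨$⟩ˡ value v) g (subst (λ k → toℕ k < toℕ σi) (sym (inverseʳ σ)) (value< v)))
    pos : Fin (toℕ σi) → Fin (toℕ i)
    pos v = fromℕ< (pos< v)
    pos-injective : Injective _≡_ _≡_ pos
    pos-injective {v} {w} e = Fin.toℕ-injective (trans (sym (Fin.toℕ-inject v)) (trans
      (cong toℕ (trans (sym (inverseʳ σ)) (trans (cong (σ ⟨$⟩ʳ_) (Fin.toℕ-injective
        (trans (sym (Fin.toℕ-fromℕ< (pos< v))) (trans (cong toℕ e) (Fin.toℕ-fromℕ< (pos< w))))))
        (inverseʳ σ)))) (Fin.toℕ-inject w)))

  module Head321 {m} (σ : Permutation′ (suc m)) where
    open Head σ

    Av321-ρ : Av321 σ → Av321 ρ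
    Av321-ρ av a b c a<b b<c ρc<ρb ρb<ρa =
      av (suc a) (suc b) (suc c) (s≤s a<b) (s≤s b<c) (mono c b ρc<ρb) (mono b a ρb<ρa)

    Av321-Inc : Av321 σ → Inc j ρ
    Av321-Inc av a b a<b ρb<ρa ρa<j =
      av zero (suc a) (suc b) (s≤s z≤n) (s≤s a<b) (mono b a ρb<ρa) (<-head⁺ a ρa<j)

    Av321-σ : Av321 ρ → Inc j ρ → Av321 σ
    Av321-σ av inc zero    (suc b) (suc c) _         (s≤s b<c) σc<σb σb<j =
      inc b c b<c (cancel c b σc<σb) (<-head⁻ b σb<j)
    Av321-σ av inc (suc a) (suc b) (suc c) (s≤s a<b) (s≤s b<c) σc<σb σb<σa =
      av a b c a<b b<c (cancel c b σc<σb) (cancel b a σb<σa)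

    Inc-zero⁻ : ∀ h → j ≡ 0 → Inc h σ → Inc (ℕ.pred h) ρ
    Inc-zero⁻ (suc h) j≡0 inc a b a<b ρb<ρa ρa<h = inc (suc a) (suc b) (s≤s a<b) (mono b a ρb<ρa)
      (ℕ.≤-<-trans (σ⁺≤ a) (s≤s ρa<h))

    Inc-zero⁺ : ∀ h → j ≡ 0 → Inc (ℕ.pred h) ρ → Inc h σ
    Inc-zero⁺ h j≡0 inc zero    (suc b) _         σb<j  _    = contradiction (subst (σ⁺ b <_) j≡0 σb<j) λ ()
    Inc-zero⁺ h j≡0 inc (suc a) (suc b) (s≤s a<b) σb<σa σa<h = inc a b a<b (cancel b a σb<σa)
      (ℕ.pred-mono-≤ (subst (_< h) (above a (ℕ.≤-trans (ℕ.≤-reflexive j≡0) z≤n)) σa<h))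

    Inc-above : ∀ h → h ≤ j → Inc j ρ → Inc h σ
    Inc-above h h≤j inc zero    (suc b) _         _     j<h  = ℕ.<⇒≱ j<h h≤j
    Inc-above h h≤j inc (suc a) (suc b) (s≤s a<b) σb<σa σa<h =
      inc a b a<b (cancel b a σb<σa) (<-head⁻ a (ℕ.<-≤-trans σa<h h≤j))

    -- The value 0 stands to the right of the first entry and forms with it an inversion whose top
    -- is below `h`.
    Inc-between : ∀ h → 0 < j → j < h → ¬ Inc h σ
    Inc-between h 0<j j<h inc = inc zero i (ℕ.n≢0⇒n>0 i≢0) (subst (_< j) (sym (cong toℕ (inverseʳ σ))) 0<j) j<h
      where
      i = σ ⟨$⟩ˡ zero
      i≢0 : toℕ i ≢ 0
      i≢0 e = ℕ.<⇒≢ 0<j (trans (sym (cong toℕ (inverseʳ σ {zero})))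
        (cong (toℕ ∘ (σ ⟨$⟩ʳ_)) (Fin.toℕ-injective {j = zero} e)))

    module _ (inc : Inc j ρ) where

      -- Deletion lowers the position by one, and also each value above `j`. Values below `j` are
      -- unchanged, but by the pigeonhole bound they are not excedances of `ρ`.
      exc-suc⁺ : ∀ i → toℕ i < ρᵛ i → suc (toℕ i) < σ⁺ i
      exc-suc⁺ i lt with ρᵛ i ℕ.<? j
      ... | yes p = contradiction (Inc⇒value≤position ρ inc i p) (ℕ.<⇒≱ lt)
      ... | no ¬p = subst (suc (toℕ i) <_) (sym (above i (ℕ.≮⇒≥ ¬p))) (s≤s lt)

      exc-suc⁻ : ∀ i → suc (toℕ i) < σ⁺ i → toℕ i < ρᵛ i
      exc-suc⁻ i lt = s≤s⁻¹ (ℕ.<-≤-trans lt (σ⁺≤ i))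

      preimage-head : ∀ i → suc (toℕ i) ≡ j → σ ⟨$⟩ˡ suc i ≡ zero
      preimage-head i e = trans (cong (σ ⟨$⟩ˡ_) (Fin.toℕ-injective e)) (inverseˡ σ)

      preimage-above : ∀ i → j ≤ toℕ i → σ ⟨$⟩ˡ suc i ≡ suc (ρ ⟨$⟩ˡ i)
      preimage-above i le = trans (cong (σ ⟨$⟩ˡ_) (sym (Fin.toℕ-injective (trans
        (above (ρ ⟨$⟩ˡ i) (subst (j ≤_) (sym (cong toℕ (inverseʳ ρ))) le))
        (cong (suc ∘ toℕ) (inverseʳ ρ)))))) (inverseˡ σ)

      -- A value below j other than the first entry is preceded by all smaller values.
      preimage-below : ∀ y → toℕ y < j → toℕ y < toℕ (σ ⟨$⟩ˡ y)
      preimage-below y y<j with σ ⟨$⟩ˡ y in e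
      ... | zero  = contradiction y<j (ℕ.<-irrefl (cong toℕ (trans (sym (inverseʳ σ)) (cong (σ ⟨$⟩ʳ_) e))))
      ... | suc p = s≤s (subst (_≤ toℕ p) (trans (sym (below p ρp<j)) σp≡y) (Inc⇒value≤position ρ inc p ρp<j))
        where
        σp≡y : σ⁺ p ≡ toℕ y
        σp≡y = cong toℕ (trans (cong (σ ⟨$⟩ʳ_) (sym e)) (inverseʳ σ))
        ρp<j : ρᵛ p < j
        ρp<j = <-head⁻ p (subst (_< j) (sym σp≡y) y<j)

      -- A value above `j` loses one together with its position, and a value below `j` satisfies
      -- neither side. Only `j` itself, whose position is deleted, requires the extra alternative.
      inverse-suc⁺ : ∀ i → suc (toℕ i) ≡ j ⊎ toℕ (ρ ⟨$⟩ˡ i) < toℕ i → toℕ (σ ⟨$⟩ˡ suc i) < suc (toℕ i)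
      inverse-suc⁺ i (inj₁ e)  = subst (λ k → toℕ k < suc (toℕ i)) (sym (preimage-head i e)) (s≤s z≤n)
      inverse-suc⁺ i (inj₂ lt) with j ℕ.≤? toℕ i
      ... | yes p = subst (λ k → toℕ k < suc (toℕ i)) (sym (preimage-above i p)) (s≤s lt)
      ... | no ¬p = contradiction lt (ℕ.≤⇒≯ (subst (_≤ toℕ (ρ ⟨$⟩ˡ i)) (cong toℕ (inverseʳ ρ))
                      (Inc⇒value≤position ρ inc (ρ ⟨$⟩ˡ i)
                        (subst (_< j) (sym (cong toℕ (inverseʳ ρ))) (ℕ.≰⇒> ¬p)))))

      inverse-suc⁻ : ∀ i → toℕ (σ ⟨$⟩ˡ suc i) < suc (toℕ i) → suc (toℕ i) ≡ j ⊎ toℕ (ρ ⟨$⟩ˡ i) < toℕ i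
      inverse-suc⁻ i lt with ℕ.<-cmp (suc (toℕ i)) j
      ... | tri< l _ _ = contradiction lt (ℕ.<⇒≯ (preimage-below (suc i) l))
      ... | tri≈ _ e _ = inj₁ e
      ... | tri> _ _ g = inj₂ (s≤s⁻¹ (subst (λ k → toℕ k < suc (toℕ i)) (preimage-above i (s≤s⁻¹ g)) lt))

      exc-head : exc σ ≡ 𝟙 (does (0 ℕ.<? j)) + exc ρ
      exc-head = trans (#-allFin (λ i → i Fin.<? σ ⟨$⟩ʳ i)) (cong (𝟙 (does (0 ℕ.<? j)) +_)
        (#-cong (λ i → suc i Fin.<? σ ⟨$⟩ʳ suc i) (λ i → i Fin.<? ρ ⟨$⟩ʳ i)
          (λ i → mk⇔ (exc-suc⁻ i) (exc-suc⁺ i)) (allFin m)))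

    inv-head : inv σ ≡ j + inv ρ
    inv-head = begin
      # P (cartesianProduct (allFin (suc m)) (allFin (suc m)))
        ≡⟨ cong (λ l → # P (cartesianProduct (zero ∷ l) (zero ∷ l))) (List.map-tabulate (λ i → i) suc) ⟨
      # P (cartesianProduct (zero ∷ sucs) (zero ∷ sucs))
        ≡⟨ #-×-∷ˡ P zero sucs (zero ∷ sucs) ⟩
      # (λ y → P (zero , y)) (zero ∷ sucs) + # P (cartesianProduct sucs (zero ∷ sucs))
        ≡⟨ cong₂ _+_ first rest ⟩
      j + inv ρ ∎
      where
      open ≡-Reasoning
      sucs : List (Fin (suc m))
      sucs = map suc (allFin m)
      P : Decidable (λ ((a , b) : Fin (suc m) × Fin (suc m)) → (a Fin.< b) × (σ ⟨$⟩ʳ b Fin.< σ ⟨$⟩ʳ a))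
      P (a , b) = (a Fin.<? b) ×-dec (σ ⟨$⟩ʳ b Fin.<? σ ⟨$⟩ʳ a)
      inRange : Decidable (λ (v : Fin m) → (0 ≤ toℕ v) × (toℕ v < j))
      inRange v = (0 ℕ.≤? toℕ v) ×-dec (toℕ v ℕ.<? j)
      first : # (λ y → P (zero , y)) (zero ∷ sucs) ≡ j
      first = begin
        # (λ y → P (zero , y)) (zero ∷ sucs)         ≡⟨ #-map (λ y → P (zero , y)) suc (allFin m) ⟩
        # (λ y → P (zero , suc y)) (allFin m)        ≡⟨ #-cong (λ y → P (zero , suc y)) (λ y → inRange (ρ ⟨$⟩ʳ y))
          (λ y → mk⇔ (λ (_ , l) → z≤n , <-head⁻ y l) (λ (_ , l) → s≤s z≤n , <-head⁺ y l)) (allFin m) ⟩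
        # (λ y → inRange (ρ ⟨$⟩ʳ y)) (allFin m)      ≡⟨ #-values inRange ρ ⟩
        # inRange (allFin m)                          ≡⟨ #-range m 0 j (Fin.toℕ≤pred[n] (σ ⟨$⟩ʳ zero)) ⟩
        j ∎
      rest : # P (cartesianProduct sucs (zero ∷ sucs)) ≡ inv ρ
      rest = begin
        # P (cartesianProduct sucs (zero ∷ sucs))
          ≡⟨ #-×-∷ʳ P sucs zero sucs ⟩
        # (λ x → P (x , zero)) sucs + # P (cartesianProduct sucs sucs)
          ≡⟨ cong₂ _+_ (#-none (λ x → P (x , zero)) (λ _ ()) sucs) (#-×-map P suc suc (allFin m) (allFin m)) ⟩
        # (λ (x , y) → P (suc x , suc y)) (cartesianProduct (allFin m) (allFin m))
          ≡⟨ #-cong (λ (x , y) → P (suc x , suc y)) (λ (a , b) → (a Fin.<? b) ×-dec (ρ ⟨$⟩ʳ b Fin.<? ρ ⟨$⟩ʳ a))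
               (λ (a , b) → mk⇔ (λ (l , l′) → s≤s⁻¹ l , cancel b a l′) (λ (l , l′) → s≤s l , mono b a l′))
               (cartesianProduct (allFin m) (allFin m)) ⟩
        inv ρ ∎

  neither : ∀ {a b} {A : Set a} {B : Set b} → ¬ A → ¬ B → A ⇔ B
  neither ¬a ¬b = mk⇔ (λ a → contradiction a ¬a) (λ b → contradiction b ¬b)

  both : ∀ {a b} {A : Set a} {B : Set b} → A → B → A ⇔ B
  both a b = mk⇔ (λ _ → b) (λ _ → a)

  increasing₃ : ∀ {m} {a b c : Fin m} → a Fin.< b → b Fin.< c →
    ∀ x y → x Fin.< y → lookup (a ∷ b ∷ c ∷ []) x Fin.< lookup (a ∷ b ∷ c ∷ []) y
  increasing₃ a<b b<c 0F 1F _ = a<b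
  increasing₃ a<b b<c 0F 2F _ = ℕ.<-trans a<b b<c
  increasing₃ a<b b<c 1F 2F _ = b<c
  increasing₃ a<b b<c 1F 1F (s≤s ())
  increasing₃ a<b b<c 2F 1F (s≤s ())
  increasing₃ a<b b<c 2F 2F (s≤s (s≤s ()))

  <-irr : ∀ {n} → ¬ n < n
  <-irr = ℕ.<-irrefl refl

  avoids321⇔ : ∀ {m} (σ : Permutation′ m) → Avoids pat321 σ ⇔ Av321 σ
  avoids321⇔ {m} σ = mk⇔ to from
    where
    to : Avoids pat321 σ → Av321 σ
    to av a b c a<b b<c c<b b<a = av (a ∷ b ∷ c ∷ [] , increasing₃ a<b b<c , λ where
      0F 0F → neither <-irr <-irr
      0F 1F → neither (ℕ.<⇒≯ b<a) (λ { (s≤s (s≤s ())) })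
      0F 2F → neither (ℕ.<⇒≯ (ℕ.<-trans c<b b<a)) (λ { (s≤s ()) })
      1F 0F → both b<a (s≤s (s≤s (s≤s z≤n)))
      1F 1F → neither <-irr <-irr
      1F 2F → neither (ℕ.<⇒≯ c<b) (λ { (s≤s ()) })
      2F 0F → both (ℕ.<-trans c<b b<a) (s≤s (s≤s z≤n))
      2F 1F → both c<b (s≤s (s≤s z≤n))
      2F 2F → neither <-irr <-irr)
    from : Av321 σ → Avoids pat321 σ
    from av (a ∷ b ∷ c ∷ [] , p , o) = av a b c (p 0F 1F (s≤s z≤n)) (p 1F 2F (s≤s (s≤s z≤n)))
      (Equivalence.from (o 2F 1F) (s≤s (s≤s z≤n))) (Equivalence.from (o 1F 0F) (s≤s (s≤s (s≤s z≤n))))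

  at : List Bool → ℕ → Bool
  at []       i       = false
  at (b ∷ bs) zero    = b
  at (b ∷ bs) (suc i) = at bs i

  -- The number of cyclic double ascents when the values marked by bs are regarded as
  -- excedance values too.
  cdaᴹ : ∀ {m} → List Bool → Permutation′ m → ℕ
  cdaᴹ {m} bs σ =
    # (λ x → (T? (at bs (toℕ x)) ⊎-dec (σ ⟨$⟩ˡ x Fin.<? x)) ×-dec (x Fin.<? σ ⟨$⟩ʳ x)) (allFin m)

  if-elim : ∀ {c ℓ} (R : CommutativeRing c ℓ) → let open CommutativeRing R renaming (_≈_ to _≋_) in
    ∀ {p} {P : Set p} {x y v : Carrier} (P? : Dec P) →
    (P → x ≋ v) → (¬ P → y ≋ v) → (if does P? then x else y) ≋ v
  if-elim R (yes p) f g = f p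
  if-elim R (no ¬p) f g = g ¬p

  at-tail : ∀ bs i → at bs (suc i) ≡ at (tail bs) i
  at-tail []       i = refl
  at-tail (b ∷ bs) i = refl

  at-pad⁺ : ∀ bs j → length bs ≤ j → ∀ i → T (at bs i) ⊎ i ≡ j → T (at (pad bs j) i)
  at-pad⁺ []       zero    _        i       (inj₂ refl) = _
  at-pad⁺ []       (suc j) _        (suc i) (inj₂ refl) = at-pad⁺ [] j z≤n i (inj₂ refl)
  at-pad⁺ (b ∷ bs) (suc j) (s≤s le) zero    (inj₁ t)    = t
  at-pad⁺ (b ∷ bs) (suc j) (s≤s le) (suc i) (inj₁ t)    = at-pad⁺ bs j le i (inj₁ t)
  at-pad⁺ (b ∷ bs) (suc j) (s≤s le) (suc i) (inj₂ refl) = at-pad⁺ bs j le i (inj₂ refl)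

  at-pad⁻ : ∀ bs j i → T (at (pad bs j) i) → T (at bs i) ⊎ i ≡ j
  at-pad⁻ []       zero    zero    _ = inj₂ refl
  at-pad⁻ []       (suc j) (suc i) t = [ inj₁ , inj₂ ∘ cong suc ]′ (at-pad⁻ [] j i t)
  at-pad⁻ (b ∷ bs) zero    zero    _ = inj₂ refl
  at-pad⁻ (b ∷ bs) (suc j) zero    t = inj₁ t
  at-pad⁻ (b ∷ bs) (suc j) (suc i) t = [ inj₁ , inj₂ ∘ cong suc ]′ (at-pad⁻ bs j i t)

  module _ {m} (σ : Permutation′ (suc m)) where
    open Head σ
    open Head321 σ

    -- Whether `x` is a cyclic double ascent depends on the position of the value `x`, which `ρ` no
    -- longer knows for `x = j`. A new mark, shifted by one like all positions, keeps it.
    cda-head : Inc j ρ → ∀ bs bs′ →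
      (∀ i → T (at bs′ i) ⇔ (T (at bs (suc i)) ⊎ suc i ≡ j)) →
      cdaᴹ bs σ ≡ 𝟙 (head bs ∧ does (0 ℕ.<? j)) + cdaᴹ bs′ ρ
    cda-head inc bs bs′ marks = trans (#-allFin P) (cong₂ _+_ (cong (λ b → 𝟙 (b ∧ does (0 ℕ.<? j))) (at-0 bs))
      (#-cong (λ x → P (suc x)) P′ (λ i → mk⇔ (to i) (from i)) (allFin m)))
      where
      P : Decidable (λ (x : Fin (suc m)) → (T (at bs (toℕ x)) ⊎ σ ⟨$⟩ˡ x Fin.< x) × x Fin.< σ ⟨$⟩ʳ x)
      P x = (T? (at bs (toℕ x)) ⊎-dec (σ ⟨$⟩ˡ x Fin.<? x)) ×-dec (x Fin.<? σ ⟨$⟩ʳ x)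
      P′ : Decidable (λ (x : Fin m) → (T (at bs′ (toℕ x)) ⊎ ρ ⟨$⟩ˡ x Fin.< x) × x Fin.< ρ ⟨$⟩ʳ x)
      P′ x = (T? (at bs′ (toℕ x)) ⊎-dec (ρ ⟨$⟩ˡ x Fin.<? x)) ×-dec (x Fin.<? ρ ⟨$⟩ʳ x)
      at-0 : ∀ bs → does (T? (at bs 0)) ∨ false ≡ head bs
      at-0 []           = refl
      at-0 (true ∷ bs)  = refl
      at-0 (false ∷ bs) = refl
      to : ∀ i → (T (at bs (suc (toℕ i))) ⊎ σ ⟨$⟩ˡ suc i Fin.< suc i) × suc i Fin.< σ ⟨$⟩ʳ suc i →
        (T (at bs′ (toℕ i)) ⊎ ρ ⟨$⟩ˡ i Fin.< i) × i Fin.< ρ ⟨$⟩ʳ i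
      to i (inj₁ t , e) = inj₁ (Equivalence.from (marks (toℕ i)) (inj₁ t)) , exc-suc⁻ inc i e
      to i (inj₂ l , e) = [ inj₁ ∘ Equivalence.from (marks (toℕ i)) ∘ inj₂ , inj₂ ]′ (inverse-suc⁻ inc i l)
                        , exc-suc⁻ inc i e
      from : ∀ i → (T (at bs′ (toℕ i)) ⊎ ρ ⟨$⟩ˡ i Fin.< i) × i Fin.< ρ ⟨$⟩ʳ i →
        (T (at bs (suc (toℕ i))) ⊎ σ ⟨$⟩ˡ suc i Fin.< suc i) × suc i Fin.< σ ⟨$⟩ʳ suc i
      from i (inj₁ t , e) = [ inj₁ , inj₂ ∘ inverse-suc⁺ inc i ∘ inj₁ ]′ (Equivalence.to (marks (toℕ i)) t)
                          , exc-suc⁺ inc i e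
      from i (inj₂ l , e) = inj₂ (inverse-suc⁺ inc i (inj₂ l)) , exc-suc⁺ inc i e

  module Sum321 {c ℓ} (R : CommutativeRing c ℓ) (q z : CommutativeRing.Carrier R) where

    private module R = CommutativeRing R
    open R using (Carrier; _*_; 0#; 1#) renaming (_≈_ to _≋_)
    open CodeSums.Code321 R q z using (val)
    open PathSums.Motzkin R q z using (ζ)
    open GeneratingFunctions R using (_^_)
    open import Algebra.Properties.Semiring.Exp R.semiring using (^-homo-*)
    open import Relation.Binary.Reasoning.Setoid R.setoid
    open import Algebra.Solver.Ring.NaturalCoefficients.Default R.commutativeSemiring
      using (solve; _:*_; _:=_)

    weight : ∀ {m} → (ℕ → Carrier) → List Bool → Permutation′ m → Carrier
    weight f bs σ = f (exc σ) * (z ^ cdaᴹ bs σ * q ^ inv σ)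

    val-zero : ∀ {j} f bs c → j ≡ 0 → val f bs (j ∷ c) ≡ val f (tail bs) c
    val-zero f bs c refl = refl

    val-suc : ∀ {j i} f bs c → j ≡ suc i → length (tail bs) ≤ i →
      val f bs (j ∷ c) ≡ ζ (head bs) * (q ^ suc i * val (f ∘ suc) (pad (tail bs) i) c)
    val-suc {i = i} f bs c refl le rewrite dec-true (length (tail bs) ℕ.≤? i) le = refl

    val-suc-0 : ∀ {j i} f bs c → j ≡ suc i → ¬ length (tail bs) ≤ i → val f bs (j ∷ c) ≡ 0#
    val-suc-0 {i = i} f bs c refl ≰ rewrite dec-false (length (tail bs) ℕ.≤? i) ≰ = refl

    length-tail≡ : ∀ bs → ℕ.pred (length bs) ≡ length (tail bs)
    length-tail≡ []       = refl
    length-tail≡ (b ∷ bs) = refl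

    length≤ : ∀ bs {i} → length (tail bs) ≤ i → length bs ≤ suc i
    length≤ []       _  = z≤n
    length≤ (b ∷ bs) le = s≤s le

    length> : ∀ bs {i} → ¬ length (tail bs) ≤ i → suc i < length bs
    length> []       ≰ = contradiction z≤n ≰
    length> (b ∷ bs) ≰ = s≤s (ℕ.≰⇒> ≰)

    z^𝟙 : ∀ b → z ^ 𝟙 b ≋ ζ b
    z^𝟙 true  = R.*-identityʳ z
    z^𝟙 false = R.refl

    zero-or-suc : ∀ j → j ≡ 0 ⊎ ∃ λ i → j ≡ suc i
    zero-or-suc zero    = inj₁ refl
    zero-or-suc (suc i) = inj₂ (i , refl)

    -- The invariant `Inc (length bs)` is restored in both cases: a zero entry lowers the threshold
    -- by one, and an entry `suc i` makes it `suc i`, the length of the padded list.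
    val-avoiding : ∀ m σ f bs → Av321 σ → Inc (length bs) σ → val f bs (code m σ) ≋ weight f bs σ
    val-avoiding zero    σ f bs av inc = R.sym (R.trans (R.*-congˡ (R.*-identityˡ 1#)) (R.*-identityʳ (f 0)))
    val-avoiding (suc m) σ f bs av inc = case zero-or-suc j of λ where
        (inj₁ j≡0) → begin
          val f bs (j ∷ code m ρ)
            ≡⟨ val-zero f bs (code m ρ) j≡0 ⟩
          val f (tail bs) (code m ρ)
            ≈⟨ val-avoiding m ρ f (tail bs) (Av321-ρ av)
                 (subst (λ h → Inc h ρ) (length-tail≡ bs) (Inc-zero⁻ (length bs) j≡0 inc)) ⟩
          weight f (tail bs) ρ
            ≡⟨ cong₂ _*_
                 (cong f (trans (exc-head incρ) (cong (λ j → 𝟙 (does (0 ℕ.<? j)) + exc ρ) j≡0)))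
                 (cong₂ (λ a b → z ^ a * q ^ b)
                   (trans (cda-head σ incρ bs (tail bs) (marks₀ j≡0))
                     (trans (cong (λ j → 𝟙 (head bs ∧ does (0 ℕ.<? j)) + cdaᴹ (tail bs) ρ) j≡0)
                            (cong (λ b → 𝟙 b + cdaᴹ (tail bs) ρ) (∧-zeroʳ (head bs)))))
                   (trans inv-head (cong (_+ inv ρ) j≡0))) ⟨
          weight f bs σ ∎
        (inj₂ (i , j≡)) → case length (tail bs) ℕ.≤? i of λ where
          (no ≰)  → contradiction inc (Inc-between (length bs) (subst (0 <_) (sym j≡) (s≤s z≤n))
                      (subst (_< length bs) (sym j≡) (length> bs ≰)))
          (yes le) → begin
            val f bs (j ∷ code m ρ)
              ≡⟨ val-suc f bs (code m ρ) j≡ le ⟩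
            ζ (head bs) * (q ^ suc i * val (f ∘ suc) (pad (tail bs) i) (code m ρ))
              ≈⟨ R.*-congˡ (R.*-congˡ (val-avoiding m ρ (f ∘ suc) (pad (tail bs) i) (Av321-ρ av)
                   (subst (λ h → Inc h ρ) (trans j≡ (sym (length-pad (tail bs) i))) incρ))) ⟩
            ζ (head bs) * (q ^ suc i * (f (suc (exc ρ)) * (z ^ C i * q ^ inv ρ)))
              ≈⟨ R.*-congʳ (z^𝟙 (head bs)) ⟨
            z ^ 𝟙 (head bs) * (q ^ suc i * (f (suc (exc ρ)) * (z ^ C i * q ^ inv ρ)))
              ≈⟨ solve 5 (λ a b c d e → a :* (b :* (c :* (d :* e))) := c :* ((a :* d) :* (b :* e))) R.refl
                   (z ^ 𝟙 (head bs)) (q ^ suc i) (f (suc (exc ρ))) (z ^ C i) (q ^ inv ρ) ⟩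
            f (suc (exc ρ)) * ((z ^ 𝟙 (head bs) * z ^ C i) * (q ^ suc i * q ^ inv ρ))
              ≈⟨ R.*-congˡ (R.*-cong (^-homo-* z (𝟙 (head bs)) (C i)) (^-homo-* q (suc i) (inv ρ))) ⟨
            f (suc (exc ρ)) * (z ^ (𝟙 (head bs) + C i) * q ^ (suc i + inv ρ))
              ≡⟨ cong₂ _*_
                   (cong f (trans (exc-head incρ) (cong (λ j → 𝟙 (does (0 ℕ.<? j)) + exc ρ) j≡)))
                   (cong₂ (λ a b → z ^ a * q ^ b)
                     (trans (cda-head σ incρ bs (pad (tail bs) i) (marks₊ i j≡ le))
                       (trans (cong (λ j → 𝟙 (head bs ∧ does (0 ℕ.<? j)) + C i) j≡)
                              (cong (λ b → 𝟙 b + C i) (∧-identityʳ (head bs)))))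
                     (trans inv-head (cong (_+ inv ρ) j≡))) ⟨
            weight f bs σ ∎
      where
      open Head σ
      open Head321 σ
      incρ : Inc j ρ
      incρ = Av321-Inc av
      C : ℕ → ℕ
      C i = cdaᴹ (pad (tail bs) i) ρ
      marks₀ : j ≡ 0 → ∀ i → T (at (tail bs) i) ⇔ (T (at bs (suc i)) ⊎ suc i ≡ j)
      marks₀ j≡0 i = mk⇔ (inj₁ ∘ subst T (sym (at-tail bs i)))
        [ subst T (at-tail bs i) , (λ e → contradiction (trans e j≡0) λ ()) ]′
      marks₊ : ∀ k → j ≡ suc k → length (tail bs) ≤ k →
        ∀ i → T (at (pad (tail bs) k) i) ⇔ (T (at bs (suc i)) ⊎ suc i ≡ j)
      marks₊ k j≡ le i = mk⇔
        ([ inj₁ ∘ subst T (sym (at-tail bs i)) , (λ e → inj₂ (trans (cong suc e) (sym j≡))) ]′ ∘ at-pad⁻ (tail bs) k i)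
        (at-pad⁺ (tail bs) k le i ∘
          [ inj₁ ∘ subst T (at-tail bs i) , (λ e → inj₂ (ℕ.suc-injective (trans e j≡))) ]′)

    val-nonavoiding : ∀ m σ f bs → ¬ (Av321 σ × Inc (length bs) σ) → val f bs (code m σ) ≋ 0#
    val-nonavoiding zero    σ f bs ¬av = contradiction ((λ ()) , λ ()) ¬av
    val-nonavoiding (suc m) σ f bs ¬av = case zero-or-suc j of λ where
        (inj₁ j≡0) → R.trans (R.reflexive (val-zero f bs (code m ρ) j≡0))
          (val-nonavoiding m ρ f (tail bs) λ (av , inc) → ¬av
            ( Av321-σ av (subst (λ h → Inc h ρ) (sym j≡0) (Inc-0 ρ))
            , Inc-zero⁺ (length bs) j≡0 (subst (λ h → Inc h ρ) (sym (length-tail≡ bs)) inc)))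
        (inj₂ (i , j≡)) → case length (tail bs) ℕ.≤? i of λ where
          (no ≰)   → R.reflexive (val-suc-0 f bs (code m ρ) j≡ ≰)
          (yes le) → R.trans (R.reflexive (val-suc f bs (code m ρ) j≡ le)) (R.trans
            (R.*-congˡ (R.trans (R.*-congˡ (val-nonavoiding m ρ (f ∘ suc) (pad (tail bs) i) λ (av , inc) →
              let incρ = subst (λ h → Inc h ρ) (trans (length-pad (tail bs) i) (sym j≡)) inc in
              ¬av (Av321-σ av incρ , Inc-above (length bs) (subst (length bs ≤_) (sym j≡) (length≤ bs le)) incρ)))
              (R.zeroʳ _))) (R.zeroʳ _))
      where
      open Head σ
      open Head321 σ

    cdaᴹ-[] : ∀ {m} (σ : Permutation′ m) → cdaᴹ [] σ ≡ cda σ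
    cdaᴹ-[] {m} σ = #-cong
      (λ x → (T? false ⊎-dec (σ ⟨$⟩ˡ x Fin.<? x)) ×-dec (x Fin.<? σ ⟨$⟩ʳ x))
      (λ x → (σ ⟨$⟩ˡ x Fin.<? x) ×-dec (x Fin.<? σ ⟨$⟩ʳ x))
      (λ x → mk⇔ (λ { (inj₂ l , e) → l , e }) (λ (l , e) → inj₂ l , e)) (allFin m)

    val-code : ∀ m (σ : Permutation′ m) f →
      (if does (avoids? pat321 σ) then f (exc σ) * (z ^ cda σ * q ^ inv σ) else 0#) ≋ val f [] (code m σ)
    val-code m σ f = if-elim R (avoids? pat321 σ)
      (λ av → R.sym (R.trans (val-avoiding m σ f [] (Equivalence.to (avoids321⇔ σ) av) (Inc-0 σ))
         (R.reflexive (cong (λ a → f (exc σ) * (z ^ a * q ^ inv σ)) (cdaᴹ-[] σ)))))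
      (λ ¬av → R.sym (val-nonavoiding m σ f [] λ (av , _) → ¬av (Equivalence.from (avoids321⇔ σ) av)))

  -- Avoidance of 231

  Av231 : ∀ {m} → Permutation′ m → Set
  Av231 {m} σ = ∀ (a b c : Fin m) → a Fin.< b → b Fin.< c →
    σ ⟨$⟩ʳ c Fin.< σ ⟨$⟩ʳ a → ¬ σ ⟨$⟩ʳ a Fin.< σ ⟨$⟩ʳ b

  avoids231⇔ : ∀ {m} (σ : Permutation′ m) → Avoids pat231 σ ⇔ Av231 σ
  avoids231⇔ {m} σ = mk⇔ to from
    where
    to : Avoids pat231 σ → Av231 σ
    to av a b c a<b b<c c<a a<b′ = av (a ∷ b ∷ c ∷ [] , increasing₃ a<b b<c , λ where
      0F 0F → neither <-irr <-irr
      0F 1F → both a<b′ (s≤s (s≤s (s≤s z≤n)))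
      0F 2F → neither (ℕ.<⇒≯ c<a) (λ { (s≤s ()) })
      1F 0F → neither (ℕ.<⇒≯ a<b′) (λ { (s≤s (s≤s ())) })
      1F 1F → neither <-irr <-irr
      1F 2F → neither (ℕ.<⇒≯ (ℕ.<-trans c<a a<b′)) (λ { (s≤s ()) })
      2F 0F → both c<a (s≤s (s≤s z≤n))
      2F 1F → both (ℕ.<-trans c<a a<b′) (s≤s (s≤s z≤n))
      2F 2F → neither <-irr <-irr)
    from : Av231 σ → Avoids pat231 σ
    from av (a ∷ b ∷ c ∷ [] , p , o) = av a b c (p 0F 1F (s≤s z≤n)) (p 1F 2F (s≤s (s≤s z≤n)))
      (Equivalence.from (o 2F 0F) (s≤s (s≤s z≤n))) (Equivalence.from (o 0F 1F) (s≤s (s≤s (s≤s z≤n))))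

  -- In a 231-avoiding word all values below the first entry precede those above it. Each deleted
  -- entry thus leaves a boundary `t` between remaining values that must be used up from the bottom.
  Sep : ∀ {m} → ℕ → Permutation′ m → Set
  Sep {m} t σ = ∀ (a b : Fin m) → a Fin.< b → t ≤ toℕ (σ ⟨$⟩ʳ a) → ¬ toℕ (σ ⟨$⟩ʳ b) < t

  -- The offset o is the total size of the blocks already split off.
  Blocks : ∀ {m} → ℕ → List ℕ → Permutation′ m → Set
  Blocks o []       σ = ⊤
  Blocks o (s ∷ bl) σ = Sep (o + s) σ × Blocks (o + s) bl σ

  Sep-0 : ∀ {m} (σ : Permutation′ m) → Sep 0 σ
  Sep-0 σ _ _ _ _ ()

  Blocks-empty : ∀ o bl (σ : Permutation′ 0) → Blocks o bl σ
  Blocks-empty o []       σ = tt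
  Blocks-empty o (s ∷ bl) σ = (λ ()) , Blocks-empty (o + s) bl σ

  module Head231 {m} (σ : Permutation′ (suc m)) where
    open Head σ

    Av231-ρ : Av231 σ → Av231 ρ
    Av231-ρ av a b c a<b b<c ρc<ρa ρa<ρb =
      av (suc a) (suc b) (suc c) (s≤s a<b) (s≤s b<c) (mono c a ρc<ρa) (mono a b ρa<ρb)

    Av231-Sep : Av231 σ → Sep j ρ
    Av231-Sep av a b a<b j≤ρa ρb<j =
      av zero (suc a) (suc b) (s≤s z≤n) (s≤s a<b) (<-head⁺ b ρb<j)
        (subst (j <_) (sym (above a j≤ρa)) (s≤s j≤ρa))

    Av231-σ : Av231 ρ → Sep j ρ → Av231 σ
    Av231-σ av sep zero    (suc b) (suc c) _         (s≤s b<c) σc<j σb>j =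
      sep b c b<c (ℕ.≮⇒≥ λ ρb<j → ℕ.<⇒≯ σb>j (<-head⁺ b ρb<j)) (<-head⁻ c σc<j)
    Av231-σ av sep (suc a) (suc b) (suc c) (s≤s a<b) (s≤s b<c) σc<σa σa<σb =
      av a b c a<b b<c (cancel c a σc<σa) (cancel a b σa<σb)

    -- The value 0 stands to the right of the first entry, so an entry on or above a positive
    -- boundary would precede a value below it. Hence the first entry belongs to the first nonempty
    -- block.
    Sep-low : ∀ t → 0 < t → t ≤ j → ¬ Sep t σ
    Sep-low t 0<t t≤j sep =
      sep zero i (ℕ.n≢0⇒n>0 i≢0) t≤j (subst (_< t) (sym (cong toℕ (inverseʳ σ))) 0<t)
      where
      i = σ ⟨$⟩ˡ zero
      i≢0 : toℕ i ≢ 0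
      i≢0 e = ℕ.<⇒≢ (ℕ.<-≤-trans 0<t t≤j) (trans (sym (cong toℕ (inverseʳ σ {zero})))
        (cong (toℕ ∘ (σ ⟨$⟩ʳ_)) (Fin.toℕ-injective {j = zero} e)))

    Sep⁻ : ∀ t → j ≤ t → Sep (suc t) σ → Sep t ρ
    Sep⁻ t j≤t sep a b a<b t≤ρa ρb<t = sep (suc a) (suc b) (s≤s a<b)
      (subst (suc t ≤_) (sym (above a (ℕ.≤-trans j≤t t≤ρa))) (s≤s t≤ρa))
      (ℕ.≤-<-trans (σ⁺≤ b) (s≤s ρb<t))

    Sep⁺ : ∀ t → j ≤ t → Sep t ρ → Sep (suc t) σ
    Sep⁺ t j≤t sep zero    (suc b) _         t<j  _    = ℕ.<⇒≱ t<j j≤t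
    Sep⁺ t j≤t sep (suc a) (suc b) (s≤s a<b) t<σa σb≤t =
      sep a b a<b (s≤s⁻¹ (ℕ.≤-trans t<σa (σ⁺≤ a))) ρb<t
      where
      ρb<t : ρᵛ b < t
      ρb<t with ρᵛ b ℕ.<? j
      ... | yes p = ℕ.<-≤-trans p j≤t
      ... | no ¬p = s≤s⁻¹ (subst (_< suc t) (above b (ℕ.≮⇒≥ ¬p)) σb≤t)

    Blocks⁻ : ∀ o bl → j ≤ o → Blocks (suc o) bl σ → Blocks o bl ρ
    Blocks⁻ o []       j≤o _            = tt
    Blocks⁻ o (s ∷ bl) j≤o (sep , blks) = Sep⁻ (o + s) j≤o+s sep , Blocks⁻ (o + s) bl j≤o+s blks
      where j≤o+s = ℕ.≤-trans j≤o (ℕ.m≤m+n o s)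

    Blocks⁺ : ∀ o bl → j ≤ o → Blocks o bl ρ → Blocks (suc o) bl σ
    Blocks⁺ o []       j≤o _            = tt
    Blocks⁺ o (s ∷ bl) j≤o (sep , blks) = Sep⁺ (o + s) j≤o+s sep , Blocks⁺ (o + s) bl j≤o+s blks
      where j≤o+s = ℕ.≤-trans j≤o (ℕ.m≤m+n o s)

    split⁻ : ∀ s bl → j ≤ s → Av231 σ → Blocks 0 (suc s ∷ bl) σ → Blocks 0 (j ∷ s ∸ j ∷ bl) ρ
    split⁻ s bl j≤s av (sep , blks) = Av231-Sep av ,
      subst (λ o → Sep o ρ × Blocks o bl ρ) (sym (ℕ.m+[n∸m]≡n j≤s)) (Sep⁻ s j≤s sep , Blocks⁻ s bl j≤s blks)

    split⁺ : ∀ s bl → j ≤ s → Av231 ρ → Blocks 0 (j ∷ s ∸ j ∷ bl) ρ → Av231 σ × Blocks 0 (suc s ∷ bl) σ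
    split⁺ s bl j≤s av (sepⱼ , rest)
      with sep , blks ← subst (λ o → Sep o ρ × Blocks o bl ρ) (ℕ.m+[n∸m]≡n j≤s) rest =
      Av231-σ av sepⱼ , Sep⁺ s j≤s sep , Blocks⁺ s bl j≤s blks

  -- Descents, drops and double descents of a code

  desᶜ dropᶜ : ℕ → List ℕ → ℕ
  desᶜ p []      = 0
  desᶜ p (j ∷ c) = 𝟙 (does (j ℕ.<? p)) + desᶜ j c
  dropᶜ p []      = 0
  dropᶜ p (j ∷ c) = (p ∸ j) + dropᶜ j c

  lddᶜ : Bool → ℕ → List ℕ → ℕ
  lddᶜ d p []      = 0
  lddᶜ d p (j ∷ c) = 𝟙 (d ∧ does (j ℕ.<? p)) + lddᶜ (does (j ℕ.<? p)) j c

  steps-suc : ∀ m → steps (suc (suc m)) ≡ (zero , suc zero) ∷ map (λ (a , b) → suc a , suc b) (steps (suc m))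
  steps-suc m = cong ((zero , suc zero) ∷_) (trans (List.map-tabulate {n = m} suc (λ i → inject₁ i , suc i))
    (sym (trans (sym (List.map-∘ (allFin m)))
      (List.map-tabulate {n = m} (λ i → i) (λ i → suc (inject₁ i) , suc (suc i))))))

  -- Deleting the first entry does not change whether the second one lies below it, so a permutation
  -- descends exactly where its code decreases.
  des-code : ∀ m (σ : Permutation′ (suc m)) → des σ ≡ desᶜ (toℕ (σ ⟨$⟩ʳ zero)) (code m (remove zero σ))
  des-code zero    σ = refl
  des-code (suc m) σ = begin
    # P (steps (suc (suc m)))                ≡⟨ cong (# P) (steps-suc m) ⟩
    # P ((zero , suc zero) ∷ map sucs (steps (suc m)))
      ≡⟨ #-∷ P (zero , suc zero) (map sucs (steps (suc m))) ⟩
    𝟙 (does (σ⁺ zero ℕ.<? j)) + # P (map sucs (steps (suc m)))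
      ≡⟨ cong₂ _+_
           (cong 𝟙 (does-⇔ (mk⇔ (<-head⁻ zero) (<-head⁺ zero)) (σ⁺ zero ℕ.<? j) (ρᵛ zero ℕ.<? j)))
           (trans (#-map P sucs (steps (suc m)))
             (#-cong (λ (a , b) → P (suc a , suc b)) (λ (a , b) → ρ ⟨$⟩ʳ b Fin.<? ρ ⟨$⟩ʳ a)
               (λ (a , b) → mk⇔ (cancel b a) (mono b a)) (steps (suc m)))) ⟩
    𝟙 (does (ρᵛ zero ℕ.<? j)) + des ρ
      ≡⟨ cong (𝟙 (does (ρᵛ zero ℕ.<? j)) +_) (des-code m ρ) ⟩
    desᶜ j (code (suc m) ρ) ∎
    where
    open ≡-Reasoning
    open Head σ
    sucs : Fin (suc m) × Fin (suc m) → Fin (suc (suc m)) × Fin (suc (suc m))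
    sucs (a , b) = suc a , suc b
    P : Decidable (λ ((a , b) : Fin (suc (suc m)) × Fin (suc (suc m))) → σ ⟨$⟩ʳ b Fin.< σ ⟨$⟩ʳ a)
    P (a , b) = σ ⟨$⟩ʳ b Fin.<? σ ⟨$⟩ʳ a

  -- In a Lehmer code, the later entries lying between those of a descent are
  -- counted by the drop of the code, minus one for the descent itself.
  drop-code : ∀ m (σ : Permutation′ (suc m)) →
    31-2 σ + des σ ≡ dropᶜ (toℕ (σ ⟨$⟩ʳ zero)) (code m (remove zero σ))
  drop-code zero    σ = refl
  drop-code (suc m) σ = begin
    31-2 σ + des σ
      ≡⟨ cong₂ _+_ 31-2-head (des-code (suc m) σ) ⟩
    (j ∸ suc (ρᵛ zero) + 31-2 ρ) + (𝟙 (does (ρᵛ zero ℕ.<? j)) + desᶜ (ρᵛ zero) (code m (remove zero ρ)))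
      ≡⟨ cong (λ d → (j ∸ suc (ρᵛ zero) + 31-2 ρ) + (𝟙 (does (ρᵛ zero ℕ.<? j)) + d)) (des-code m ρ) ⟨
    (j ∸ suc (ρᵛ zero) + 31-2 ρ) + (𝟙 (does (ρᵛ zero ℕ.<? j)) + des ρ)
      ≡⟨ solve 4 (λ a b c d → (a :+ b) :+ (c :+ d) := (a :+ c) :+ (b :+ d)) refl
           (j ∸ suc (ρᵛ zero)) (31-2 ρ) (𝟙 (does (ρᵛ zero ℕ.<? j))) (des ρ) ⟩
    (j ∸ suc (ρᵛ zero) + 𝟙 (does (ρᵛ zero ℕ.<? j))) + (31-2 ρ + des ρ)
      ≡⟨ cong₂ _+_ (drop-suc j (ρᵛ zero)) (drop-code m ρ) ⟩
    dropᶜ j (code (suc m) ρ) ∎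
    where
    open ≡-Reasoning
    open import Data.Nat.Solver
    open +-*-Solver
    open Head σ
    Step : Set
    Step = Fin (suc m) × Fin (suc m)
    sucs : Step → Fin (suc (suc m)) × Fin (suc (suc m))
    sucs (a , b) = suc a , suc b
    all : List (Fin (suc (suc m)))
    all = zero ∷ map suc (allFin (suc m))
    P : Decidable (λ (((i , i⁺) , y) : (Fin (suc (suc m)) × Fin (suc (suc m))) × Fin (suc (suc m))) →
          i⁺ Fin.< y × σ ⟨$⟩ʳ i⁺ Fin.< σ ⟨$⟩ʳ y × σ ⟨$⟩ʳ y Fin.< σ ⟨$⟩ʳ i)
    P ((i , i⁺) , y) = (i⁺ Fin.<? y) ×-dec (σ ⟨$⟩ʳ i⁺ Fin.<? σ ⟨$⟩ʳ y) ×-dec (σ ⟨$⟩ʳ y Fin.<? σ ⟨$⟩ʳ i)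
    Pρ : Decidable (λ (((i , i⁺) , y) : Step × Fin (suc m)) →
          i⁺ Fin.< y × ρ ⟨$⟩ʳ i⁺ Fin.< ρ ⟨$⟩ʳ y × ρ ⟨$⟩ʳ y Fin.< ρ ⟨$⟩ʳ i)
    Pρ ((i , i⁺) , y) = (i⁺ Fin.<? y) ×-dec (ρ ⟨$⟩ʳ i⁺ Fin.<? ρ ⟨$⟩ʳ y) ×-dec (ρ ⟨$⟩ʳ y Fin.<? ρ ⟨$⟩ʳ i)

    drop-suc : ∀ j r → j ∸ suc r + 𝟙 (does (r ℕ.<? j)) ≡ j ∸ r
    drop-suc j r with r ℕ.<? j
    ... | yes r<j rewrite dec-true (r ℕ.<? j) r<j = trans (ℕ.+-comm _ 1) (sym (ℕ.+-∸-assoc 1 r<j))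
    ... | no  r≮j rewrite dec-false (r ℕ.<? j) r≮j =
      trans (ℕ.+-identityʳ _) (trans (ℕ.m≤n⇒m∸n≡0 (ℕ.m≤n⇒m≤1+n (ℕ.≮⇒≥ r≮j))) (sym (ℕ.m≤n⇒m∸n≡0 (ℕ.≮⇒≥ r≮j))))

    inRange : Decidable (λ (v : Fin (suc m)) → suc (ρᵛ zero) ≤ toℕ v × toℕ v < j)
    inRange v = (suc (ρᵛ zero) ℕ.≤? toℕ v) ×-dec (toℕ v ℕ.<? j)

    first : # (λ y → P ((zero , suc zero) , y)) all ≡ j ∸ suc (ρᵛ zero)
    first = begin
      # (λ y → P ((zero , suc zero) , y)) all
        ≡⟨ #-map (λ y → P ((zero , suc zero) , y)) suc (allFin (suc m)) ⟩
      # (λ y → P ((zero , suc zero) , suc y)) (allFin (suc m))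
        ≡⟨ #-cong (λ y → P ((zero , suc zero) , suc y)) (λ y → inRange (ρ ⟨$⟩ʳ y))
             (λ y → mk⇔ (λ (_ , l , h) → cancel zero y l , <-head⁻ y h)
                        (λ (l , h) → s≤s (positive y l) , mono zero y l , <-head⁺ y h)) (allFin (suc m)) ⟩
      # (λ y → inRange (ρ ⟨$⟩ʳ y)) (allFin (suc m))
        ≡⟨ #-values inRange ρ ⟩
      # inRange (allFin (suc m))
        ≡⟨ #-range (suc m) (suc (ρᵛ zero)) j (Fin.toℕ≤pred[n] (σ ⟨$⟩ʳ zero)) ⟩
      j ∸ suc (ρᵛ zero) ∎
      where
      positive : ∀ y → ρᵛ zero < ρᵛ y → 0 < toℕ y
      positive zero    l = contradiction l (ℕ.<-irrefl refl)
      positive (suc y) l = s≤s z≤n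

    31-2-head : 31-2 σ ≡ j ∸ suc (ρᵛ zero) + 31-2 ρ
    31-2-head = begin
      # P (cartesianProduct (steps (suc (suc m))) (allFin (suc (suc m))))
        ≡⟨ cong₂ (λ s l → # P (cartesianProduct s (zero ∷ l))) (steps-suc m)
             (sym (List.map-tabulate {n = suc m} (λ i → i) suc)) ⟩
      # P (cartesianProduct ((zero , suc zero) ∷ map sucs (steps (suc m))) all)
        ≡⟨ #-×-∷ˡ P (zero , suc zero) (map sucs (steps (suc m))) all ⟩
      # (λ y → P ((zero , suc zero) , y)) all + # P (cartesianProduct (map sucs (steps (suc m))) all)
        ≡⟨ cong₂ _+_ first (trans (#-×-∷ʳ P (map sucs (steps (suc m))) zero (map suc (allFin (suc m))))
             (cong₂ _+_ (#-none (λ s → P (s , zero)) (λ _ ()) (map sucs (steps (suc m))))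
               (trans (#-×-map P sucs suc (steps (suc m)) (allFin (suc m)))
                 (#-cong (λ ((a , b) , y) → P ((suc a , suc b) , suc y)) Pρ
                   (λ ((a , b) , y) → mk⇔
                     (λ (l , l₁ , l₂) → s≤s⁻¹ l , cancel b y l₁ , cancel y a l₂)
                     (λ (l , l₁ , l₂) → s≤s l , mono b y l₁ , mono y a l₂))
                   (cartesianProduct (steps (suc m)) (allFin (suc m))))))) ⟩
      j ∸ suc (ρᵛ zero) + 31-2 ρ ∎

  dd : ∀ {n} → ℕ → (Fin n → ℕ) → ℕ → ℕ
  dd {n} l g r = # (λ i → (w (inject₁ (suc i)) ℕ.<? w (inject₁ (inject₁ i)))

           ×-dec (w (suc (suc i)) ℕ.<? w (inject₁ (suc i))))
            (allFin n)
    where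
    w : Fin (suc (suc n)) → ℕ
    w = lookup (l ∷ (tabulate g ∷ʳ r))

  -- The rest of a word is not the word of `ρ`, but it is ordered alike. The induction therefore
  -- admits any `g` ordered like `σ`, and any left neighbour `l` that compares with the first letter
  -- as the previous code entry `p` does with the first code entry.
  dd-code : ∀ m (σ : Permutation′ (suc m)) l p g r →
    (∀ a b → g a < g b ⇔ σ ⟨$⟩ʳ a Fin.< σ ⟨$⟩ʳ b) → (g zero < l ⇔ toℕ (σ ⟨$⟩ʳ zero) < p) →
    (∀ a → g a < r) →
    dd l g r ≡ lddᶜ (does (toℕ (σ ⟨$⟩ʳ zero) ℕ.<? p)) (toℕ (σ ⟨$⟩ʳ zero)) (code m (remove zero σ))
  dd-code zero σ l p g r order left right =
    #-none (λ i → (w (inject₁ (suc i)) ℕ.<? w (inject₁ (inject₁ i)))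
           ×-dec (w (suc (suc i)) ℕ.<? w (inject₁ (suc i))))
      (λ { zero (_ , r<g) → ℕ.<⇒≯ r<g (right zero) }) (allFin 1)
    where
    w : Fin 3 → ℕ
    w = lookup (l ∷ (tabulate g ∷ʳ r))
  dd-code (suc m) σ l p g r order left right = trans
    (#-allFin (λ i → (w (inject₁ (suc i)) ℕ.<? w (inject₁ (inject₁ i)))
           ×-dec (w (suc (suc i)) ℕ.<? w (inject₁ (suc i)))))
    (cong₂ _+_ (cong 𝟙 (cong₂ _∧_
        (does-⇔ left (g zero ℕ.<? l) (j ℕ.<? p))
        (does-⇔ (left′ zero) (g (suc zero) ℕ.<? g zero) (ρᵛ zero ℕ.<? j))))
      (dd-code m ρ (g zero) j (g ∘ suc) r
        (λ a b → mk⇔ (cancel a b ∘ Equivalence.to (order (suc a) (suc b)))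
                     (Equivalence.from (order (suc a) (suc b)) ∘ mono a b))
        (left′ zero) (right ∘ suc)))
    where
    open Head σ
    w : Fin (suc (suc (suc (suc m)))) → ℕ
    w = lookup (l ∷ (tabulate g ∷ʳ r))
    left′ : ∀ a → g (suc a) < g zero ⇔ ρᵛ a < j
    left′ a = mk⇔ (<-head⁻ a ∘ Equivalence.to (order (suc a) zero))
                  (Equivalence.from (order (suc a) zero) ∘ <-head⁺ a)

  ldd-code : ∀ m (σ : Permutation′ m) → ldd σ ≡ lddᶜ false 0 (code m σ)
  ldd-code zero    σ = refl
  ldd-code (suc m) σ = dd-code m σ 0 0 (λ i → suc (toℕ (σ ⟨$⟩ʳ i))) (suc (suc m))
    (λ a b → mk⇔ s≤s⁻¹ s≤s) (mk⇔ (λ ()) (λ ())) (λ a → s≤s (Fin.toℕ<n (σ ⟨$⟩ʳ a)))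

  module Sum231 {c ℓ} (R : CommutativeRing c ℓ) (q : CommutativeRing.Carrier R) where

    private module R = CommutativeRing R
    open R using (Carrier; _*_; 0#; 1#) renaming (_≈_ to _≋_)
    open CodeSums.Code231 R q using (val)
    open GeneratingFunctions R using (_^_)
    open import Algebra.Properties.Semiring.Exp R.semiring using (^-homo-*)
    open import Relation.Binary.Reasoning.Setoid R.setoid
    open import Algebra.Solver.Ring.NaturalCoefficients.Default R.commutativeSemiring
      using (solve; _:*_; _:=_)

    weight : (ℕ → Carrier) → Bool → ℕ → List ℕ → Carrier
    weight f d p c = f (desᶜ p c) * (0# ^ lddᶜ d p c * q ^ dropᶜ p c)

    next : (ℕ → Carrier) → Bool → ℕ → ℕ → List ℕ → List ℕ → Carrier
    next f d p j bl c = if does (j ℕ.<? p)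
      then (if d then 0# else q ^ (p ∸ j) * val (f ∘ suc) true j bl c)
      else val f false j bl c

    val-inside : ∀ f d p s bl j c → j ≤ s → val f d p (suc s ∷ bl) (j ∷ c) ≡ next f d p j (j ∷ s ∸ j ∷ bl) c
    val-inside f d p s bl j c j≤s rewrite dec-true (j ℕ.≤? s) j≤s = refl

    val-outside : ∀ f d p s bl j c → ¬ j ≤ s → val f d p (suc s ∷ bl) (j ∷ c) ≡ 0#
    val-outside f d p s bl j c j≰s rewrite dec-false (j ℕ.≤? s) j≰s = refl

    next-weight : ∀ f d p j bl c → (∀ f d → val f d j bl c ≋ weight f d j c) →
      next f d p j bl c ≋ weight f d p (j ∷ c)
    next-weight f d p j bl c ih = if-elim R (j ℕ.<? p) descent ascent
      where
      e = desᶜ j c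
      D = dropᶜ j c
      L : Bool → ℕ
      L d = lddᶜ d j c
      descent : j < p → (if d then 0# else q ^ (p ∸ j) * val (f ∘ suc) true j bl c) ≋ weight f d p (j ∷ c)
      descent j<p rewrite dec-true (j ℕ.<? p) j<p = lem d
        where
        lem : ∀ d → (if d then 0# else q ^ (p ∸ j) * val (f ∘ suc) true j bl c) ≋
          f (suc e) * (0# ^ (𝟙 (d ∧ true) + L true) * q ^ (p ∸ j + D))
        lem true  = R.sym (R.trans (R.*-congˡ (R.trans (R.*-congʳ (R.zeroˡ _)) (R.zeroˡ _))) (R.zeroʳ _))
        lem false = begin
          q ^ (p ∸ j) * val (f ∘ suc) true j bl c                 ≈⟨ R.*-congˡ (ih (f ∘ suc) true) ⟩
          q ^ (p ∸ j) * (f (suc e) * (0# ^ L true * q ^ D))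
            ≈⟨ solve 4 (λ a b c d → a :* (b :* (c :* d)) := b :* (c :* (a :* d))) R.refl
                 (q ^ (p ∸ j)) (f (suc e)) (0# ^ L true) (q ^ D) ⟩
          f (suc e) * (0# ^ L true * (q ^ (p ∸ j) * q ^ D))       ≈⟨ R.*-congˡ (R.*-congˡ (^-homo-* q (p ∸ j) D)) ⟨
          f (suc e) * (0# ^ L true * q ^ (p ∸ j + D))             ∎
      ascent : ¬ j < p → val f false j bl c ≋ weight f d p (j ∷ c)
      ascent j≮p rewrite dec-false (j ℕ.<? p) j≮p | ∧-zeroʳ d | ℕ.m≤n⇒m∸n≡0 (ℕ.≮⇒≥ j≮p) = ih f false

    val-avoiding : ∀ m σ f d p bl → sum bl ≡ m → Av231 σ → Blocks 0 bl σ →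
      val f d p bl (code m σ) ≋ weight f d p (code m σ)
    val-avoiding zero    σ f d p bl           e av blks =
      R.sym (R.trans (R.*-congˡ (R.*-identityˡ 1#)) (R.*-identityʳ (f 0)))
    val-avoiding (suc m) σ f d p (zero  ∷ bl) e av (_ , blks) = val-avoiding (suc m) σ f d p bl e av blks
    val-avoiding (suc m) σ f d p (suc s ∷ bl) e av blks = case j ℕ.≤? s of λ where
        (no j≰s)  → contradiction (proj₁ blks) (Sep-low (suc s) (s≤s z≤n) (ℕ.≰⇒> j≰s))
        (yes j≤s) → R.trans (R.reflexive (val-inside f d p s bl j (code m ρ) j≤s))
          (next-weight f d p j (j ∷ s ∸ j ∷ bl) (code m ρ) λ f d →
            val-avoiding m ρ f d j (j ∷ s ∸ j ∷ bl)
              (trans (split-size j s (sum bl) j≤s) (ℕ.suc-injective e))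
              (Av231-ρ av) (split⁻ s bl j≤s av blks))
      where
      open Head σ
      open Head231 σ

    next-0 : ∀ f d p j bl c → (∀ f d → val f d j bl c ≋ 0#) → next f d p j bl c ≋ 0#
    next-0 f d p j bl c ih = if-elim R (j ℕ.<? p) (λ _ → lem d) (λ _ → ih f false)
      where
      lem : ∀ d → (if d then 0# else q ^ (p ∸ j) * val (f ∘ suc) true j bl c) ≋ 0#
      lem true  = R.refl
      lem false = R.trans (R.*-congˡ (ih (f ∘ suc) true)) (R.zeroʳ _)

    val-nonavoiding : ∀ m σ f d p bl → ¬ (Av231 σ × Blocks 0 bl σ) → val f d p bl (code m σ) ≋ 0#
    val-nonavoiding zero    σ f d p bl           ¬av = contradiction ((λ ()) , Blocks-empty 0 bl σ) ¬av
    val-nonavoiding (suc m) σ f d p []           ¬av = R.refl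
    val-nonavoiding (suc m) σ f d p (zero  ∷ bl) ¬av =
      val-nonavoiding (suc m) σ f d p bl λ (av , blks) → ¬av (av , Sep-0 σ , blks)
    val-nonavoiding (suc m) σ f d p (suc s ∷ bl) ¬av = case j ℕ.≤? s of λ where
        (no j≰s)  → R.reflexive (val-outside f d p s bl j (code m ρ) j≰s)
        (yes j≤s) → R.trans (R.reflexive (val-inside f d p s bl j (code m ρ) j≤s))
          (next-0 f d p j (j ∷ s ∸ j ∷ bl) (code m ρ) λ f d →
            val-nonavoiding m ρ f d j (j ∷ s ∸ j ∷ bl) λ (av , blks) → ¬av (split⁺ s bl j≤s av blks))
      where
      open Head σ
      open Head231 σ

    stats : ∀ m (σ : Permutation′ m) → des σ ≡ desᶜ 0 (code m σ) × 31-2 σ + des σ ≡ dropᶜ 0 (code m σ)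
    stats zero    σ = refl , refl
    stats (suc m) σ = des-code m σ , trans (drop-code m σ)
      (cong (_+ dropᶜ (toℕ (σ ⟨$⟩ʳ zero)) (code m (remove zero σ)))
        (sym (ℕ.0∸n≡0 (toℕ (σ ⟨$⟩ʳ zero)))))

    val-code : ∀ m (σ : Permutation′ m) f →
      (if does (avoids? pat231 σ) then f (des σ) * (0# ^ ldd σ * q ^ (31-2 σ + des σ)) else 0#)
        ≋ val f false 0 (m ∷ []) (code m σ)
    val-code m σ f = if-elim R (avoids? pat231 σ)
      (λ av → R.sym (R.trans
        (val-avoiding m σ f false 0 (m ∷ []) (ℕ.+-identityʳ m) (Equivalence.to (avoids231⇔ σ) av) (whole , tt))
        (R.reflexive (cong₂ _*_ (cong f (sym (proj₁ (stats m σ))))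
          (cong₂ (λ a b → 0# ^ a * q ^ b) (sym (ldd-code m σ)) (sym (proj₂ (stats m σ))))))))
      (λ ¬av → R.sym (val-nonavoiding m σ f false 0 (m ∷ []) λ (av , _) →
        ¬av (Equivalence.from (avoids231⇔ σ) av)))
      where
      whole : Sep m σ
      whole a b _ m≤σa _ = ℕ.<⇒≱ (Fin.toℕ<n (σ ⟨$⟩ʳ a)) m≤σa

  -- Reversal and complementation

  _ʳ _ᶜ : ∀ {m} → Permutation′ m → Permutation′ m
  σ ʳ = Perm.reverse ∘ₚ σ
  σ ᶜ = σ ∘ₚ Perm.reverse

  reflect-< : ∀ M {a b a′ b′} → a′ + a ≡ M → b′ + b ≡ M → a′ < b′ ⇔ b < a
  reflect-< M {a} {b} {a′} {b′} refl e = mk⇔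
    (λ lt → ℕ.+-cancelˡ-< b′ b a (subst (_< b′ + a) (sym e) (ℕ.+-monoˡ-< a lt)))
    (λ lt → ℕ.+-cancelʳ-< a a′ b′ (subst (_< b′ + a) e (ℕ.+-monoʳ-< b′ lt)))

  opposite-sum : ∀ {m} (i : Fin m) → toℕ (opposite i) + suc (toℕ i) ≡ m
  opposite-sum i = trans (cong (_+ suc (toℕ i)) (Fin.opposite-prop i)) (ℕ.m∸n+n≡m (Fin.toℕ<n i))

  opposite-< : ∀ {m} (i j : Fin m) → opposite i Fin.< opposite j ⇔ j Fin.< i
  opposite-< {m} i j = mk⇔
    (s≤s⁻¹ ∘ Equivalence.to (reflect-< m (opposite-sum i) (opposite-sum j)))
    (Equivalence.from (reflect-< m (opposite-sum i) (opposite-sum j)) ∘ s≤s)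

  opposite-injective : ∀ {m} → Injective _≡_ _≡_ (opposite {m})
  opposite-injective {x = x} {y} e =
    trans (sym (Fin.opposite-involutive x)) (trans (cong opposite e) (Fin.opposite-involutive y))

  opposite-inject₁ : ∀ {m} (i : Fin m) → opposite (inject₁ i) ≡ suc (opposite i)
  opposite-inject₁ {suc m} zero    = refl
  opposite-inject₁ {suc m} (suc i) = cong inject₁ (opposite-inject₁ i)

  opposite-fromℕ : ∀ m → opposite (fromℕ m) ≡ zero
  opposite-fromℕ zero    = refl
  opposite-fromℕ (suc m) = cong inject₁ (opposite-fromℕ m)

  lookup-∷ʳ-inject₁ : ∀ {n} {A : Set} (xs : Vec A n) x i → lookup (xs ∷ʳ x) (inject₁ i) ≡ lookup xs i
  lookup-∷ʳ-inject₁ (y ∷ ys) x zero    = refl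
  lookup-∷ʳ-inject₁ (y ∷ ys) x (suc i) = lookup-∷ʳ-inject₁ ys x i

  lookup-∷ʳ-fromℕ : ∀ {n} {A : Set} (xs : Vec A n) x → lookup (xs ∷ʳ x) (fromℕ n) ≡ x
  lookup-∷ʳ-fromℕ []       x = refl
  lookup-∷ʳ-fromℕ (y ∷ ys) x = lookup-∷ʳ-fromℕ ys x

  module _ {n : ℕ} (g : Fin n → ℕ) (l r : ℕ) where

    lookup-reverse : ∀ x → lookup (l ∷ (tabulate g ∷ʳ r)) (opposite x) ≡
      lookup (r ∷ (tabulate (g ∘ opposite) ∷ʳ l)) x
    lookup-reverse zero    = lookup-∷ʳ-fromℕ (l ∷ tabulate g) r
    lookup-reverse (suc y) with view y
    ... | ‵fromℕ    = trans (cong (λ k → lookup (l ∷ (tabulate g ∷ʳ r)) (inject₁ k)) (opposite-fromℕ n))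
                        (sym (lookup-∷ʳ-fromℕ (tabulate (g ∘ opposite)) l))
    ... | ‵inject₁ z = begin
      lookup (l ∷ (tabulate g ∷ʳ r)) (inject₁ (opposite (inject₁ z)))
        ≡⟨ cong (λ k → lookup (l ∷ (tabulate g ∷ʳ r)) (inject₁ k)) (opposite-inject₁ z) ⟩
      lookup (tabulate g ∷ʳ r) (inject₁ (opposite z)) ≡⟨ lookup-∷ʳ-inject₁ (tabulate g) r (opposite z) ⟩
      lookup (tabulate g) (opposite z)                ≡⟨ Vec.lookup∘tabulate g (opposite z) ⟩
      g (opposite z)                                  ≡⟨ Vec.lookup∘tabulate (g ∘ opposite) z ⟨
      lookup (tabulate (g ∘ opposite)) z              ≡⟨ lookup-∷ʳ-inject₁ (tabulate (g ∘ opposite)) l z ⟨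
      lookup (tabulate (g ∘ opposite) ∷ʳ l) (inject₁ z) ∎
      where open ≡-Reasoning

  lookup-reflect : ∀ {n} M (g′ g : Fin n → ℕ) {r′ r} → (∀ i → g′ i + g i ≡ M) → r′ + r ≡ M →
    ∀ x → lookup (tabulate g′ ∷ʳ r′) x + lookup (tabulate g ∷ʳ r) x ≡ M
  lookup-reflect {zero}  M g′ g eg er zero    = er
  lookup-reflect {suc n} M g′ g eg er zero    = eg zero
  lookup-reflect {suc n} M g′ g eg er (suc x) = lookup-reflect M (g′ ∘ suc) (g ∘ suc) (eg ∘ suc) er x

  flipStep : ∀ {m} → Fin m × Fin m → Fin m × Fin m
  flipStep (i , i⁺) = opposite i⁺ , opposite i

  flipStep-injective : ∀ {m} → Injective _≡_ _≡_ (flipStep {m})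
  flipStep-injective e =
    cong₂ _,_ (opposite-injective (cong proj₂ e)) (opposite-injective (cong proj₁ e))

  steps-unique : ∀ m → Unique (steps m)
  steps-unique zero    = []
  steps-unique (suc m) = Unique.map⁺ (Fin.suc-injective ∘ cong proj₂) (Unique.allFin⁺ m)

  flipStep-closed : ∀ {m} {s : Fin m × Fin m} → s ∈ steps m → flipStep s ∈ steps m
  flipStep-closed {suc m} s∈ with k , _ , refl ← ∈-map⁻ (λ i → inject₁ i , suc i) s∈ =
    subst (λ x → (inject₁ (opposite k) , x) ∈ steps (suc m)) (sym (opposite-inject₁ k))
      (∈-map⁺ (λ i → inject₁ i , suc i) (∈-allFin (opposite k)))

  module _ {m} (σ : Permutation′ m) where

    des-ʳ : des (σ ʳ) ≡ asc σ
    des-ʳ = #-reindex (λ (i , i⁺) → σ ⟨$⟩ʳ i Fin.<? σ ⟨$⟩ʳ i⁺) flipStep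
      (steps-unique m) flipStep-injective flipStep-closed

    31-2-ʳ : 31-2 (σ ʳ) ≡ 2-13 σ
    31-2-ʳ = trans
      (#-cong (λ ((i , i⁺) , j) → (i⁺ Fin.<? j) ×-dec (σ ⟨$⟩ʳ opposite i⁺ Fin.<? σ ⟨$⟩ʳ opposite j)
                                   ×-dec (σ ⟨$⟩ʳ opposite j Fin.<? σ ⟨$⟩ʳ opposite i)) (P ∘ Φ)
        (λ ((i , i⁺) , j) → mk⇔ (λ (l , r) → Equivalence.from (opposite-< j i⁺) l , r)
                                 (λ (l , r) → Equivalence.to (opposite-< j i⁺) l , r))
        (cartesianProduct (steps m) (allFin m)))
      (#-reindex P Φ (Unique.cartesianProduct⁺ (steps-unique m) (Unique.allFin⁺ m)) Φ-injective Φ-closed)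
      where
      P : Decidable (λ (((i , i⁺) , j) : (Fin m × Fin m) × Fin m) →
            j Fin.< i × σ ⟨$⟩ʳ i Fin.< σ ⟨$⟩ʳ j × σ ⟨$⟩ʳ j Fin.< σ ⟨$⟩ʳ i⁺)
      P ((i , i⁺) , j) = (j Fin.<? i) ×-dec (σ ⟨$⟩ʳ i Fin.<? σ ⟨$⟩ʳ j) ×-dec (σ ⟨$⟩ʳ j Fin.<? σ ⟨$⟩ʳ i⁺)
      Φ : (Fin m × Fin m) × Fin m → (Fin m × Fin m) × Fin m
      Φ (s , j) = flipStep s , opposite j
      Φ-injective : Injective _≡_ _≡_ Φ
      Φ-injective e = cong₂ _,_ (flipStep-injective (cong proj₁ e)) (opposite-injective (cong proj₂ e))
      Φ-closed : ∀ {x} → x ∈ cartesianProduct (steps m) (allFin m) → Φ x ∈ cartesianProduct (steps m) (allFin m)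
      Φ-closed x∈ = ∈-cartesianProduct⁺ (flipStep-closed (proj₁ (∈-cartesianProduct⁻ (steps m) (allFin m) x∈))) (∈-allFin _)

    -- Reversal exchanges the boundary values 0 and `suc m`, which turns the convention of `ldd`
    -- into that of `rda`.
    ldd-ʳ : ldd (σ ʳ) ≡ rda σ
    ldd-ʳ = trans
      (#-cong
        (λ i → (w′ (inject₁ (suc i)) ℕ.<? w′ (inject₁ (inject₁ i)))
           ×-dec (w′ (suc (suc i)) ℕ.<? w′ (inject₁ (suc i))))
        (P ∘ opposite)
        (λ i → mk⇔
          (λ (a , b) → subst₂ _<_ (sym (last i)) (sym (mid i)) b , subst₂ _<_ (sym (mid i)) (sym (first i)) a)
          (λ (a , b) → subst₂ _<_ (mid i) (first i) b , subst₂ _<_ (last i) (mid i) a))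
        (allFin m))
      (#-reindex P opposite (Unique.allFin⁺ m) opposite-injective (λ _ → ∈-allFin _))
      where
      g : Fin m → ℕ
      g i = suc (toℕ (σ ⟨$⟩ʳ i))
      w w′ : Fin (suc (suc m)) → ℕ
      w = lookup (suc m ∷ (tabulate g ∷ʳ 0))
      w′ = lookup (0 ∷ (tabulate (g ∘ opposite) ∷ʳ suc m))
      P : Decidable (λ i → w (inject₁ (inject₁ i)) < w (inject₁ (suc i)) × w (inject₁ (suc i)) < w (suc (suc i)))
      P i = (w (inject₁ (inject₁ i)) ℕ.<? w (inject₁ (suc i))) ×-dec (w (inject₁ (suc i)) ℕ.<? w (suc (suc i)))
      last : ∀ i → w (inject₁ (inject₁ (opposite i))) ≡ w′ (suc (suc i))
      last i = lookup-reverse g (suc m) 0 (suc (suc i))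
      mid : ∀ i → w (inject₁ (suc (opposite i))) ≡ w′ (inject₁ (suc i))
      mid i = trans (cong w (sym (opposite-inject₁ (suc i)))) (lookup-reverse g (suc m) 0 (inject₁ (suc i)))
      first : ∀ i → w (suc (suc (opposite i))) ≡ w′ (inject₁ (inject₁ i))
      first i = trans (cong w (sym (trans (opposite-inject₁ (inject₁ i)) (cong suc (opposite-inject₁ i)))))
        (lookup-reverse g (suc m) 0 (inject₁ (inject₁ i)))

    σ-reflect : ∀ i j → (σ ᶜ) ⟨$⟩ʳ i Fin.< (σ ᶜ) ⟨$⟩ʳ j ⇔ σ ⟨$⟩ʳ j Fin.< σ ⟨$⟩ʳ i
    σ-reflect i j = opposite-< (σ ⟨$⟩ʳ i) (σ ⟨$⟩ʳ j)

    des-ᶜ : des (σ ᶜ) ≡ asc σ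
    des-ᶜ = #-cong (λ (i , i⁺) → (σ ᶜ) ⟨$⟩ʳ i⁺ Fin.<? (σ ᶜ) ⟨$⟩ʳ i) (λ (i , i⁺) → σ ⟨$⟩ʳ i Fin.<? σ ⟨$⟩ʳ i⁺)
      (λ (i , i⁺) → σ-reflect i⁺ i) (steps m)

    asc-ᶜ : asc (σ ᶜ) ≡ des σ
    asc-ᶜ = #-cong (λ (i , i⁺) → (σ ᶜ) ⟨$⟩ʳ i Fin.<? (σ ᶜ) ⟨$⟩ʳ i⁺) (λ (i , i⁺) → σ ⟨$⟩ʳ i⁺ Fin.<? σ ⟨$⟩ʳ i)
      (λ (i , i⁺) → σ-reflect i i⁺) (steps m)

    31-2-ᶜ : 31-2 (σ ᶜ) ≡ 13-2 σ
    31-2-ᶜ = #-cong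
      (λ ((i , i⁺) , j) → (i⁺ Fin.<? j)
         ×-dec ((σ ᶜ) ⟨$⟩ʳ i⁺ Fin.<? (σ ᶜ) ⟨$⟩ʳ j) ×-dec ((σ ᶜ) ⟨$⟩ʳ j Fin.<? (σ ᶜ) ⟨$⟩ʳ i))
      (λ ((i , i⁺) , j) → (i⁺ Fin.<? j) ×-dec (σ ⟨$⟩ʳ i Fin.<? σ ⟨$⟩ʳ j) ×-dec (σ ⟨$⟩ʳ j Fin.<? σ ⟨$⟩ʳ i⁺))
      (λ ((i , i⁺) , j) → mk⇔
        (λ (p , a , b) → p , Equivalence.to (σ-reflect j i) b , Equivalence.to (σ-reflect i⁺ j) a)
        (λ (p , a , b) → p , Equivalence.from (σ-reflect i⁺ j) b , Equivalence.from (σ-reflect j i) a))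
      (cartesianProduct (steps m) (allFin m))

    2-13-ᶜ : 2-13 (σ ᶜ) ≡ 2-31 σ
    2-13-ᶜ = #-cong
      (λ ((i , i⁺) , j) → (j Fin.<? i)
         ×-dec ((σ ᶜ) ⟨$⟩ʳ i Fin.<? (σ ᶜ) ⟨$⟩ʳ j) ×-dec ((σ ᶜ) ⟨$⟩ʳ j Fin.<? (σ ᶜ) ⟨$⟩ʳ i⁺))
      (λ ((i , i⁺) , j) → (j Fin.<? i) ×-dec (σ ⟨$⟩ʳ i⁺ Fin.<? σ ⟨$⟩ʳ j) ×-dec (σ ⟨$⟩ʳ j Fin.<? σ ⟨$⟩ʳ i))
      (λ ((i , i⁺) , j) → mk⇔
        (λ (p , a , b) → p , Equivalence.to (σ-reflect j i⁺) b , Equivalence.to (σ-reflect i j) a)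
        (λ (p , a , b) → p , Equivalence.from (σ-reflect i j) b , Equivalence.from (σ-reflect j i⁺) a))
      (cartesianProduct (steps m) (allFin m))

    private
      g g′ : Fin m → ℕ
      g i = suc (toℕ (σ ⟨$⟩ʳ i))
      g′ i = suc (toℕ ((σ ᶜ) ⟨$⟩ʳ i))

    module _ {l′ r′ l r : ℕ} (el : l′ + l ≡ suc m) (er : r′ + r ≡ suc m) where
      private
        w w′ : Fin (suc (suc m)) → ℕ
        w = lookup (l ∷ (tabulate g ∷ʳ r))
        w′ = lookup (l′ ∷ (tabulate g′ ∷ʳ r′))
        w-sum : ∀ x → w′ x + w x ≡ suc m
        w-sum zero    = el
        w-sum (suc x) = lookup-reflect (suc m) g′ g (λ i → cong suc (opposite-sum (σ ⟨$⟩ʳ i))) er x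

      -- With values running from 1 to `m`, complementation subtracts from `suc m`. This also
      -- exchanges the boundary values 0 and `suc m`, so the whole bordered word is reflected.
      word-reflect : ∀ x y → w′ x < w′ y ⇔ w y < w x
      word-reflect x y = reflect-< (suc m) (w-sum x) (w-sum y)

    ldd-ᶜ : ldd (σ ᶜ) ≡ rda σ
    ldd-ᶜ = #-cong
      (λ i → (w′ (inject₁ (suc i)) ℕ.<? w′ (inject₁ (inject₁ i)))
           ×-dec (w′ (suc (suc i)) ℕ.<? w′ (inject₁ (suc i))))
      (λ i → (w (inject₁ (inject₁ i)) ℕ.<? w (inject₁ (suc i))) ×-dec (w (inject₁ (suc i)) ℕ.<? w (suc (suc i))))
      (λ i → mk⇔
        (λ (a , b) → Equivalence.to (wr (inject₁ (suc i)) (inject₁ (inject₁ i))) a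
                   , Equivalence.to (wr (suc (suc i)) (inject₁ (suc i))) b)
        (λ (a , b) → Equivalence.from (wr (inject₁ (suc i)) (inject₁ (inject₁ i))) a
                   , Equivalence.from (wr (suc (suc i)) (inject₁ (suc i))) b)) (allFin m)
      where
      w w′ : Fin (suc (suc m)) → ℕ
      w = lookup (suc m ∷ (tabulate g ∷ʳ 0))
      w′ = lookup (0 ∷ (tabulate g′ ∷ʳ suc m))
      wr : ∀ x y → w′ x < w′ y ⇔ w y < w x
      wr = word-reflect refl (ℕ.+-identityʳ (suc m))

    rda-ᶜ : rda (σ ᶜ) ≡ ldd σ
    rda-ᶜ = #-cong
      (λ i → (w′ (inject₁ (inject₁ i)) ℕ.<? w′ (inject₁ (suc i)))
           ×-dec (w′ (inject₁ (suc i)) ℕ.<? w′ (suc (suc i))))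
      (λ i → (w (inject₁ (suc i)) ℕ.<? w (inject₁ (inject₁ i)))
           ×-dec (w (suc (suc i)) ℕ.<? w (inject₁ (suc i))))
      (λ i → mk⇔
        (λ (a , b) → Equivalence.to (wr (inject₁ (inject₁ i)) (inject₁ (suc i))) a
                   , Equivalence.to (wr (inject₁ (suc i)) (suc (suc i))) b)
        (λ (a , b) → Equivalence.from (wr (inject₁ (inject₁ i)) (inject₁ (suc i))) a
                   , Equivalence.from (wr (inject₁ (suc i)) (suc (suc i))) b)) (allFin m)
      where
      w w′ : Fin (suc (suc m)) → ℕ
      w = lookup (0 ∷ (tabulate g ∷ʳ suc m))
      w′ = lookup (suc m ∷ (tabulate g′ ∷ʳ 0))
      wr : ∀ x y → w′ x < w′ y ⇔ w y < w x
      wr = word-reflect (ℕ.+-identityʳ (suc m)) refl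

    module _ {k} {τ τ′ : Vec ℕ k} where

      avoids-ʳ : (∀ x → lookup τ′ x ≡ lookup τ (opposite x)) → Avoids τ′ (σ ʳ) ⇔ Avoids τ σ
      avoids-ʳ τ-rev = mk⇔
        (λ av (v , inc , ord) → av (flipped v , flipped-inc v inc , λ x y → mk⇔
          (λ lt → subst₂ _<_ (sym (τ-rev x)) (sym (τ-rev y)) (Equivalence.to (ord (opposite x) (opposite y))
            (subst₂ Fin._<_ (value v x) (value v y) lt)))
          (λ lt → subst₂ Fin._<_ (sym (value v x)) (sym (value v y)) (Equivalence.from (ord (opposite x) (opposite y))
            (subst₂ _<_ (τ-rev x) (τ-rev y) lt)))))
        (λ av (v , inc , ord) → av (flipped v , flipped-inc v inc , λ x y → mk⇔
          (λ lt → subst₂ _<_ (τ-rev′ x) (τ-rev′ y) (Equivalence.to (ord (opposite x) (opposite y))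
            (subst₂ Fin._<_ (value′ v x) (value′ v y) lt)))
          (λ lt → subst₂ Fin._<_ (sym (value′ v x)) (sym (value′ v y)) (Equivalence.from (ord (opposite x) (opposite y))
            (subst₂ _<_ (sym (τ-rev′ x)) (sym (τ-rev′ y)) lt)))))
        where
        flipped : Vec (Fin m) k → Vec (Fin m) k
        flipped v = tabulate (λ x → opposite (lookup v (opposite x)))
        flipped-lookup : ∀ v x → lookup (flipped v) x ≡ opposite (lookup v (opposite x))
        flipped-lookup v = Vec.lookup∘tabulate (λ x → opposite (lookup v (opposite x)))
        flipped-inc : ∀ v → (∀ a b → a Fin.< b → lookup v a Fin.< lookup v b) →
          ∀ a b → a Fin.< b → lookup (flipped v) a Fin.< lookup (flipped v) b
        flipped-inc v inc a b a<b = subst₂ Fin._<_ (sym (flipped-lookup v a)) (sym (flipped-lookup v b))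
          (Equivalence.from (opposite-< _ _) (inc _ _ (Equivalence.from (opposite-< b a) a<b)))
        value : ∀ v x → (σ ʳ) ⟨$⟩ʳ lookup (flipped v) x ≡ σ ⟨$⟩ʳ lookup v (opposite x)
        value v x = trans (cong ((σ ʳ) ⟨$⟩ʳ_) (flipped-lookup v x)) (cong (σ ⟨$⟩ʳ_) (Fin.opposite-involutive _))
        value′ : ∀ v x → σ ⟨$⟩ʳ lookup (flipped v) x ≡ (σ ʳ) ⟨$⟩ʳ lookup v (opposite x)
        value′ v x = cong (σ ⟨$⟩ʳ_) (flipped-lookup v x)
        τ-rev′ : ∀ x → lookup τ′ (opposite x) ≡ lookup τ x
        τ-rev′ x = trans (τ-rev (opposite x)) (cong (lookup τ) (Fin.opposite-involutive x))

      avoids-ᶜ : ∀ M → (∀ x → lookup τ′ x + lookup τ x ≡ M) → Avoids τ′ (σ ᶜ) ⇔ Avoids τ σ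
      avoids-ᶜ M τ-sum = mk⇔
        (λ av (v , inc , ord) → av (v , inc , λ x y → mk⇔
          (λ lt → Equivalence.from (τ-reflect x y) (Equivalence.to (ord y x) (Equivalence.to (σ-reflect _ _) lt)))
          (λ lt → Equivalence.from (σ-reflect _ _) (Equivalence.from (ord y x) (Equivalence.to (τ-reflect x y) lt)))))
        (λ av (v , inc , ord) → av (v , inc , λ x y → mk⇔
          (λ lt → Equivalence.to (τ-reflect y x) (Equivalence.to (ord y x) (Equivalence.from (σ-reflect _ _) lt)))
          (λ lt → Equivalence.to (σ-reflect _ _) (Equivalence.from (ord y x) (Equivalence.from (τ-reflect y x) lt)))))
        where
        τ-reflect : ∀ x y → lookup τ′ x < lookup τ′ y ⇔ lookup τ y < lookup τ x
        τ-reflect x y = reflect-< M (τ-sum x) (τ-sum y)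

-- Sums over permutations

module _ {c ℓ} (R : CommutativeRing c ℓ) where

  private module R = CommutativeRing R
  open R using (Carrier; _+_; _*_; 0#; 1#) renaming (_≈_ to _≋_)
  open GeneratingFunctions R
  open PathSums R using (Σ<; module Motzkin; module Restricted; module Contraction)
  open CodeSums R using (Σcode)
  open import Relation.Binary.Reasoning.Setoid R.setoid

  module _ {a} {A : Set a} where

    ∑-cong : ∀ (xs : List A) {F G : A → Carrier} → (∀ x → F x ≋ G x) → ∑ xs F ≋ ∑ xs G
    ∑-cong []       F≋G = R.refl
    ∑-cong (x ∷ xs) F≋G = R.+-cong (F≋G x) (∑-cong xs F≋G)

    ∑-++ : ∀ (xs ys : List A) F → ∑ (xs ++ ys) F ≋ ∑ xs F + ∑ ys F
    ∑-++ []       ys F = R.sym (R.+-identityˡ _)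
    ∑-++ (x ∷ xs) ys F = R.trans (R.+-congˡ (∑-++ xs ys F)) (R.sym (R.+-assoc _ _ _))

    ∑-map : ∀ {b} {B : Set b} (g : B → A) xs F → ∑ (map g xs) F ≡ ∑ xs (F ∘ g)
    ∑-map g xs F = ≡.cong (foldr _+_ 0#) (≡.sym (List.map-∘ xs))

    ∑-filter : ∀ {p} {P : A → Set p} (P? : Decidable P) xs F →
      ∑ (filter P? xs) F ≋ ∑ xs (λ x → if does (P? x) then F x else 0#)
    ∑-filter P? []       F = R.refl
    ∑-filter P? (x ∷ xs) F with does (P? x)
    ... | true  = R.+-congˡ (∑-filter P? xs F)
    ... | false = R.trans (∑-filter P? xs F) (R.sym (R.+-identityˡ _))

    ∑-tabulate : ∀ n (g : Fin n → A) F G → (∀ i → F (g i) ≋ G (toℕ i)) → ∑ (List.tabulate g) F ≋ Σ< n G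
    ∑-tabulate zero    g F G F≋G = R.refl
    ∑-tabulate (suc n) g F G F≋G = R.+-cong (F≋G zero) (∑-tabulate n (g ∘ suc) F (G ∘ suc) (F≋G ∘ suc))

    ∑-applyUpTo : ∀ n (g : ℕ → A) F → ∑ (applyUpTo g n) F ≡ Σ< n (F ∘ g)
    ∑-applyUpTo zero    g F = ≡.refl
    ∑-applyUpTo (suc n) g F = ≡.cong (F (g 0) +_) (∑-applyUpTo n (g ∘ suc) F)

  ∑-cartesianProductWith : ∀ {a b d} {A : Set a} {B : Set b} {D : Set d} (g : A → B → D) xs ys F →
    ∑ (cartesianProductWith g xs ys) F ≋ ∑ xs (λ x → ∑ ys (λ y → F (g x y)))
  ∑-cartesianProductWith g []       ys F = R.refl
  ∑-cartesianProductWith g (x ∷ xs) ys F = R.trans (∑-++ (map (g x) ys) _ F)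
    (R.+-cong (R.reflexive (∑-map (g x) ys F)) (∑-cartesianProductWith g xs ys F))

  ∑-code : ∀ m F → ∑[ σ ∈ 𝔖 m ] F (code m σ) ≋ Σcode m F
  ∑-code zero    F = R.+-identityʳ _
  ∑-code (suc m) F = R.trans
    (∑-cartesianProductWith (insert zero) (allFin (suc m)) (𝔖 m) _)
    (∑-tabulate (suc m) (λ j → j) _ (λ j → Σcode m (F ∘ (j ∷_))) λ j → R.trans
      (∑-cong (𝔖 m) λ ρ → R.reflexive (≡.cong F (code-insert j ρ)))
      (∑-code m (F ∘ (toℕ j ∷_))))

  -- Permutations with the same values need not be identical, so the image of `𝔖 m` under `φ` is a
  -- rearrangement of `𝔖 m` only up to pointwise equality, which `F` has to respect.
  ∑-𝔖-reindex : ∀ m (φ : Permutation′ m → Permutation′ m) → (∀ {σ π} → φ σ ≈ₚ φ π → σ ≈ₚ π) →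
    ∀ F → (∀ {σ π} → σ ≈ₚ π → F σ ≋ F π) → ∑ (𝔖 m) (F ∘ φ) ≋ ∑ (𝔖 m) F
  ∑-𝔖-reindex m φ φ-inj F F-cong = begin
    ∑ (𝔖 m) (F ∘ φ)       ≡⟨ ∑-map φ (𝔖 m) F ⟨
    ∑ (map φ (𝔖 m)) F
      ≈⟨ SetoidPermutationₚ.foldr-commMonoid R.setoid R.+-isCommutativeMonoid
           (SetoidPermutationₚ.map⁺ (≈-setoid m) R.setoid (λ {σ} {π} → F-cong {σ} {π})
             (unique∧⊆⇒↭ (≈-setoid m)
               (UniqueSetoidₚ.map⁺ (≈-setoid m) (≈-setoid m) (λ {σ} {π} → φ-inj {σ} {π}) (𝔖-unique m))
               (λ {σ} _ → 𝔖-complete m σ) (List.length-map φ (𝔖 m)))) ⟩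
    ∑ (𝔖 m) F             ∎

  if-cong : ∀ {p r} {P : Set p} {Q : Set r} (P? : Dec P) (Q? : Dec Q) {x y : Carrier} → P ⇔ Q → x ≋ y →
    (if does P? then x else 0#) ≋ (if does Q? then y else 0#)
  if-cong (yes p) (yes q) e x≋y = x≋y
  if-cong (no ¬p) (no ¬q) e x≋y = R.refl
  if-cong (yes p) (no ¬q) e x≋y = contradiction (Equivalence.to e p) ¬q
  if-cong (no ¬p) (yes q) e x≋y = contradiction (Equivalence.from e q) ¬p

  ∑-321 : ∀ m q z f → ∑[ σ ∈ 𝔖[ pat321 ] m ] (f (exc σ) * (z ^ cda σ * q ^ inv σ)) ≋ Motzkin.E q z f m 0
  ∑-321 m q z f = begin
    _ ≈⟨ ∑-filter (avoids? pat321) (𝔖 m) _ ⟩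
    _ ≈⟨ ∑-cong (𝔖 m) (λ σ → Sum321.val-code R q z m σ f) ⟩
    _ ≈⟨ ∑-code m (CodeSums.Code321.val R q z f []) ⟩
    _ ≈⟨ CodeSums.Code321.Σcode-val R q z m f [] z≤n ⟩
    Motzkin.E q z f m 0 ∎

  module _ (m k : ℕ) (q : Carrier) where

    open Restricted q using (E; δ)

    -- 0# ^ d is the indicator of d = 0.
    indicator : ∀ e d x → (if does ((e ℕ.≟ k) ×-dec (d ℕ.≟ 0)) then x else 0#) ≋ δ k e * (0# ^ d * x)
    indicator e d x = if-elim R ((e ℕ.≟ k) ×-dec (d ℕ.≟ 0))
      (λ { (≡.refl , ≡.refl) → R.sym (R.trans
         (R.*-cong (R.reflexive (δ-refl e)) (R.*-identityˡ x)) (R.*-identityˡ x)) })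
      (λ ¬ed → R.sym (vanish ¬ed))
      where
      δ-refl : ∀ k → δ k k ≡ 1#
      δ-refl k rewrite dec-true (k ℕ.≟ k) ≡.refl = ≡.refl
      δ-≢ : ¬ k ≡ e → δ k e ≡ 0#
      δ-≢ ≢ rewrite dec-false (k ℕ.≟ e) ≢ = ≡.refl
      power : ∀ d → ¬ d ≡ 0 → 0# ^ d ≋ 0#
      power zero    ≢ = contradiction ≡.refl ≢
      power (suc d) ≢ = R.zeroˡ _
      vanish : ¬ (e ≡ k × d ≡ 0) → δ k e * (0# ^ d * x) ≋ 0#
      vanish ¬ed with e ℕ.≟ k
      ... | yes e≡k = R.trans
        (R.*-congˡ (R.trans (R.*-congʳ (power d λ d≡0 → ¬ed (e≡k , d≡0))) (R.zeroˡ x))) (R.zeroʳ _)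
      ... | no  e≢k = R.trans (R.*-congʳ (R.reflexive (δ-≢ (e≢k ∘ ≡.sym)))) (R.zeroˡ _)

    ∑-restricted : ∀ {l} (τ : Vec ℕ l) (st dd w : Permutation′ m → ℕ) →
      ∑ (filter (λ σ → (st σ ℕ.≟ k) ×-dec (dd σ ℕ.≟ 0)) (𝔖[ τ ] m)) (λ σ → q ^ w σ) ≋
      ∑[ σ ∈ 𝔖 m ] (if does (avoids? τ σ) then δ k (st σ) * (0# ^ dd σ * q ^ w σ) else 0#)
    ∑-restricted τ st dd w = R.trans
      (∑-filter (λ σ → (st σ ℕ.≟ k) ×-dec (dd σ ℕ.≟ 0)) (𝔖[ τ ] m) _)
      (R.trans (∑-cong (𝔖[ τ ] m) λ σ → indicator (st σ) (dd σ) (q ^ w σ))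
               (∑-filter (avoids? τ) (𝔖 m) _))

    γ≋E : γ m k q ≋ E (δ k) m 0
    γ≋E = begin
      γ m k q ≈⟨ ∑-restricted pat321 exc cda inv ⟩
      _       ≈⟨ ∑-filter (avoids? pat321) (𝔖 m) _ ⟨
      _       ≈⟨ ∑-321 m q 0# (δ k) ⟩
      E (δ k) m 0 ∎

    W : Permutation′ m → Carrier
    W σ = CodeSums.Code231.val R q (δ k) false 0 (m ∷ []) (code m σ)

    ∑W≋γ : ∑ (𝔖 m) W ≋ γ m k q
    ∑W≋γ = begin
      ∑ (𝔖 m) W  ≈⟨ ∑-code m (CodeSums.Code231.val R q (δ k) false 0 (m ∷ [])) ⟩
      _          ≈⟨ CodeSums.Code231.Σcode-val R q m (δ k) ⟩
      E (δ k) m 0 ≈⟨ γ≋E ⟨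
      γ m k q    ∎

    -- Transport along a symmetry φ of the square that takes τ to 231.
    γ-symmetric : (φ : Permutation′ m → Permutation′ m) → (∀ {σ π} → φ σ ≈ₚ φ π → σ ≈ₚ π) →
      ∀ {l} (τ : Vec ℕ l) (st dd w : Permutation′ m → ℕ) →
      (∀ σ → Avoids pat231 (φ σ) ⇔ Avoids τ σ) →
      (∀ σ → des (φ σ) ≡ st σ) → (∀ σ → ldd (φ σ) ≡ dd σ) → (∀ σ → 31-2 (φ σ) ≡ w σ) →
      γ m k q ≋ ∑ (filter (λ σ → (st σ ℕ.≟ k) ×-dec (dd σ ℕ.≟ 0)) (𝔖[ τ ] m)) (λ σ → q ^ (w σ ℕ.+ st σ))
    γ-symmetric φ φ-inj τ st dd w av e₁ e₂ e₃ = R.sym (begin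
      _ ≈⟨ ∑-restricted τ st dd (λ σ → w σ ℕ.+ st σ) ⟩
      _ ≈⟨ ∑-cong (𝔖 m) (λ σ → R.trans
             (R.sym (if-cong (avoids? pat231 (φ σ)) (avoids? τ σ) (av σ)
               (R.reflexive (≡.cong₂ _*_ (≡.cong (δ k) (e₁ σ))
                 (≡.cong₂ (λ a b → 0# ^ a * q ^ b) (e₂ σ) (≡.cong₂ ℕ._+_ (e₃ σ) (e₁ σ)))))))
             (Sum231.val-code R q m (φ σ) (δ k))) ⟩
      ∑ (𝔖 m) (W ∘ φ) ≈⟨ ∑-𝔖-reindex m φ (λ {σ} {π} → φ-inj {σ} {π}) W
             (λ {σ} {π} e → R.reflexive (≡.cong (CodeSums.Code231.val R q (δ k) false 0 (m ∷ []))
               (code-cong m {σ} {π} e))) ⟩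
      ∑ (𝔖 m) W ≈⟨ ∑W≋γ ⟩
      γ m k q ∎)

    ʳ-injective : ∀ {σ π : Permutation′ m} → (σ ʳ) ≈ₚ (π ʳ) → σ ≈ₚ π
    ʳ-injective {σ} {π} e i = ≡.subst (λ x → σ ⟨$⟩ʳ x ≡ π ⟨$⟩ʳ x) (Fin.opposite-involutive i) (e (Fin.opposite i))

    ᶜ-injective : ∀ {σ π : Permutation′ m} → (σ ᶜ) ≈ₚ (π ᶜ) → σ ≈ₚ π
    ᶜ-injective e i = opposite-injective (e i)

    231→132 : ∀ (σ : Permutation′ m) → Avoids pat231 (σ ʳ) ⇔ Avoids pat132 σ
    231→132 σ = avoids-ʳ σ {τ = pat132} {pat231} (λ { 0F → ≡.refl ; 1F → ≡.refl ; 2F → ≡.refl })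

    γ-231 : γ m k q ≋ (∑[ π ∈ 𝔖̃231 m k ] (q ^ (31-2 π ℕ.+ des π)))
    γ-231 = γ-symmetric (λ σ → σ) (λ e → e) pat231 des ldd 31-2 (λ _ → mk⇔ (λ a → a) (λ a → a))
      (λ _ → ≡.refl) (λ _ → ≡.refl) (λ _ → ≡.refl)

    γ-132 : γ m k q ≋ (∑[ π ∈ 𝔖̃132 m k ] (q ^ (2-13 π ℕ.+ asc π)))
    γ-132 = γ-symmetric _ʳ (λ {σ} {π} → ʳ-injective {σ} {π}) pat132 asc rda 2-13 231→132 des-ʳ ldd-ʳ 31-2-ʳ

    γ-213 : γ m k q ≋ (∑[ π ∈ 𝔖̃213 m k ] (q ^ (13-2 π ℕ.+ asc π)))
    γ-213 = γ-symmetric _ᶜ (λ {σ} {π} → ᶜ-injective {σ} {π}) pat213 asc rda 13-2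
      -- The pattern entries are 1, 2, 3, so complementary entries add up to 4.
      (λ σ → avoids-ᶜ σ {τ = pat213} {pat231} 4 (λ { 0F → ≡.refl ; 1F → ≡.refl ; 2F → ≡.refl }))
      des-ᶜ ldd-ᶜ 31-2-ᶜ

    γ-312 : γ m k q ≋ (∑[ π ∈ 𝔖̃312 m k ] (q ^ (2-31 π ℕ.+ des π)))
    γ-312 = γ-symmetric (λ σ → (σ ᶜ) ʳ)
      (λ {σ} {π} e → ᶜ-injective {σ} {π} (ʳ-injective {σ ᶜ} {π ᶜ} e)) pat312 des ldd 2-31
      -- Complementation takes 312 to 132, and reversal takes 132 to 231.
      (λ σ → avoids-ᶜ σ {τ = pat312} {pat132} 4 (λ { 0F → ≡.refl ; 1F → ≡.refl ; 2F → ≡.refl }) ⇔-∘ 231→132 (σ ᶜ))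
      (λ σ → ≡.trans (des-ʳ (σ ᶜ)) (asc-ᶜ σ))
      (λ σ → ≡.trans (ldd-ʳ (σ ᶜ)) (rda-ᶜ σ))
      (λ σ → ≡.trans (31-2-ʳ (σ ᶜ)) (2-13-ᶜ σ))

  1^ : ∀ n → 1# ^ n ≋ 1#
  1^ zero    = R.refl
  1^ (suc n) = R.trans (R.*-identityˡ _) (1^ n)

  N-expansion : ∀ m (t q q⁻¹ : Carrier) → q * q⁻¹ ≋ 1# →
    N (suc m) (t * q⁻¹) q 1# ≋
      (∑[ k ∈ upTo (suc ⌊ m /2⌋) ] (γ m k q * t ^ k * (1# + t) ^ (m ∸ 2 ℕ.* k)))
  N-expansion m t q q⁻¹ qq⁻¹ = begin
    N (suc m) x q 1#
      ≈⟨ ∑-cong (𝔖[ pat321 ] (suc m)) (λ σ → begin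
           x ^ exc σ * q ^ inv σ * 1# ^ fix σ    ≈⟨ R.*-congˡ (1^ (fix σ)) ⟩
           x ^ exc σ * q ^ inv σ * 1#            ≈⟨ R.*-identityʳ _ ⟩
           x ^ exc σ * q ^ inv σ                 ≈⟨ R.*-congˡ (R.*-identityˡ (q ^ inv σ)) ⟨
           -- The trivial factor `1# ^ cda σ` gives the summand the form of `∑-321` at `z = 1#`.
           x ^ exc σ * (1# * q ^ inv σ)          ≈⟨ R.*-congˡ (R.*-congʳ (1^ (cda σ))) ⟨
           x ^ exc σ * (1# ^ cda σ * q ^ inv σ)  ∎) ⟩
    _ ≈⟨ ∑-321 (suc m) q 1# (x ^_) ⟩
    _ ≈⟨ γ-expansion m ⟩
    Σ< (suc ⌊ m /2⌋) (λ k → Restricted.E q (Restricted.δ q k) m 0 * t ^ k * (1# + t) ^ (m ∸ 2 ℕ.* k))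
      ≡⟨ ∑-applyUpTo (suc ⌊ m /2⌋) (λ k → k) _ ⟨
    _ ≈⟨ ∑-cong (upTo (suc ⌊ m /2⌋)) (λ k → R.*-congʳ (R.*-congʳ (R.sym (γ≋E m k q)))) ⟩
    _ ∎
    where
    open Contraction t q q⁻¹ qq⁻¹ using (x; γ-expansion)

theorem3p13 : ∀ {c ℓ} (R : CommutativeRing c ℓ) →
    let open CommutativeRing R
        open GeneratingFunctions R in
    ∀ (n : ℕ) → 1 ≤ n →
      (∀ (t q q⁻¹ : Carrier) → q * q⁻¹ ≈ 1# →
         N n (t * q⁻¹) q 1#
           ≈ (∑[ k ∈ upTo (suc ⌊ n ∸ 1 /2⌋) ]
                (γ (n ∸ 1) k q * t ^ k * (1# + t) ^ (n ∸ 1 ∸ 2 ℕ.* k))))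
      ×
      (∀ (q : Carrier) (k : ℕ) → k ≤ ⌊ n ∸ 1 /2⌋ →
         (γ (n ∸ 1) k q ≈ (∑[ π ∈ 𝔖̃231 (n ∸ 1) k ] (q ^ (31-2 π ℕ.+ des π))))
         × (γ (n ∸ 1) k q ≈ (∑[ π ∈ 𝔖̃312 (n ∸ 1) k ] (q ^ (2-31 π ℕ.+ des π))))
         × (γ (n ∸ 1) k q ≈ (∑[ π ∈ 𝔖̃132 (n ∸ 1) k ] (q ^ (2-13 π ℕ.+ asc π))))
         × (γ (n ∸ 1) k q ≈ (∑[ π ∈ 𝔖̃213 (n ∸ 1) k ] (q ^ (13-2 π ℕ.+ asc π)))))
theorem3p13 R (suc m) _ = N-expansion R m ,
  λ q k _ → γ-231 R m k q , γ-312 R m k q , γ-132 R m k q , γ-213 R m k q
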